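{- Let $B\ge 2$, $d\ge1$ be integers and let $L\in\mathbb{C}^{1\times d}$, $A_0,\dots,A_{B-1}\in\mathbb{C}^{d\times d}$, $C\in\mathbb{C}^d$ be a linear representation of a rational formal power series. Let $Q=\sum_{0\le r<B}A_r$ and let $\lambda_*$ be the joint spectral radius of $(A_r)_{0\le r<B}$. For $v\in\mathbb{C}^d$ let $\mathbf S_K^{v}(x)=\sum_{|w|=K,\ (0.w)_B\le x}A_wv$, $x\in[0,1]$. (a) Suppose $V$ is a generalized eigenvector of $Q$ of height $\nu$ for an eigenvalue $\rho\omega$, where $\rho>\lambda_*$ and $|\omega|=1$, with associated linearly independent family $(V^{(j)})_{0\le j<\nu}$, $V^{(\nu-1)}=V$, $QV^{(j)}=\rho\omega V^{(j)}+V^{(j-1)}$ for $0<j<\nu$, $QV^{(0)}=\rho\omega V^{(0)}$ (so that $Q^KV=\sum_{\ell=0}^{\nu-1}\binom K\ell(\rho\omega)^{K-\ell}V^{(\nu-1-\ell)}$). Then there is a unique family $(\mathbf F^{(j)})_{0\le j<\nu}$ of continuous functions $[0,1]\to\mathbb{C}^d$ with $\mathbf F^{(j)}(0)=0$, $\mathbf F^{(j)}(1)=V^{(j)}$ and, for all $x\in[0,1)$ with $x_1=\lfloor Bx\rfloor$, $$\rho\omega\,\mathbf F^{(0)}(x)=\sum_{r<x_1}A_rV^{(0)}+A_{x_1}\mathbf F^{(0)}(Bx-x_1),$$ $$\mathbf F^{(j-1)}(x)+\rho\omega\,\mathbf F^{(j)}(x)=\sum_{r<x_1}A_rV^{(j)}+A_{x_1}\mathbf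 F^{(j)}(Bx-x_1)\qquad(1\le j<\nu);$$ and, for every $\lambda>\lambda_*$, as $K\to+\infty$, $$\mathbf S^{V}_K(x)=\mathbf A_{V;K}(x)+O(\lambda^K),\qquad \mathbf A_{V;K}(x):=\sum_{\ell=0}^{\nu-1}\binom K\ell(\rho\omega)^{K-\ell}\,\mathbf F^{(\nu-1-\ell)}(x),$$ uniformly for $x\in[0,1]$. (b) For arbitrary $C$, let $\mathcal V$ be a Jordan basis for $Q$ and write $C=\sum_{V\in\mathcal V}\gamma_VV$. Then for every $\lambda>\lambda_*$, as $K\to+\infty$, $$\mathbf S_K^{C}(x)=\sum_{V\in\mathcal V,\ \rho_V>\lambda_*}\gamma_V\,\mathbf A_{V;K}(x)+O(\lambda^K)$$ uniformly for $x\in[0,1]$, where $\rho_V$ is the modulus of the eigenvalue associated with $V$. Thus $\mathbf S_K^C(x)$ has an asymptotic expansion in the scale $\rho^K\binom K\ell$ ($\rho>0$, $\ell\in\mathbb{N}_{\ge0}$) with error term $O(\lambda^K)$ uniform in $x$. (c) If moreover $\lambda_*$ is attained, let $m$ be the maximal height of those $V\in\mathcal V$ with $\rho_V=\lambda_*$ and $\gamma_V\ne0$ (with $m=0$ if there is none). Then the error term in (b) may be replaced by $O(\lambda_*^KK^m)$, uniformly in $x\in[0,1]$.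
   Context: Words $w=w_1\cdots w_K$ are over the alphabet $\{0,\dots,B-1\}$, $|w|=K$ is the length, $A_w=A_{w_1}\cdots A_{w_K}$ (identity for the empty word), $(0.w)_B=\sum_{i=1}^K w_iB^{ -i}$. The rational formal power series represented by $L,(A_r),C$ is the map $w\mapsto LA_wC$. The joint spectral radius is $\lambda_*=\lim_{T\to\infty}\lambda_T$ with $\lambda_T=\max_{|w|=T}\|A_w\|^{1/T}$ for any induced matrix norm (it does not depend on the norm). One says $\lambda_*$ is attained if there are an induced norm and an integer $T\ge1$ with $\lambda_*=\lambda_T$. A Jordan basis for $Q$ is a basis of $\mathbb{C}^d$ that is a disjoint union of chains $(V^{(j)})_{0\le j<\nu}$ with $QV^{(0)}=\mu V^{(0)}$ and $QV^{(j)}=\mu V^{(j)}+V^{(j-1)}$ for $j>0$ ($\mu$ is the eigenvalue associated with each vector of the chain). The height of a generalized eigenvector is the dimension of the subspace it spans under the action of $Q$; in a chain, $V^{(j)}$ has height $j+1$, and its associated family is $(V^{(0)},\dots,V^{(j)})$. Terms with $\binom K\ell=0$ are read as $0$. -}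

module Defs where

open import Algebra.Bundles using (CommutativeRing; RawRing; Semiring)
open import Axiom.ExcludedMiddle using (ExcludedMiddle)
open import Data.Bool.Base using (if_then_else_)
open import Data.Empty using (⊥-elim)
open import Data.Fin.Base using (Fin; toℕ; inject; inject≤; opposite)
open import Data.Fin.Properties using (toℕ<n; _≟_)
open import Data.List.Base as List using (List; []; _∷_)
open import Data.Nat.Base as ℕ using (ℕ; zero; suc; _∸_)
open import Data.Nat.Combinatorics using (_C_)
open import Data.Product.Base using (Σ-syntax; ∃; ∃-syntax; _×_; _,_; proj₁)
open import Data.Sum.Base using (_⊎_; inj₁; inj₂)
open import Data.Vec.Base as Vec using (Vec; []; _∷_)
open import Level using (0ℓ)
open import Relation.Binary.Bundles using (Setoid; TotalOrder)
open import Relation.Binary.PropositionalEquality.Core using (_≡_)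
open import Relation.Binary.Structures using (IsTotalOrder)
open import Relation.Nullary using (¬_; does; yes; no)
import Algebra.Construct.NaturalChoice.Max as Max
import Algebra.Definitions.RawSemiring as RawSemiringOps
import Algebra.Properties.Ring as RingProperties
import Data.List.Extrema as Extrema
import Data.Vec.Functional.Relation.Binary.Equality.Setoid as VectorEquality
import Relation.Binary.Construct.NonStrictToStrict as ToStrict
import Relation.Binary.Reasoning.Setoid as SetoidReasoning

-- The real numbers, characterised up to isomorphism as a complete ordered
-- field.

record CompleteOrderedField : Set₁ where
  infix  4 _≤_
  infix  9 _⁻¹
  field
    commutativeRing : CommutativeRing 0ℓ 0ℓ

  open CommutativeRing commutativeRing public

  field
    -- The value of 0# ⁻¹ is irrelevant.
    _⁻¹        : Carrier → Carrier
    0≉1        : ¬ 0# ≈ 1#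
    ⁻¹-inverse : ∀ x → ¬ x ≈ 0# → x * x ⁻¹ ≈ 1#

    _≤_           : Carrier → Carrier → Set
    isTotalOrder  : IsTotalOrder _≈_ _≤_
    +-monoˡ-≤     : ∀ {x y} z → x ≤ y → x + z ≤ y + z
    *-nonNegative : ∀ {x y} → 0# ≤ x → 0# ≤ y → 0# ≤ x * y

  UpperBound : (Carrier → Set) → Carrier → Set
  UpperBound P b = ∀ x → P x → x ≤ b

  IsSupremum : (Carrier → Set) → Carrier → Set
  IsSupremum P s = UpperBound P s × (∀ b → UpperBound P b → s ≤ b)

  field
    complete : ∀ P → ∃ P → ∃ (UpperBound P) → ∃ (IsSupremum P)

-- Everything below is relative to classical logic and a model R of the reals.

module Analysis (em : ExcludedMiddle 0ℓ) (R : CompleteOrderedField) where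

  open CompleteOrderedField R public
    using (_≈_; _+_; _*_; -_; _-_; 0#; 1#; _⁻¹; _≤_; complete; IsSupremum; UpperBound)
    renaming (Carrier to ℝ)

  private
    module R = CompleteOrderedField R
    module O = IsTotalOrder R.isTotalOrder

  open RawSemiringOps (Semiring.rawSemiring R.semiring) public using (_^_; sum)
    renaming (_×_ to _×ℝ_)

  totalOrder : TotalOrder 0ℓ 0ℓ 0ℓ
  totalOrder = record { isTotalOrder = R.isTotalOrder }

  open Max totalOrder public using (_⊔_)
  open ToStrict _≈_ _≤_ public using (_<_)

  ofℕ : ℕ → ℝ
  ofℕ n = n ×ℝ 1#

  ∣_∣ℝ : ℝ → ℝ
  ∣ x ∣ℝ = x ⊔ (- x)

  -- The least upper bound, with value 0# when there is none.
  sup : (ℝ → Set) → ℝ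
  sup P with em {∃ P × ∃ (UpperBound P)}
  ... | yes (inhabited , bounded) = proj₁ (complete P inhabited bounded)
  ... | no  _                     = 0#

  -- root n a is the non-negative n-th root of a, for n ≥ 1 and a ≥ 0.
  root : ℕ → ℝ → ℝ
  root n a = sup (λ x → 0# ≤ x × x ^ n ≤ a)

  Tendsto : (ℕ → ℝ) → ℝ → Set
  Tendsto a l = ∀ ε → 0# < ε → ∃[ N ] ∀ n → N ℕ.≤ n → ∣ a n - l ∣ℝ < ε

  infix 6 _+i_
  record ℂ : Set where
    constructor _+i_
    field
      re im : ℝ
  open ℂ public

  ofℝ : ℝ → ℂ
  ofℝ x = x +i 0#

  ℂ-rawRing : RawRing 0ℓ 0ℓ
  ℂ-rawRing = record
    { Carrier = ℂ
    ; _≈_     = λ z w → re z ≈ re w × im z ≈ im w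
    ; _+_     = λ z w → (re z + re w) +i (im z + im w)
    ; _*_     = λ z w → (re z * re w - im z * im w) +i (re z * im w + im z * re w)
    ; -_      = λ z → (- re z) +i (- im z)
    ; 0#      = 0# +i 0#
    ; 1#      = 1# +i 0#
    }

  open RawRing ℂ-rawRing public using ()
    renaming (_≈_ to _≈ᶜ_; _+_ to _+ᶜ_; _*_ to _*ᶜ_; -_ to -ᶜ_; 0# to 0ᶜ; 1# to 1ᶜ)
  open RawSemiringOps (RawRing.rawSemiring ℂ-rawRing) public using ()
    renaming (_^_ to _^ᶜ_; _×_ to _×ᶜ_; sum to ∑ᶜ)

  ℂ-setoid : Setoid 0ℓ 0ℓ
  ℂ-setoid = record
    { Carrier       = ℂ
    ; _≈_           = _≈ᶜ_
    ; isEquivalence = record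
      { refl  = R.refl , R.refl
      ; sym   = λ { (p , q) → R.sym p , R.sym q }
      ; trans = λ { (p , q) (p′ , q′) → R.trans p p′ , R.trans q q′ }
      }
    }

  ∣_∣ : ℂ → ℝ
  ∣ z ∣ = root 2 (re z * re z + im z * im z)

  infixl 6 _+ᵛ_ _-ᵛ_
  infixr 7 _•_ _⊙_ _⊡_
  infixr 8 _^ᴹ_

  ℂ^ : ℕ → Set
  ℂ^ d = Fin d → ℂ

  Matrix : ℕ → Set
  Matrix d = Fin d → Fin d → ℂ

  open VectorEquality ℂ-setoid public using (_≋_)

  0ᵛ : ∀ {d} → ℂ^ d
  0ᵛ _ = 0ᶜ

  _+ᵛ_ _-ᵛ_ : ∀ {d} → ℂ^ d → ℂ^ d → ℂ^ d
  (u +ᵛ v) i = u i +ᶜ v i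
  (u -ᵛ v) i = u i +ᶜ (-ᶜ v i)

  _•_ : ∀ {d} → ℂ → ℂ^ d → ℂ^ d
  (z • v) i = z *ᶜ v i

  ∑ : ∀ {d n} → (Fin n → ℂ^ d) → ℂ^ d
  ∑ f i = ∑ᶜ (λ j → f j i)

  ∑∑ : ∀ {d c} (ν : Fin c → ℕ) → ((k : Fin c) → Fin (ν k) → ℂ^ d) → ℂ^ d
  ∑∑ ν f = ∑ (λ k → ∑ (f k))

  ∑ᴸ : ∀ {d} {X : Set} → (X → ℂ^ d) → List X → ℂ^ d
  ∑ᴸ f = List.foldr (λ x s → f x +ᵛ s) 0ᵛ

  _when_ : ∀ {d} → ℂ^ d → Set → ℂ^ d
  v when P = if does (em {P}) then v else 0ᵛ

  _⊙_ : ∀ {d} → Matrix d → ℂ^ d → ℂ^ d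
  (M ⊙ v) i = ∑ᶜ (λ j → M i j *ᶜ v j)

  _⊡_ : ∀ {d} → Matrix d → Matrix d → Matrix d
  (M ⊡ N) i k = ∑ᶜ (λ j → M i j *ᶜ N j k)

  1ᴹ : ∀ {d} → Matrix d
  1ᴹ i j = if does (i ≟ j) then 1ᶜ else 0ᶜ

  _^ᴹ_ : ∀ {d} → Matrix d → ℕ → Matrix d
  M ^ᴹ zero  = 1ᴹ
  M ^ᴹ suc n = M ⊡ (M ^ᴹ n)

  ∑ᴹ : ∀ {d n} → (Fin n → Matrix d) → Matrix d
  ∑ᴹ f i j = ∑ᶜ (λ k → f k i j)

  shift : ∀ {d} → Matrix d → ℂ → Matrix d
  shift M μ i j = M i j +ᶜ (-ᶜ (μ *ᶜ 1ᴹ i j))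

  LinearlyIndependent : ∀ {d n} → (Fin n → ℂ^ d) → Set
  LinearlyIndependent {n = n} b = (a : Fin n → ℂ) → ∑ (λ j → a j • b j) ≋ 0ᵛ → ∀ j → a j ≈ᶜ 0ᶜ

  InSpan : ∀ {d n} → (Fin n → ℂ^ d) → ℂ^ d → Set
  InSpan {n = n} b v = Σ[ a ∈ (Fin n → ℂ) ] v ≋ ∑ (λ j → a j • b j)

  HasDimension : ∀ {d} → (ℂ^ d → Set) → ℕ → Set
  HasDimension {d} W h = Σ[ b ∈ (Fin h → ℂ^ d) ]
    (∀ j → W (b j)) × LinearlyIndependent b × (∀ v → W v → InSpan b v)

  -- The subspace spanned by v under the action of Q.
  Cyclic : ∀ {d} → Matrix d → ℂ^ d → ℂ^ d → Set
  Cyclic Q v u = ∃[ n ] InSpan {n = n} (λ k → (Q ^ᴹ toℕ k) ⊙ v) u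

  IsGeneralizedEigenvector : ∀ {d} → Matrix d → ℂ → ℂ^ d → Set
  IsGeneralizedEigenvector Q μ v =
    ¬ v ≋ 0ᵛ × ∃[ p ] (shift Q μ ^ᴹ p) ⊙ v ≋ 0ᵛ

  HasHeight : ∀ {d} → Matrix d → ℂ^ d → ℕ → Set
  HasHeight Q v h = HasDimension (Cyclic Q v) h

  record IsJordanChain {d ν} (Q : Matrix d) (μ : ℂ) (V : Fin ν → ℂ^ d) : Set where
    field
      base : ∀ j → toℕ j ≡ 0 → Q ⊙ V j ≋ μ • V j
      step : ∀ i j → toℕ j ≡ suc (toℕ i) → Q ⊙ V j ≋ μ • V j +ᵛ V i

  -- A basis of ℂ^ d that is a disjoint union of chains; the vector j of the
  -- chain k is V k j.
  record JordanBasis {d} (Q : Matrix d) : Set where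
    field
      chains      : ℕ
      ν           : Fin chains → ℕ
      μ           : Fin chains → ℂ
      V           : (k : Fin chains) → Fin (ν k) → ℂ^ d
      isChain     : ∀ k → IsJordanChain Q (μ k) (V k)
      independent : (a : (k : Fin chains) → Fin (ν k) → ℂ) →
                    ∑∑ ν (λ k j → a k j • V k j) ≋ 0ᵛ → ∀ k j → a k j ≈ᶜ 0ᶜ
      spanning    : ∀ v → Σ[ a ∈ ((k : Fin chains) → Fin (ν k) → ℂ) ]
                    v ≋ ∑∑ ν (λ k j → a k j • V k j)

    -- The family V⁽⁰⁾, …, V⁽ʲ⁾ associated with the vector j of the chain k.
    associated : ∀ k (j : Fin (ν k)) → Fin (suc (toℕ j)) → ℂ^ d
    associated k j i = V k (inject≤ i (toℕ<n j))

  -- ∑_{ℓ<ν} (K choose ℓ) μ^{K-ℓ} X^{(ν-1-ℓ)}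
  binomialSum : ∀ {d ν} → ℂ → ℕ → (Fin ν → ℂ^ d) → ℂ^ d
  binomialSum μ K X =
    ∑ (λ l → ((K C toℕ l) ×ᶜ (μ ^ᶜ (K ∸ toℕ l))) • X (opposite l))

  record Norm (d : ℕ) : Set where
    field
      ‖_‖         : ℂ^ d → ℝ
      cong        : ∀ {u v} → u ≋ v → ‖ u ‖ ≈ ‖ v ‖
      nonNegative : ∀ v → 0# ≤ ‖ v ‖
      definite    : ∀ v → ‖ v ‖ ≈ 0# → v ≋ 0ᵛ
      homogeneous : ∀ z v → ‖ z • v ‖ ≈ ∣ z ∣ * ‖ v ‖
      triangle    : ∀ u v → ‖ u +ᵛ v ‖ ≤ ‖ u ‖ + ‖ v ‖

    induced : Matrix d → ℝ
    induced M = sup (λ y → ∃[ v ] ‖ v ‖ ≈ 1# × y ≈ ‖ M ⊙ v ‖)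

  Word : ℕ → ℕ → Set
  Word B K = Vec (Fin B) K

  words : ∀ B K → List (Word B K)
  words B zero    = [] ∷ []
  words B (suc K) = List.cartesianProductWith _∷_ (List.allFin B) (words B K)

  module _ {B d : ℕ} (A : Fin B → Matrix d) where

    wordProduct : ∀ {K} → Word B K → Matrix d
    wordProduct = Vec.foldr′ (λ r M → A r ⊡ M) 1ᴹ

    -- λ_T, for T ≥ 1; the default 0# of the maximum is harmless since induced
    -- norms are non-negative.
    spectral : Norm d → ℕ → ℝ
    spectral N T = root T
      (Extrema.max totalOrder 0# (List.map (λ w → Norm.induced N (wordProduct w)) (words B T)))

    IsJointSpectralRadius : ℝ → Set
    IsJointSpectralRadius λ⋆ = ∃[ N ] Tendsto (spectral N) λ⋆

    IsAttained : ℝ → Set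
    IsAttained λ⋆ = ∃[ N ] ∃[ T ] 1 ℕ.≤ T × λ⋆ ≈ spectral N T

  record UnitInterval : Set where
    constructor interval
    field
      val   : ℝ
      0≤val : 0# ≤ val
      val≤1 : val ≤ 1#
  open UnitInterval public using (val)

  private
    x-x≈0 : ∀ x → x - x ≈ 0#
    x-x≈0 = R.-‿inverseʳ

    [x+y]-x≈y : ∀ x y → (x + y) - x ≈ y
    [x+y]-x≈y x y = begin
      (x + y) - x    ≈⟨ R.+-congʳ (R.+-comm x y) ⟩
      (y + x) - x    ≈⟨ R.+-assoc y x (- x) ⟩
      y + (x - x)    ≈⟨ R.+-congˡ (x-x≈0 x) ⟩
      y + 0#         ≈⟨ R.+-identityʳ y ⟩
      y              ∎
      where open SetoidReasoning R.setoid

    0≤1 : 0# ≤ 1#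
    0≤1 with O.total 0# 1#
    ... | inj₁ p = p
    ... | inj₂ p = O.trans (R.*-nonNegative 0≤-1 0≤-1) (O.reflexive [-1]²≈1)
      where
      0≤-1 : 0# ≤ - 1#
      0≤-1 = O.trans (O.reflexive (R.sym (x-x≈0 1#)))
               (O.trans (R.+-monoˡ-≤ (- 1#) p) (O.reflexive (R.+-identityˡ (- 1#))))
      open RingProperties R.ring using (-‿distribˡ-*; -‿involutive)
      [-1]²≈1 : (- 1#) * (- 1#) ≈ 1#
      [-1]²≈1 = R.trans (R.sym (-‿distribˡ-* 1# (- 1#)))
                  (R.trans (R.-‿cong (R.*-identityˡ (- 1#))) (-‿involutive 1#))

  0ᴵ 1ᴵ : UnitInterval
  0ᴵ = interval 0# O.refl 0≤1
  1ᴵ = interval 1# 0≤1 O.refl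

  IsFloor : ℕ → ℝ → Set
  IsFloor n y = ofℕ n ≤ y × y < ofℕ (suc n)

  fractionalPart : ∀ n y → IsFloor n y → UnitInterval
  fractionalPart n y (n≤y , (y≤n+1 , _)) = interval (y - ofℕ n)
    (O.trans (O.reflexive (R.sym (x-x≈0 (ofℕ n)))) (R.+-monoˡ-≤ (- ofℕ n) n≤y))
    (O.trans (R.+-monoˡ-≤ (- ofℕ n) y≤n+1)
      (O.reflexive (R.trans (R.+-congʳ (R.+-comm 1# (ofℕ n))) ([x+y]-x≈y (ofℕ n) 1#))))

  Continuous : ∀ {d} → (UnitInterval → ℂ^ d) → Set
  Continuous F = ∀ x ε → 0# < ε → ∃[ δ ] 0# < δ ×
    (∀ y → ∣ val y - val x ∣ℝ < δ → ∀ i → ∣ (F y -ᵛ F x) i ∣ < ε)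

  -- E_K(x) = O(g K) as K → ∞, uniformly in x; all norms on ℂ^ d being
  -- equivalent, the estimate is made on coordinates.
  UniformlyO : ∀ {d} → (ℕ → UnitInterval → ℂ^ d) → (ℕ → ℝ) → Set
  UniformlyO E g = ∃[ c ] ∃[ K₀ ] ∀ K → K₀ ℕ.≤ K → ∀ x i → ∣ E K x i ∣ ≤ c * g K

  record LinearRepresentation (B d : ℕ) : Set where
    field
      L : Fin d → ℂ
      A : Fin B → Matrix d
      C : ℂ^ d

    series : ∀ {K} → Word B K → ℂ
    series w = ∑ᶜ (λ i → L i *ᶜ (wordProduct A w ⊙ C) i)

    Q : Matrix d
    Q = ∑ᴹ A

  -- (0.w)_B
  radix : ∀ {B K} → Word B K → ℝ
  radix {B} w = sum (λ i → ofℕ (toℕ (Vec.lookup w i)) * (ofℕ B ⁻¹) ^ suc (toℕ i))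

  module _ {B d : ℕ} (A : Fin B → Matrix d) where

    S : ℂ^ d → ℕ → UnitInterval → ℂ^ d
    S v K x = ∑ᴸ (λ w → wordProduct A w ⊙ v)
      (List.filter (λ w → em {radix w ≤ val x}) (words B K))

    dilate : ∀ (x : UnitInterval) (x₁ : Fin B) → IsFloor (toℕ x₁) (ofℕ B * val x) → UnitInterval
    dilate x x₁ = fractionalPart (toℕ x₁) (ofℕ B * val x)

    dilationRHS : (v : ℂ^ d) (F : UnitInterval → ℂ^ d) (x : UnitInterval) (x₁ : Fin B) →
                  IsFloor (toℕ x₁) (ofℕ B * val x) → ℂ^ d
    dilationRHS v F x x₁ x₁-floor =
      ∑ (λ (r : Fin (toℕ x₁)) → A (inject r) ⊙ v) +ᵛ A x₁ ⊙ F (dilate x x₁ x₁-floor)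

    record IsDilationSolution {ν} (μ : ℂ) (V : Fin ν → ℂ^ d)
             (F : Fin ν → UnitInterval → ℂ^ d) : Set where
      field
        continuous : ∀ j → Continuous (F j)
        at-0       : ∀ j → F j 0ᴵ ≋ 0ᵛ
        at-1       : ∀ j → F j 1ᴵ ≋ V j
        base       : ∀ j → toℕ j ≡ 0 → ∀ x → val x < 1# →
                     ∀ x₁ (x₁-floor : IsFloor (toℕ x₁) (ofℕ B * val x)) →
                     μ • F j x ≋ dilationRHS (V j) (F j) x x₁ x₁-floor
        step       : ∀ i j → toℕ j ≡ suc (toℕ i) → ∀ x → val x < 1# →
                     ∀ x₁ (x₁-floor : IsFloor (toℕ x₁) (ofℕ B * val x)) →
                     F i x +ᵛ μ • F j x ≋ dilationRHS (V j) (F j) x x₁ x₁-floor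

  -- 𝐀_{V;K}(x), in terms of the eigenvalue μ of V and the solutions F⁽ʲ⁾
  -- for its associated family.
  𝐀 : ∀ {d ν} → ℂ → (Fin ν → UnitInterval → ℂ^ d) → ℕ → UnitInterval → ℂ^ d
  𝐀 μ F K x = binomialSum μ K (λ j → F j x)

  -- A term of order ρ^K (K choose ℓ), with coefficient ω^K G(x), ∣ω∣ = 1.
  record ExpansionTerm (d : ℕ) : Set where
    field
      ρ            : ℝ
      ω            : ℂ
      l            : ℕ
      G            : UnitInterval → ℂ^ d
      ρ-positive   : 0# < ρ
      ω-unit       : ∣ ω ∣ ≈ 1#
      G-continuous : Continuous G

    value : ℕ → UnitInterval → ℂ^ d
    value K x = (ofℝ (ρ ^ K * ofℕ (K C l)) *ᶜ (ω ^ᶜ K)) • G x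

  module _ {d : ℕ} {Q : Matrix d} (𝒱 : JordanBasis Q) where
    open JordanBasis 𝒱

    Critical : ℝ → ((k : Fin chains) → Fin (ν k) → ℂ) → ∀ k → Fin (ν k) → Set
    Critical λ⋆ γ k j = ∣ μ k ∣ ≈ λ⋆ × ¬ γ k j ≈ᶜ 0ᶜ

    -- m is the maximal height of the V ∈ 𝒱 with ρ_V = λ⋆ and γ_V ≠ 0, and 0
    -- if there is none.
    IsMaximalHeight : ℝ → ((k : Fin chains) → Fin (ν k) → ℂ) → ℕ → Set
    IsMaximalHeight λ⋆ γ m =
      (∀ k j h → Critical λ⋆ γ k j → HasHeight Q (V k j) h → h ℕ.≤ m) ×
      ((∃[ k ] ∃[ j ] Critical λ⋆ γ k j × HasHeight Q (V k j) m) ⊎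
       ((∀ k j → ¬ Critical λ⋆ γ k j) × m ≡ 0))

{-# OPTIONS --safe #-}

-- Extended to all real x, the sums satisfy 𝐒_{K+1}(x) = ∑_r A_r 𝐒_K(B x − r),
-- vanish for x < 0 and equal Q^K v for x ≥ 1.  A family with this recursion
-- which is supported on [0,1) involves a single branch r at each step, hence
-- grows like the products A_w, at any rate λ > λ⋆.
--
-- On a Jordan chain V with block J, of eigenvalue μ with ∣μ∣ > λ⋆, the tuples
-- U_K = V J^{-K} are O(σ^{-K}) for every σ < ∣μ∣, so that 𝐒_K^{U_K}(x) converges
-- geometrically and uniformly in x.  The limit 𝐅 satisfies the dilation equation
-- 𝐅(x) J = ∑_r A_r 𝐅(B x − r), and it is continuous since 𝐒_K changes by at most
-- one term A_w U_K over an interval shorter than B^{-K}.  It is unique because the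
-- equation determines 𝐅 at the B-adic points.  As 𝐒_K^V and 𝐀_{V;K} have the same
-- recursion and agree outside [0,1), their difference is O(λ^K).
--
-- For ∣μ∣ ≤ λ⋆ the branches with B x − r ≥ 1 contribute A_r Q^K V, whence a
-- recurrence for the size of 𝐒_K^V in terms of that of Q^K V.
module Submission where

open import Defs
open import Algebra.Bundles using (CommutativeRing)
import Algebra.Construct.NaturalChoice.Max as Max
import Algebra.Construct.NaturalChoice.MaxOp as MaxOp
import Algebra.Properties.AbelianGroup as AbelianGroupProperties
import Algebra.Properties.CommutativeSemiring.Exp as CommutativeSemiringExp
import Algebra.Properties.Ring as RingProperties
import Algebra.Properties.Semiring.Exp as SemiringExp
import Algebra.Properties.Semiring.Mult as SemiringMult
import Algebra.Properties.Semiring.Mult.TCOptimised as MultTC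
import Algebra.Properties.Semiring.Sum as SemiringSum
import Algebra.Solver.Ring as RingSolver
import Algebra.Solver.Ring.AlmostCommutativeRing as ACR
open import Axiom.ExcludedMiddle using (ExcludedMiddle)
open import Data.Empty using (⊥-elim)
open import Data.Fin.Base using (Fin; zero; suc; toℕ; fromℕ; fromℕ<; inject; inject₁; inject≤; opposite)
open import Data.Fin.Induction using (<-weakInduction; >-weakInduction)
import Data.Fin.Properties as Fin
open import Data.Integer.Base as ℤ using (ℤ)
import Data.Integer.Properties as ℤ
open import Data.List.Base as List using (List; []; _∷_; _++_)
import Data.List.Extrema as Extrema
open import Data.List.Membership.Propositional using (_∈_; lose)
open import Data.List.Membership.Propositional.Properties using (∈-cartesianProductWith⁺; ∈-allFin; ∈-map⁺)
import Data.List.Properties as List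
open import Data.List.Relation.Unary.Any using (here)
import Data.Maybe.Base as Maybe
open import Data.Nat.Base as ℕ using (ℕ; zero; suc; _∸_)
open import Data.Nat.Combinatorics using (nCk+nC[k+1]≡[n+1]C[k+1]; k>n⇒nCk≡0; nCk≡nC[n∸k]; nCn≡1)
  renaming (_C_ to _choose_)
import Data.Nat.Properties as ℕ
open import Data.Product.Base using (_,_; proj₁; proj₂; ∃; ∃-syntax; Σ-syntax; _×_)
open import Data.Sign.Base as Sign using (Sign)
open import Data.Sum.Base using (_⊎_; inj₁; inj₂)
open import Data.Vec.Base as Vec using (Vec; []; _∷_; _∷ʳ_)
import Data.Vec.Functional.Relation.Binary.Equality.Setoid as VectorEquality
open import Function.Base using (_∘_)
open import Level using (0ℓ)
open import Relation.Binary.Bundles using (Setoid; TotalOrder)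
open import Relation.Binary.Definitions using (WeaklyDecidable; tri<; tri≈; tri>)
open import Relation.Binary.PropositionalEquality.Core as ≡ using (_≡_)
import Relation.Binary.Reasoning.PartialOrder as PosetReasoning
import Relation.Binary.Reasoning.Setoid as SetoidReasoning
open import Relation.Nullary using (¬_; yes; no; Dec)
open import Relation.Nullary.Decidable.Core using (dec⇒maybe)

-- The bound on a homogeneous family involves its values at K = 0 only. Hence 𝐅 can be built once,
-- from a single rate lam between λ⋆ and ∣μ∣, and the remainder estimated afterwards at any rate at
-- which the products contract: each λ > λ⋆, and λ⋆ itself when it is attained. The norm that
-- attains λ⋆ need not be the one that served to build 𝐅; a rate therefore comes with its own norm,
-- and the equivalence of norms leads from one to the other.
--
-- The construction needs a second rate σ with lam < σ < ∣μ∣: a Jordan block may make U_K larger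
-- than ∣μ∣^(-K) by a power of K, which σ^(-K) absorbs, and the increments of the limit are then
-- O((lam/σ)^K).
--
-- The joint spectral radius is used through a bound on the products of one length T + 1. A weighted
-- norm spreads it over the single letters, with powers of 1/lam as weights. The rate 0 is therefore
-- treated apart: there the errors are eventually 0.
--
-- Letting x be any real number makes all digits alike: complete and empty branches are those that
-- fall into the regions x ≥ 1 and x < 0.

-- Integer coefficients make cancellation decidable over an arbitrary
-- commutative ring.
module IntegerSolver (CR : CommutativeRing 0ℓ 0ℓ) where
  private
    module C = CommutativeRing CR
    open C
    open RingProperties ring
    open AbelianGroupProperties +-abelianGroup using (⁻¹-∙-comm)
    open MultTC semiring renaming (_×_ to _·_)
    open SetoidReasoning setoid

    ⟦_⟧ : ℤ → Carrier
    ⟦ ℤ.+ n ⟧      = n · 1#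
    ⟦ ℤ.-[1+ n ] ⟧ = - (suc n · 1#)

    1+ : ∀ n → suc n · 1# ≈ 1# + n · 1#
    1+ n = ×-homo-+ 1# 1 n

    ⊖-homo : ∀ m n → ⟦ m ℤ.⊖ n ⟧ ≈ m · 1# - n · 1#
    ⊖-homo m zero = sym (trans (+-congˡ -0#≈0#) (+-identityʳ _))
    ⊖-homo zero (suc n) = sym (+-identityˡ _)
    ⊖-homo (suc m) (suc n) = begin
      ⟦ suc m ℤ.⊖ suc n ⟧             ≡⟨ ≡.cong ⟦_⟧ (ℤ.[1+m]⊖[1+n]≡m⊖n m n) ⟩
      ⟦ m ℤ.⊖ n ⟧                     ≈⟨ ⊖-homo m n ⟩
      a - b                           ≈⟨ +-congˡ (+-identityˡ _) ⟨
      a + (0# - b)                    ≈⟨ +-congˡ (+-congʳ (-‿inverseʳ 1#)) ⟨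
      a + ((1# - 1#) - b)             ≈⟨ +-congˡ (+-assoc _ _ _) ⟩
      a + (1# + (- 1# - b))           ≈⟨ +-assoc _ _ _ ⟨
      (a + 1#) + (- 1# - b)           ≈⟨ +-cong (+-comm a 1#) (⁻¹-∙-comm 1# b) ⟩
      (1# + a) - (1# + b)             ≈⟨ +-cong (1+ m) (-‿cong (1+ n)) ⟨
      suc m · 1# - suc n · 1#         ∎
      where
      a = m · 1#
      b = n · 1#

    +-homo : ∀ i j → ⟦ i ℤ.+ j ⟧ ≈ ⟦ i ⟧ + ⟦ j ⟧
    +-homo (ℤ.+ m) (ℤ.+ n) = ×-homo-+ 1# m n
    +-homo (ℤ.+ m) ℤ.-[1+ n ] = ⊖-homo m (suc n)
    +-homo ℤ.-[1+ m ] (ℤ.+ n) = trans (⊖-homo n (suc m)) (+-comm _ _)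
    +-homo ℤ.-[1+ m ] ℤ.-[1+ n ] = begin
      - (suc (suc (m ℕ.+ n)) · 1#)      ≈⟨ -‿cong (1+ (suc (m ℕ.+ n))) ⟩
      - (1# + suc (m ℕ.+ n) · 1#)       ≈⟨ -‿cong (+-congˡ (×-homo-+ 1# (suc m) n)) ⟩
      - (1# + (suc m · 1# + n · 1#))    ≈⟨ -‿cong (+-assoc _ _ _) ⟨
      - ((1# + suc m · 1#) + n · 1#)    ≈⟨ -‿cong (+-congʳ (+-comm _ _)) ⟩
      - ((suc m · 1# + 1#) + n · 1#)    ≈⟨ -‿cong (+-assoc _ _ _) ⟩
      - (suc m · 1# + (1# + n · 1#))    ≈⟨ -‿cong (+-congˡ (1+ n)) ⟨
      - (suc m · 1# + suc n · 1#)       ≈⟨ ⁻¹-∙-comm _ _ ⟨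
      - (suc m · 1#) - suc n · 1#       ∎

    -‿homo : ∀ i → ⟦ ℤ.- i ⟧ ≈ - ⟦ i ⟧
    -‿homo (ℤ.+ zero)  = sym -0#≈0#
    -‿homo (ℤ.+ suc n) = refl
    -‿homo ℤ.-[1+ n ]  = sym (-‿involutive _)

    +◃-homo : ∀ n → ⟦ Sign.+ ℤ.◃ n ⟧ ≈ n · 1#
    +◃-homo zero    = refl
    +◃-homo (suc n) = refl

    -◃-homo : ∀ n → ⟦ Sign.- ℤ.◃ n ⟧ ≈ - (n · 1#)
    -◃-homo zero    = sym -0#≈0#
    -◃-homo (suc n) = refl

    *-homo : ∀ i j → ⟦ i ℤ.* j ⟧ ≈ ⟦ i ⟧ * ⟦ j ⟧
    *-homo (ℤ.+ m) (ℤ.+ n) = trans (+◃-homo (m ℕ.* n)) (×1-homo-* m n)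
    *-homo (ℤ.+ m) ℤ.-[1+ n ] = trans (-◃-homo (m ℕ.* suc n))
      (trans (-‿cong (×1-homo-* m (suc n))) (-‿distribʳ-* _ _))
    *-homo ℤ.-[1+ m ] (ℤ.+ n) = trans (-◃-homo (suc m ℕ.* n))
      (trans (-‿cong (×1-homo-* (suc m) n)) (-‿distribˡ-* _ _))
    *-homo ℤ.-[1+ m ] ℤ.-[1+ n ] = begin
      ⟦ Sign.+ ℤ.◃ (suc m ℕ.* suc n) ⟧  ≈⟨ ×1-homo-* (suc m) (suc n) ⟩
      a * b                             ≈⟨ -‿involutive _ ⟨
      - - (a * b)                       ≈⟨ -‿cong (-‿distribʳ-* a b) ⟩
      - (a * - b)                       ≈⟨ -‿distribˡ-* a (- b) ⟩
      - a * - b                         ∎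
      where
      a = suc m · 1#
      b = suc n · 1#

    morphism : ℤ.+-*-rawRing ACR.-Raw-AlmostCommutative⟶ ACR.fromCommutativeRing CR
    morphism = record
      { ⟦_⟧    = ⟦_⟧
      ; +-homo = +-homo
      ; *-homo = *-homo
      ; -‿homo = -‿homo
      ; 0-homo = refl
      ; 1-homo = refl
      }

    _≟_ : WeaklyDecidable (λ i j → ⟦ i ⟧ ≈ ⟦ j ⟧)
    i ≟ j = Maybe.map (λ eq → reflexive (≡.cong ⟦_⟧ eq)) (dec⇒maybe (i ℤ.≟ j))

  open RingSolver ℤ.+-*-rawRing (ACR.fromCommutativeRing CR) morphism _≟_ public
    using (Polynomial; solve; _:=_; _:+_; _:*_; _:-_; :-_; con; _:^_)

  :0 :1 : ∀ {n} → Polynomial n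
  :0 = con (ℤ.+ 0)
  :1 = con (ℤ.+ 1)

module Development (em : ExcludedMiddle 0ℓ) (R : CompleteOrderedField) where
  open Analysis em R

  -- Complete ordered fields: inequalities, powers and geometric limits.

  module OrderedField where

    module R = CompleteOrderedField R
    module RO = TotalOrder totalOrder
    open IntegerSolver R.commutativeRing public
    module ≤-Reasoning = PosetReasoning RO.poset

    private
      variable
        x y z w a b c s ε θ : ℝ

    0≤y-x : x ≤ y → 0# ≤ y - x
    0≤y-x {x} {y} x≤y = begin
      0#      ≈⟨ R.-‿inverseʳ x ⟨
      x - x   ≤⟨ R.+-monoˡ-≤ (- x) x≤y ⟩
      y - x   ∎
      where open ≤-Reasoning

    -- Most inequalities below are brought into this form: b - a is rewritten as an expression that
    -- is visibly non-negative, and the solver checks the identity.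
    ≤-by : 0# ≤ s → b - a ≈ s → a ≤ b
    ≤-by {s} {b} {a} 0≤s eq = begin
      a              ≈⟨ R.+-identityˡ a ⟨
      0# + a         ≤⟨ R.+-monoˡ-≤ a 0≤s ⟩
      s + a          ≈⟨ R.+-congʳ eq ⟨
      (b - a) + a    ≈⟨ solve 2 (λ a b → (b :- a) :+ a := b) R.refl a b ⟩
      b              ∎
      where open ≤-Reasoning

    ≰⇒> : ¬ x ≤ y → y < x
    ≰⇒> {x} {y} x≰y with RO.total x y
    ... | inj₁ x≤y = ⊥-elim (x≰y x≤y)
    ... | inj₂ y≤x = y≤x , λ eq → x≰y (RO.reflexive (R.sym eq))

    <⇒≱ : x < y → ¬ y ≤ x
    <⇒≱ (x≤y , x≉y) y≤x = x≉y (RO.antisym x≤y y≤x)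

    ≮⇒≥ : ¬ x < y → y ≤ x
    ≮⇒≥ {x} {y} x≮y with em {y ≤ x}
    ... | yes p = p
    ... | no ¬p = ⊥-elim (x≮y (≰⇒> ¬p))

    <-irrefl : ¬ x < x
    <-irrefl (_ , x≉x) = x≉x R.refl

    <⇒≤ : x < y → x ≤ y
    <⇒≤ = proj₁

    <-≤-trans : x < y → y ≤ z → x < z
    <-≤-trans p q = ≰⇒> λ z≤x → <⇒≱ p (RO.trans q z≤x)

    ≤-<-trans : x ≤ y → y < z → x < z
    ≤-<-trans p q = ≰⇒> λ z≤x → <⇒≱ q (RO.trans z≤x p)

    +-mono-≤ : x ≤ y → z ≤ w → x + z ≤ y + w
    +-mono-≤ {x} {y} {z} {w} p q = begin
      x + z  ≤⟨ R.+-monoˡ-≤ z p ⟩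
      y + z  ≈⟨ R.+-comm y z ⟩
      z + y  ≤⟨ R.+-monoˡ-≤ y q ⟩
      w + y  ≈⟨ R.+-comm w y ⟩
      y + w  ∎
      where open ≤-Reasoning

    +-monoʳ-≤ : ∀ z → x ≤ y → z + x ≤ z + y
    +-monoʳ-≤ z p = +-mono-≤ (RO.refl {z}) p

    0≤+ : 0# ≤ x → 0# ≤ y → 0# ≤ x + y
    0≤+ p q = RO.trans (RO.reflexive (R.sym (R.+-identityˡ 0#))) (+-mono-≤ p q)

    0≤* : 0# ≤ x → 0# ≤ y → 0# ≤ x * y
    0≤* = R.*-nonNegative

    neg-mono : x ≤ y → - y ≤ - x
    neg-mono {x} {y} p = ≤-by (0≤y-x p) (solve 2 (λ x y → (:- x) :- (:- y) := y :- x) R.refl x y)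

    0≤x² : ∀ x → 0# ≤ x * x
    0≤x² x with RO.total 0# x
    ... | inj₁ p = 0≤* p p
    ... | inj₂ p = RO.trans (0≤* q q) (RO.reflexive (solve 1 (λ x → (:- x) :* (:- x) := x :* x) R.refl x))
      where
      q : 0# ≤ - x
      q = ≤-by (0≤y-x p) (solve 1 (λ x → (:- x) :- :0 := :0 :- x) R.refl x)

    0≤1 : 0# ≤ 1#
    0≤1 = RO.trans (0≤x² 1#) (RO.reflexive (R.*-identityˡ 1#))

    0<1 : 0# < 1#
    0<1 = 0≤1 , R.0≉1

    *-monoˡ-≤ : 0# ≤ z → x ≤ y → z * x ≤ z * y
    *-monoˡ-≤ {z} {x} {y} p q = ≤-by (0≤* p (0≤y-x q))
      (solve 3 (λ x y z → z :* y :- z :* x := z :* (y :- x)) R.refl x y z)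

    *-monoʳ-≤ : 0# ≤ z → x ≤ y → x * z ≤ y * z
    *-monoʳ-≤ {z} {x} {y} p q = ≤-by (0≤* (0≤y-x q) p)
      (solve 3 (λ x y z → y :* z :- x :* z := (y :- x) :* z) R.refl x y z)

    *-mono-≤ : 0# ≤ x → 0# ≤ w → x ≤ y → z ≤ w → x * z ≤ y * w
    *-mono-≤ p q r s = RO.trans (*-monoˡ-≤ p s) (*-monoʳ-≤ q r)

    pos⇒≉0 : 0# < x → ¬ x ≈ 0#
    pos⇒≉0 (_ , q) eq = q (R.sym eq)

    ⁻¹-inverseˡ : 0# < x → x ⁻¹ * x ≈ 1#
    ⁻¹-inverseˡ p = R.trans (R.*-comm _ _) (R.⁻¹-inverse _ (pos⇒≉0 p))

    ⁻¹-inverseʳ : 0# < x → x * x ⁻¹ ≈ 1#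
    ⁻¹-inverseʳ p = R.⁻¹-inverse _ (pos⇒≉0 p)

    0≤⁻¹ : 0# < x → 0# ≤ x ⁻¹
    0≤⁻¹ {x} p = begin
      0#                   ≤⟨ 0≤* (<⇒≤ p) (0≤x² (x ⁻¹)) ⟩
      x * (x ⁻¹ * x ⁻¹)    ≈⟨ R.*-assoc _ _ _ ⟨
      x * x ⁻¹ * x ⁻¹      ≈⟨ R.*-congʳ (⁻¹-inverseʳ p) ⟩
      1# * x ⁻¹            ≈⟨ R.*-identityˡ _ ⟩
      x ⁻¹                 ∎
      where open ≤-Reasoning

    *-cancel-≤ : 0# < z → z * x ≤ z * y → x ≤ y
    *-cancel-≤ {z} {x} {y} p q = begin
      x                ≈⟨ R.*-identityˡ x ⟨
      1# * x           ≈⟨ R.*-congʳ (⁻¹-inverseˡ p) ⟨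
      z ⁻¹ * z * x     ≈⟨ R.*-assoc _ _ _ ⟩
      z ⁻¹ * (z * x)   ≤⟨ *-monoˡ-≤ (0≤⁻¹ p) q ⟩
      z ⁻¹ * (z * y)   ≈⟨ R.*-assoc _ _ _ ⟨
      z ⁻¹ * z * y     ≈⟨ R.*-congʳ (⁻¹-inverseˡ p) ⟩
      1# * y           ≈⟨ R.*-identityˡ y ⟩
      y                ∎
      where open ≤-Reasoning

    *-mono-< : 0# < z → x < y → z * x < z * y
    *-mono-< p q = ≰⇒> λ r → <⇒≱ q (*-cancel-≤ p r)

    0<* : 0# < x → 0# < y → 0# < x * y
    0<* {x} p q = ≤-<-trans (RO.reflexive (R.sym (R.zeroʳ x))) (*-mono-< p q)

    0<⁻¹ : 0# < x → 0# < x ⁻¹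
    0<⁻¹ {x} p = 0≤⁻¹ p , λ eq → R.0≉1 (R.trans (R.sym (R.zeroʳ x)) (R.trans (R.*-congˡ eq) (⁻¹-inverseʳ p)))

    0<y-x : x < y → 0# < y - x
    0<y-x (p , q) = 0≤y-x p , λ eq → q (R.trans (R.sym (R.+-identityʳ _)) (R.trans (R.+-congˡ eq)
      (solve 2 (λ x y → x :+ (y :- x) := y) R.refl _ _)))

    <-by : 0# < s → b - a ≈ s → a < b
    <-by {s} {b} {a} 0<s eq = ≤-by (<⇒≤ 0<s) eq ,
      λ a≈b → proj₂ 0<s (R.trans (R.sym (R.trans (R.+-congˡ (R.-‿cong a≈b)) (R.-‿inverseʳ b))) eq)

    0<+ : 0# < x → 0# ≤ y → 0# < x + y
    0<+ p q = <-≤-trans p (RO.trans (RO.reflexive (R.sym (R.+-identityʳ _))) (+-monoʳ-≤ _ q))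

    +-mono-<-≤ : x < y → z ≤ w → x + z < y + w
    +-mono-<-≤ {x} {y} {z} {w} p q = <-by (0<+ (0<y-x p) (0≤y-x q))
      (solve 4 (λ x y z w → (y :+ w) :- (x :+ z) := (y :- x) :+ (w :- z)) R.refl x y z w)

    2# ½ : ℝ
    2# = 1# + 1#
    ½ = 2# ⁻¹

    0<2 : 0# < 2#
    0<2 = 0<+ 0<1 0≤1

    ½+½ : ½ + ½ ≈ 1#
    ½+½ = R.trans (solve 1 (λ h → h :+ h := (:1 :+ :1) :* h) R.refl ½) (⁻¹-inverseʳ 0<2)

    0<½ : 0# < ½
    0<½ = 0<⁻¹ 0<2

    ½<1 : ½ < 1#
    ½<1 = <-by 0<½ (R.trans (R.+-congʳ (R.sym ½+½)) (solve 1 (λ h → (h :+ h) :- h := h) R.refl ½))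

    between : x < y → ∃[ z ] x < z × z < y
    between {x} {y} p = ½ * (x + y) , <-by q eq₁ , <-by q eq₂
      where
      q = 0<* 0<½ (0<y-x p)
      eq₁ : ½ * (x + y) - x ≈ ½ * (y - x)
      eq₁ = R.trans (R.+-congˡ (R.-‿cong (R.trans (R.sym (R.*-identityˡ x)) (R.*-congʳ (R.sym ½+½)))))
        (solve 3 (λ h x y → h :* (x :+ y) :- (h :+ h) :* x := h :* (y :- x)) R.refl ½ x y)
      eq₂ : y - ½ * (x + y) ≈ ½ * (y - x)
      eq₂ = R.trans (R.+-congʳ (R.trans (R.sym (R.*-identityˡ y)) (R.*-congʳ (R.sym ½+½))))
        (solve 3 (λ h x y → (h :+ h) :* y :- h :* (x :+ y) := h :* (y :- x)) R.refl ½ x y)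

    ≤-from-ε : (∀ ε → 0# < ε → x ≤ ε) → x ≤ 0#
    ≤-from-ε {x} h = ≮⇒≥ λ 0<x → let (z , 0<z , z<x) = between 0<x in <⇒≱ z<x (h z 0<z)

    open MaxOp (Max.maxOperator totalOrder) public using (x≤x⊔y; x≤y⊔x; ⊔-lub; ⊔-cong)

    ∣∣-≤ : x ≤ y → - x ≤ y → ∣ x ∣ℝ ≤ y
    ∣∣-≤ = ⊔-lub

    x≤∣x∣ : ∀ x → x ≤ ∣ x ∣ℝ
    x≤∣x∣ x = x≤x⊔y x (- x)

    -x≤∣x∣ : ∀ x → - x ≤ ∣ x ∣ℝ
    -x≤∣x∣ x = x≤y⊔x x (- x)

    ∣∣-cong : x ≈ y → ∣ x ∣ℝ ≈ ∣ y ∣ℝ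
    ∣∣-cong eq = ⊔-cong eq (R.-‿cong eq)

    0≤∣∣ : ∀ x → 0# ≤ ∣ x ∣ℝ
    0≤∣∣ x with RO.total 0# x
    ... | inj₁ p = RO.trans p (x≤∣x∣ x)
    ... | inj₂ p = RO.trans (RO.trans (RO.reflexive (solve 0 (:0 := :- :0) R.refl)) (neg-mono p)) (-x≤∣x∣ x)

    ∣-∣ : ∀ x → ∣ - x ∣ℝ ≈ ∣ x ∣ℝ
    ∣-∣ x = RO.antisym
      (∣∣-≤ (-x≤∣x∣ x) (RO.trans (RO.reflexive (solve 1 (λ x → :- (:- x) := x) R.refl x)) (x≤∣x∣ x)))
      (∣∣-≤ (RO.trans (RO.reflexive (solve 1 (λ x → x := :- (:- x)) R.refl x)) (-x≤∣x∣ (- x))) (x≤∣x∣ (- x)))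

    ∣x-y∣≈∣y-x∣ : ∀ x y → ∣ x - y ∣ℝ ≈ ∣ y - x ∣ℝ
    ∣x-y∣≈∣y-x∣ x y = R.trans (R.sym (∣-∣ (x - y)))
      (∣∣-cong (solve 2 (λ x y → :- (x :- y) := y :- x) R.refl x y))

    0≤^ : 0# ≤ x → ∀ n → 0# ≤ x ^ n
    0≤^ p zero    = 0≤1
    0≤^ p (suc n) = 0≤* p (0≤^ p n)

    0<^ : 0# < x → ∀ n → 0# < x ^ n
    0<^ p zero    = 0<1
    0<^ p (suc n) = 0<* p (0<^ p n)

    ^-mono-≤ : 0# ≤ x → x ≤ y → ∀ n → x ^ n ≤ y ^ n
    ^-mono-≤ p q zero    = RO.refl
    ^-mono-≤ p q (suc n) = *-mono-≤ p (0≤^ (RO.trans p q) n) q (^-mono-≤ p q n)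

    1≤^ : 1# ≤ x → ∀ n → 1# ≤ x ^ n
    1≤^ p zero = RO.refl
    1≤^ {x} p (suc n) = begin
      1#          ≈⟨ R.*-identityˡ 1# ⟨
      1# * 1#     ≤⟨ *-mono-≤ 0≤1 (0≤^ (RO.trans 0≤1 p) n) p (1≤^ p n) ⟩
      x * x ^ n   ∎
      where open ≤-Reasoning

    ^-monoʳ-≤ : ∀ {m n} → 1# ≤ x → m ℕ.≤ n → x ^ m ≤ x ^ n
    ^-monoʳ-≤ {n = n} 1≤x ℕ.z≤n = 1≤^ 1≤x n
    ^-monoʳ-≤ 1≤x (ℕ.s≤s p)     = *-monoˡ-≤ (RO.trans 0≤1 1≤x) (^-monoʳ-≤ 1≤x p)

    0≤ofℕ : ∀ n → 0# ≤ ofℕ n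
    0≤ofℕ zero    = RO.refl
    0≤ofℕ (suc n) = 0≤+ 0≤1 (0≤ofℕ n)

    ofℕ-mono : ∀ {m n} → m ℕ.≤ n → ofℕ m ≤ ofℕ n
    ofℕ-mono {n = n} ℕ.z≤n = 0≤ofℕ n
    ofℕ-mono (ℕ.s≤s p)     = +-monoʳ-≤ 1# (ofℕ-mono p)

    1≤ofℕ : ∀ {n} → 1 ℕ.≤ n → 1# ≤ ofℕ n
    1≤ofℕ p = RO.trans (RO.reflexive (R.sym (R.+-identityʳ 1#))) (ofℕ-mono p)

    -- The supremum σ of the lower bounds of the θ^n is a lower bound, and so is
    -- (2 - θ) σ; this contradicts σ > 0.
    powers-small : 0# ≤ θ → θ < 1# → ∀ ε → 0# < ε → ∃[ n ] θ ^ n < ε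
    powers-small {θ} 0≤θ θ<1 ε 0<ε with em {∃[ n ] θ ^ n < ε}
    ... | yes p = p
    ... | no ¬p = ⊥-elim (<⇒≱ (0<* (0<y-x θ<1) 0<σ) contra)
      where
      open ≤-Reasoning
      P : ℝ → Set
      P y = ∀ n → y ≤ θ ^ n
      ε∈P : P ε
      ε∈P n = ≮⇒≥ λ q → ¬p (n , q)
      hasSup = complete P (ε , ε∈P) (1# , λ y y∈P → y∈P 0)
      σ = proj₁ hasSup
      σ-lub = proj₂ (proj₂ hasSup)
      0<σ : 0# < σ
      0<σ = <-≤-trans 0<ε (proj₁ (proj₂ hasSup) ε ε∈P)
      σ∈P : P σ
      σ∈P n = σ-lub (θ ^ n) (λ y y∈P → y∈P n)
      0≤2-θ : 0# ≤ 2# - θ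
      0≤2-θ = ≤-by (0≤+ 0≤1 (0≤y-x (<⇒≤ θ<1))) (solve 1 (λ t → (:1 :+ :1 :- t) :- :0 := :1 :+ (:1 :- t)) R.refl θ)
      2σ∈P : P ((2# - θ) * σ)
      2σ∈P n = begin
        (2# - θ) * σ                   ≤⟨ *-monoˡ-≤ 0≤2-θ (σ∈P (suc n)) ⟩
        (2# - θ) * (θ * θ ^ n)         ≤⟨ ≤-by (0≤* (0≤x² (1# - θ)) (0≤^ 0≤θ n))
          (solve 2 (λ t p → p :- (:1 :+ :1 :- t) :* (t :* p) := (:1 :- t) :* (:1 :- t) :* p) R.refl θ (θ ^ n)) ⟩
        θ ^ n                          ∎
      contra : (1# - θ) * σ ≤ 0#
      contra = ≤-by (0≤y-x (proj₁ (proj₂ hasSup) _ 2σ∈P))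
        (solve 2 (λ t σ → :0 :- (:1 :- t) :* σ := σ :- (:1 :+ :1 :- t) :* σ) R.refl θ σ)

    geometric-small : 0# ≤ θ → θ < 1# → ∀ c ε → 0# < ε → ∃[ n ] c * θ ^ n < ε
    geometric-small {θ} 0≤θ θ<1 c ε 0<ε = n , ≤-<-trans c*θ^n≤ p
      where
      open ≤-Reasoning
      -- Positive for every c, so that it can be divided by.
      e = ∣ c ∣ℝ + 1#
      0<e : 0# < e
      0<e = <-≤-trans 0<1 (RO.trans (RO.reflexive (R.sym (R.+-identityˡ 1#))) (R.+-monoˡ-≤ 1# (0≤∣∣ c)))
      small = powers-small 0≤θ θ<1 (e ⁻¹ * ε) (0<* (0<⁻¹ 0<e) 0<ε)
      n = proj₁ small
      c*θ^n≤ : c * θ ^ n ≤ e * θ ^ n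
      c*θ^n≤ = *-monoʳ-≤ (0≤^ 0≤θ n) (RO.trans (x≤∣x∣ c)
        (RO.trans (RO.reflexive (R.sym (R.+-identityʳ _))) (+-monoʳ-≤ _ 0≤1)))
      p : e * θ ^ n < ε
      p = <-≤-trans (*-mono-< 0<e (proj₂ small)) (RO.reflexive
        (R.trans (R.sym (R.*-assoc _ _ _)) (R.trans (R.*-congʳ (⁻¹-inverseʳ 0<e)) (R.*-identityˡ ε))))

    ≤-from-geometric : 0# ≤ θ → θ < 1# → ∀ c → (∀ n → x ≤ c * θ ^ n) → x ≤ 0#
    ≤-from-geometric 0≤θ θ<1 c h = ≤-from-ε λ ε 0<ε →
      let (n , p) = geometric-small 0≤θ θ<1 c ε 0<ε in RO.trans (h n) (<⇒≤ p)

    -- The intervals [a n - e θ^n, a n + e θ^n], e = c / (1 - θ), are nested.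
    geometric-limit : 0# ≤ θ → θ < 1# → 0# ≤ c → (a : ℕ → ℝ) →
      (∀ n → ∣ a (suc n) - a n ∣ℝ ≤ c * θ ^ n) →
      ∃[ l ] ∀ n → ∣ l - a n ∣ℝ ≤ c * (1# - θ) ⁻¹ * θ ^ n
    geometric-limit {θ} {c} 0≤θ θ<1 0≤c a step = l , λ n → ∣∣-≤
      (≤-by (0≤y-x (proj₂ (proj₂ hasSup) (hi n) (λ { y (m , eq) → RO.trans (RO.reflexive eq) (lo≤hi m n) })))
        (solve 3 (λ l a e → e :- (l :- a) := (a :+ e) :- l) R.refl l (a n) (e * θ ^ n)))
      (≤-by (0≤y-x (proj₁ (proj₂ hasSup) (lo n) (n , R.refl)))
        (solve 3 (λ l a e → e :- :- (l :- a) := l :- (a :- e)) R.refl l (a n) (e * θ ^ n)))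
      where
      open ≤-Reasoning
      e = c * (1# - θ) ⁻¹
      lo hi : ℕ → ℝ
      lo n = a n - e * θ ^ n
      hi n = a n + e * θ ^ n
      0≤e : 0# ≤ e
      0≤e = 0≤* 0≤c (0≤⁻¹ (0<y-x θ<1))
      e[1-θ] : e * (1# - θ) ≈ c
      e[1-θ] = R.trans (R.*-assoc _ _ _) (R.trans (R.*-congˡ (⁻¹-inverseˡ (0<y-x θ<1))) (R.*-identityʳ c))
      step′ : ∀ n → ∣ a (suc n) - a n ∣ℝ ≤ e * (1# - θ) * θ ^ n
      step′ n = RO.trans (step n) (RO.reflexive (R.*-congʳ (R.sym e[1-θ])))
      lo-step : ∀ n → lo n ≤ lo (suc n)
      lo-step n = ≤-by (0≤y-x (RO.trans (-x≤∣x∣ _) (step′ n)))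
        (solve 5 (λ a b e t p → (b :- e :* (t :* p)) :- (a :- e :* p) := e :* (:1 :- t) :* p :- :- (b :- a))
          R.refl (a n) (a (suc n)) e θ (θ ^ n))
      hi-step : ∀ n → hi (suc n) ≤ hi n
      hi-step n = ≤-by (0≤y-x (RO.trans (x≤∣x∣ _) (step′ n)))
        (solve 5 (λ a b e t p → (a :+ e :* p) :- (b :+ e :* (t :* p)) := e :* (:1 :- t) :* p :- (b :- a))
          R.refl (a n) (a (suc n)) e θ (θ ^ n))
      lo-mono : ∀ m k → lo m ≤ lo (k ℕ.+ m)
      lo-mono m zero    = RO.refl
      lo-mono m (suc k) = RO.trans (lo-mono m k) (lo-step (k ℕ.+ m))
      hi-mono : ∀ m k → hi (k ℕ.+ m) ≤ hi m
      hi-mono m zero    = RO.refl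
      hi-mono m (suc k) = RO.trans (hi-step (k ℕ.+ m)) (hi-mono m k)
      lo≤hi′ : ∀ n → lo n ≤ hi n
      lo≤hi′ n = ≤-by (0≤+ p p) (solve 2 (λ a e → (a :+ e) :- (a :- e) := e :+ e) R.refl (a n) (e * θ ^ n))
        where p = 0≤* 0≤e (0≤^ 0≤θ n)
      lo≤hi : ∀ m n → lo m ≤ hi n
      lo≤hi m n = begin
        lo m           ≤⟨ lo-mono m n ⟩
        lo (n ℕ.+ m)   ≤⟨ lo≤hi′ (n ℕ.+ m) ⟩
        hi (n ℕ.+ m)   ≡⟨ ≡.cong hi (ℕ+-comm n m) ⟩
        hi (m ℕ.+ n)   ≤⟨ hi-mono n m ⟩
        hi n           ∎
        where open import Data.Nat.Properties using () renaming (+-comm to ℕ+-comm)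
      hasSup = complete (λ y → ∃[ n ] y ≈ lo n) (lo 0 , 0 , R.refl)
        (hi 0 , λ { y (n , eq) → RO.trans (RO.reflexive eq) (lo≤hi n 0) })
      l = proj₁ hasSup

    -- Stands in for the continuity of powers in the existence of roots. From y^(n+1) - x^(n+1) = (y
    -- - x) x^n + y (y^n - x^n) and y ≤ b, the constants satisfy c_{n+1} = b c_n + b^n.
    power-lipschitz : ∀ b n → 0# ≤ b → ∃[ c ] 0# ≤ c ×
      (∀ x y → 0# ≤ x → x ≤ y → y ≤ b → y ^ n ≤ x ^ n + c * (y - x))
    power-lipschitz b zero 0≤b = 0# , RO.refl , λ x y _ _ _ → RO.reflexive
      (solve 2 (λ x y → :1 := :1 :+ :0 :* (y :- x)) R.refl x y)
    power-lipschitz b (suc n) 0≤b = let (c , 0≤c , h) = power-lipschitz b n 0≤b in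
      b * c + b ^ n , 0≤+ (0≤* 0≤b 0≤c) (0≤^ 0≤b n) , λ x y 0≤x x≤y y≤b →
      let 0≤y = RO.trans 0≤x x≤y
          0≤y-x = 0≤y-x x≤y
      in begin
      y * y ^ n                             ≤⟨ *-monoˡ-≤ 0≤y (h x y 0≤x x≤y y≤b) ⟩
      y * (x ^ n + c * (y - x))             ≈⟨ solve 4 (λ x y p c → y :* (p :+ c :* (y :- x)) :=
        x :* p :+ (y :- x) :* p :+ y :* (c :* (y :- x))) R.refl x y (x ^ n) c ⟩
      x * x ^ n + (y - x) * x ^ n + y * (c * (y - x)) ≤⟨ +-mono-≤ (+-monoʳ-≤ _ (*-monoˡ-≤ 0≤y-x
        (^-mono-≤ 0≤x (RO.trans x≤y y≤b) n))) (*-monoʳ-≤ (0≤* 0≤c 0≤y-x) y≤b) ⟩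
      x * x ^ n + (y - x) * b ^ n + b * (c * (y - x)) ≈⟨ solve 6 (λ x y p q c b →
        x :* p :+ (y :- x) :* q :+ b :* (c :* (y :- x)) := x :* p :+ (b :* c :+ q) :* (y :- x))
        R.refl x y (x ^ n) (b ^ n) c b ⟩
      x * x ^ n + (b * c + b ^ n) * (y - x) ∎
      where open ≤-Reasoning

  open OrderedField public

  -- Roots and the field of complex numbers.

  module ComplexNumbers where

    private
      variable
        x y z w a b c s ε θ : ℝ

    sup-isSupremum : ∀ P → ∃ P → ∃ (UpperBound P) → IsSupremum P (sup P)
    sup-isSupremum P inh bdd with em {∃ P × ∃ (UpperBound P)}
    ... | yes (i , b) = proj₂ (complete P i b)
    ... | no ¬p       = ⊥-elim (¬p (inh , bdd))

    supremum-approx : ∀ {P s} → IsSupremum P s → ∀ δ → 0# < δ → ∃[ x ] P x × s - δ ≤ x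
    supremum-approx {P} {s} (_ , lub) δ 0<δ with em {∃[ x ] P x × s - δ ≤ x}
    ... | yes p = p
    ... | no ¬p = ⊥-elim (<⇒≱ 0<δ (≤-by (0≤y-x (lub (s - δ) λ x x∈P → ≮⇒≥ λ q → ¬p (x , x∈P , <⇒≤ q)))
        (solve 2 (λ s d → :0 :- d := (s :- d) :- s) R.refl s δ)))

    -- δ = ε/(ε + c) meets both demands at once, and its denominator is positive even for c = 0.
    small-multiplier : 0# ≤ c → 0# < ε → ∃[ δ ] 0# < δ × δ ≤ 1# × c * δ ≤ ε
    small-multiplier {c} {ε} 0≤c 0<ε = ε * e ⁻¹ , 0<* 0<ε (0<⁻¹ 0<e) ,
      (begin
        ε * e ⁻¹ ≤⟨ *-monoʳ-≤ (0≤⁻¹ 0<e) ε≤e ⟩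
        e * e ⁻¹ ≈⟨ ⁻¹-inverseʳ 0<e ⟩
        1#       ∎) ,
      (begin
        c * (ε * e ⁻¹)  ≈⟨ solve 3 (λ c ε i → c :* (ε :* i) := c :* i :* ε) R.refl c ε (e ⁻¹) ⟩
        c * e ⁻¹ * ε    ≤⟨ *-monoʳ-≤ (<⇒≤ 0<ε) (*-monoʳ-≤ (0≤⁻¹ 0<e) c≤e) ⟩
        e * e ⁻¹ * ε    ≈⟨ R.*-congʳ (⁻¹-inverseʳ 0<e) ⟩
        1# * ε          ≈⟨ R.*-identityˡ ε ⟩
        ε               ∎)
      where
      open ≤-Reasoning
      e = ε + c
      0<e = 0<+ 0<ε 0≤c
      ε≤e : ε ≤ e
      ε≤e = ≤-by 0≤c (solve 2 (λ ε c → (ε :+ c) :- ε := c) R.refl ε c)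
      c≤e : c ≤ e
      c≤e = ≤-by (<⇒≤ 0<ε) (solve 2 (λ ε c → (ε :+ c) :- c := ε) R.refl ε c)

    module _ (n : ℕ) (0≤a : 0# ≤ a) where
      open ≤-Reasoning

      root-isSupremum : IsSupremum (λ x → 0# ≤ x × x ^ suc n ≤ a) (root (suc n) a)
      root-isSupremum = sup-isSupremum _
        (0# , RO.refl , RO.trans (RO.reflexive (R.zeroˡ _)) 0≤a)
        (1# + a , λ x (0≤x , xⁿ≤a) → ≮⇒≥ λ 1+a<x → <⇒≱ (begin-strict
          a             ≈⟨ R.+-identityˡ a ⟨
          0# + a        <⟨ +-mono-<-≤ 0<1 RO.refl ⟩
          1# + a        <⟨ 1+a<x ⟩
          x             ≈⟨ R.*-identityʳ x ⟨
          x * 1#        ≤⟨ *-monoˡ-≤ 0≤x (1≤^ (RO.trans (≤-by 0≤a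
                             (solve 1 (λ a → (:1 :+ a) :- :1 := a) R.refl a)) (<⇒≤ 1+a<x)) n) ⟩
          x ^ suc n     ∎) xⁿ≤a)

      root-upper : 0# ≤ x → x ^ suc n ≤ a → x ≤ root (suc n) a
      root-upper p q = proj₁ root-isSupremum _ (p , q)

      0≤root : 0# ≤ root (suc n) a
      0≤root = root-upper RO.refl (RO.trans (RO.reflexive (R.zeroˡ _)) 0≤a)

      -- If the power of the supremum σ exceeded a, so would that of a member of the set close to σ;
      -- if it fell short of a, some σ + δ would still be a member. The Lipschitz constant is taken
      -- on [0, σ + 1] to cover the second case, where δ ≤ 1.
      root-power : root (suc n) a ^ suc n ≈ a
      root-power = RO.antisym
        (≤-by (neg (≤-from-ε below)) (solve 2 (λ p a → a :- p := :0 :- (p :- a)) R.refl (σ ^ suc n) a))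
        (≮⇒≥ above)
        where
        σ = root (suc n) a
        0≤σ+1 : 0# ≤ σ + 1#
        0≤σ+1 = 0≤+ 0≤root 0≤1
        L = power-lipschitz (σ + 1#) (suc n) 0≤σ+1
        k = proj₁ L
        0≤k = proj₁ (proj₂ L)
        lipschitz = proj₂ (proj₂ L)
        neg : x ≤ 0# → 0# ≤ 0# - x
        neg = 0≤y-x
        below : ∀ ε → 0# < ε → σ ^ suc n - a ≤ ε
        below ε 0<ε =
          let (δ , 0<δ , _ , kδ≤ε) = small-multiplier 0≤k 0<ε
              (x , (0≤x , xⁿ≤a) , σ-δ≤x) = supremum-approx root-isSupremum δ 0<δ
              x≤σ = root-upper 0≤x xⁿ≤a
          in begin
          σ ^ suc n - a                    ≤⟨ R.+-monoˡ-≤ (- a) (lipschitz x σ 0≤x x≤σ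
            (≤-by 0≤1 (solve 1 (λ s → (s :+ :1) :- s := :1) R.refl σ))) ⟩
          x ^ suc n + k * (σ - x) - a      ≤⟨ R.+-monoˡ-≤ (- a) (+-mono-≤ xⁿ≤a (*-monoˡ-≤ 0≤k
            (≤-by (0≤y-x σ-δ≤x) (solve 3 (λ s x d → d :- (s :- x) := x :- (s :- d)) R.refl σ x δ)))) ⟩
          a + k * δ - a                    ≈⟨ solve 2 (λ a p → (a :+ p) :- a := p) R.refl a (k * δ) ⟩
          k * δ                            ≤⟨ kδ≤ε ⟩
          ε                                ∎
        above : ¬ σ ^ suc n < a
        above σⁿ<a =
          let (δ , 0<δ , δ≤1 , kδ≤) = small-multiplier 0≤k (0<y-x σⁿ<a)
              eq = solve 2 (λ s d → (s :+ d) :- s := d) R.refl σ δ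
              σ≤ = ≤-by (<⇒≤ 0<δ) eq
          in <⇒≱ (<-by 0<δ eq) (root-upper (0≤+ 0≤root (<⇒≤ 0<δ)) (begin
            (σ + δ) ^ suc n                    ≤⟨ lipschitz σ (σ + δ) 0≤root σ≤ (+-monoʳ-≤ σ δ≤1) ⟩
            σ ^ suc n + k * ((σ + δ) - σ)      ≈⟨ R.+-congˡ (R.*-congˡ eq) ⟩
            σ ^ suc n + k * δ                  ≤⟨ +-monoʳ-≤ _ kδ≤ ⟩
            σ ^ suc n + (a - σ ^ suc n)        ≈⟨ solve 2 (λ p a → p :+ (a :- p) := a) R.refl (σ ^ suc n) a ⟩
            a                                  ∎))

    sq-cancel-≤ : 0# ≤ y → x * x ≤ y * y → x ≤ y
    sq-cancel-≤ {y} {x} 0≤y p = ≮⇒≥ λ y<x → <⇒≱ (<-by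
      (0<* (0<y-x y<x) (0<+ (≤-<-trans 0≤y y<x) 0≤y))
      (solve 2 (λ x y → x :* x :- y :* y := (x :- y) :* (x :+ y)) R.refl x y)) p

    sq-cancel-≈ : 0# ≤ x → 0# ≤ y → x * x ≈ y * y → x ≈ y
    sq-cancel-≈ 0≤x 0≤y p = RO.antisym (sq-cancel-≤ 0≤y (RO.reflexive p)) (sq-cancel-≤ 0≤x (RO.reflexive (R.sym p)))

    sq-≤ : x ≤ c → - x ≤ c → x * x ≤ c * c
    sq-≤ {x} {c} p q = ≤-by (0≤* (0≤y-x p) (0≤y-x q))
      (solve 2 (λ x c → c :* c :- x :* x := (c :- x) :* (c :- :- x)) R.refl x c)

    ℂ-commutativeRing : CommutativeRing 0ℓ 0ℓ
    ℂ-commutativeRing = record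
      { Carrier = ℂ
      ; _≈_ = _≈ᶜ_
      ; _+_ = _+ᶜ_
      ; _*_ = _*ᶜ_
      ; -_ = -ᶜ_
      ; 0# = 0ᶜ
      ; 1# = 1ᶜ
      ; isCommutativeRing = record
        { isRing = record
          { +-isAbelianGroup = record
            { isGroup = record
              { isMonoid = record
                { isSemigroup = record
                  { isMagma = record
                    { isEquivalence = Setoid.isEquivalence ℂ-setoid
                    ; ∙-cong = λ (p , q) (r , s) → R.+-cong p r , R.+-cong q s
                    }
                  ; assoc = λ x y z → R.+-assoc _ _ _ , R.+-assoc _ _ _
                  }
                ; identity = (λ x → R.+-identityˡ _ , R.+-identityˡ _) , (λ x → R.+-identityʳ _ , R.+-identityʳ _)
                }
              ; inverse = (λ x → R.-‿inverseˡ _ , R.-‿inverseˡ _) , (λ x → R.-‿inverseʳ _ , R.-‿inverseʳ _)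
              ; ⁻¹-cong = λ (p , q) → R.-‿cong p , R.-‿cong q
              }
            ; comm = λ x y → R.+-comm _ _ , R.+-comm _ _
            }
          ; *-cong = λ (p , q) (r , s) →
              R.+-cong (R.*-cong p r) (R.-‿cong (R.*-cong q s)) , R.+-cong (R.*-cong p s) (R.*-cong q r)
          ; *-assoc = λ (a +i b) (c +i d) (e +i f) →
              solve 6 (λ a b c d e f → (a :* c :- b :* d) :* e :- (a :* d :+ b :* c) :* f :=
                a :* (c :* e :- d :* f) :- b :* (c :* f :+ d :* e)) R.refl a b c d e f ,
              solve 6 (λ a b c d e f → (a :* c :- b :* d) :* f :+ (a :* d :+ b :* c) :* e :=
                a :* (c :* f :+ d :* e) :+ b :* (c :* e :- d :* f)) R.refl a b c d e f
          ; *-identity =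
              (λ (a +i b) → solve 2 (λ a b → :1 :* a :- :0 :* b := a) R.refl a b ,
                            solve 2 (λ a b → :1 :* b :+ :0 :* a := b) R.refl a b) ,
              (λ (a +i b) → solve 2 (λ a b → a :* :1 :- b :* :0 := a) R.refl a b ,
                            solve 2 (λ a b → a :* :0 :+ b :* :1 := b) R.refl a b)
          ; distrib =
              (λ (a +i b) (c +i d) (e +i f) →
                solve 6 (λ a b c d e f → a :* (c :+ e) :- b :* (d :+ f) :=
                  (a :* c :- b :* d) :+ (a :* e :- b :* f)) R.refl a b c d e f ,
                solve 6 (λ a b c d e f → a :* (d :+ f) :+ b :* (c :+ e) :=
                  (a :* d :+ b :* c) :+ (a :* f :+ b :* e)) R.refl a b c d e f) ,
              (λ (a +i b) (c +i d) (e +i f) →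
                solve 6 (λ a b c d e f → (c :+ e) :* a :- (d :+ f) :* b :=
                  (c :* a :- d :* b) :+ (e :* a :- f :* b)) R.refl a b c d e f ,
                solve 6 (λ a b c d e f → (c :+ e) :* b :+ (d :+ f) :* a :=
                  (c :* b :+ d :* a) :+ (e :* b :+ f :* a)) R.refl a b c d e f)
          }
        ; *-comm = λ (a +i b) (c +i d) →
            solve 4 (λ a b c d → a :* c :- b :* d := c :* a :- d :* b) R.refl a b c d ,
            solve 4 (λ a b c d → a :* d :+ b :* c := c :* b :+ d :* a) R.refl a b c d
        }
      }

    module ℂR = CommutativeRing ℂ-commutativeRing

    normSq : ℂ → ℝ
    normSq z = re z * re z + im z * im z

    0≤normSq : ∀ z → 0# ≤ normSq z
    0≤normSq z = 0≤+ (0≤x² (re z)) (0≤x² (im z))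

    0≤∣_∣ : ∀ z → 0# ≤ ∣ z ∣
    0≤∣ z ∣ = 0≤root 1 (0≤normSq z)

    ∣∣² : ∀ z → ∣ z ∣ * ∣ z ∣ ≈ normSq z
    ∣∣² z = R.trans (R.*-congˡ (R.sym (R.*-identityʳ _))) (root-power 1 (0≤normSq z))

    ∣∣ᶜ-cong : ∀ {z w} → z ≈ᶜ w → ∣ z ∣ ≈ ∣ w ∣
    ∣∣ᶜ-cong {z} {w} (p , q) = sq-cancel-≈ 0≤∣ z ∣ 0≤∣ w ∣
      (R.trans (∣∣² z) (R.trans (R.+-cong (R.*-cong p p) (R.*-cong q q)) (R.sym (∣∣² w))))

    ∣∣-* : ∀ z w → ∣ z *ᶜ w ∣ ≈ ∣ z ∣ * ∣ w ∣
    ∣∣-* z@(a +i b) w@(c +i d) = sq-cancel-≈ 0≤∣ z *ᶜ w ∣ (0≤* 0≤∣ z ∣ 0≤∣ w ∣) (begin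
      ∣ z *ᶜ w ∣ * ∣ z *ᶜ w ∣                ≈⟨ ∣∣² (z *ᶜ w) ⟩
      normSq (z *ᶜ w)                        ≈⟨ solve 4 (λ a b c d →
        (a :* c :- b :* d) :* (a :* c :- b :* d) :+ (a :* d :+ b :* c) :* (a :* d :+ b :* c) :=
        (a :* a :+ b :* b) :* (c :* c :+ d :* d)) R.refl a b c d ⟩
      normSq z * normSq w                    ≈⟨ R.*-cong (∣∣² z) (∣∣² w) ⟨
      ∣ z ∣ * ∣ z ∣ * (∣ w ∣ * ∣ w ∣)        ≈⟨ solve 2 (λ m n → m :* m :* (n :* n) := m :* n :* (m :* n)) R.refl ∣ z ∣ ∣ w ∣ ⟩
      ∣ z ∣ * ∣ w ∣ * (∣ z ∣ * ∣ w ∣)        ∎)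
      where open import Relation.Binary.Reasoning.Setoid R.setoid

    ∣∣-+ : ∀ z w → ∣ z +ᶜ w ∣ ≤ ∣ z ∣ + ∣ w ∣
    ∣∣-+ z@(a +i b) w@(c +i d) = sq-cancel-≤ (0≤+ 0≤∣ z ∣ 0≤∣ w ∣) (begin
      ∣ z +ᶜ w ∣ * ∣ z +ᶜ w ∣                                      ≈⟨ ∣∣² (z +ᶜ w) ⟩
      normSq (z +ᶜ w)                                              ≈⟨ solve 4 (λ a b c d →
        (a :+ c) :* (a :+ c) :+ (b :+ d) :* (b :+ d) :=
        (a :* a :+ b :* b) :+ (c :* c :+ d :* d) :+ ((a :* c :+ b :* d) :+ (a :* c :+ b :* d))) R.refl a b c d ⟩
      normSq z + normSq w + (p + p)                                ≤⟨ +-mono-≤ RO.refl (+-mono-≤ p≤ p≤) ⟩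
      normSq z + normSq w + (∣ z ∣ * ∣ w ∣ + ∣ z ∣ * ∣ w ∣)        ≈⟨ R.+-congʳ (R.+-cong (∣∣² z) (∣∣² w)) ⟨
      ∣ z ∣ * ∣ z ∣ + ∣ w ∣ * ∣ w ∣ + (∣ z ∣ * ∣ w ∣ + ∣ z ∣ * ∣ w ∣) ≈⟨ solve 2 (λ m n →
        m :* m :+ n :* n :+ (m :* n :+ m :* n) := (m :+ n) :* (m :+ n)) R.refl ∣ z ∣ ∣ w ∣ ⟩
      (∣ z ∣ + ∣ w ∣) * (∣ z ∣ + ∣ w ∣)                            ∎)
      where
      open ≤-Reasoning
      p = a * c + b * d
      -- Cauchy-Schwarz, from Lagrange's identity.
      p≤ : p ≤ ∣ z ∣ * ∣ w ∣
      p≤ = sq-cancel-≤ (0≤* 0≤∣ z ∣ 0≤∣ w ∣) (begin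
        p * p                              ≤⟨ ≤-by (0≤x² (a * d - b * c)) (solve 4 (λ a b c d →
          (a :* a :+ b :* b) :* (c :* c :+ d :* d) :- (a :* c :+ b :* d) :* (a :* c :+ b :* d) :=
          (a :* d :- b :* c) :* (a :* d :- b :* c)) R.refl a b c d) ⟩
        normSq z * normSq w                ≈⟨ R.*-cong (∣∣² z) (∣∣² w) ⟨
        ∣ z ∣ * ∣ z ∣ * (∣ w ∣ * ∣ w ∣)    ≈⟨ solve 2 (λ m n → m :* m :* (n :* n) := m :* n :* (m :* n)) R.refl ∣ z ∣ ∣ w ∣ ⟩
        ∣ z ∣ * ∣ w ∣ * (∣ z ∣ * ∣ w ∣)    ∎)

    ∣re∣≤ : ∀ z → ∣ re z ∣ℝ ≤ ∣ z ∣
    ∣re∣≤ z@(a +i b) = ∣∣-≤ (sq-cancel-≤ 0≤∣ z ∣ (RO.trans h (RO.reflexive (R.sym (∣∣² z)))))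
      (sq-cancel-≤ 0≤∣ z ∣ (RO.trans (RO.reflexive (solve 1 (λ a → (:- a) :* (:- a) := a :* a) R.refl a))
        (RO.trans h (RO.reflexive (R.sym (∣∣² z))))))
      where
      h : a * a ≤ normSq z
      h = ≤-by (0≤x² b) (solve 2 (λ a b → (a :+ b) :- a := b) R.refl (a * a) (b * b))

    ∣im∣≤ : ∀ z → ∣ im z ∣ℝ ≤ ∣ z ∣
    ∣im∣≤ z@(a +i b) = ∣∣-≤ (sq-cancel-≤ 0≤∣ z ∣ (RO.trans h (RO.reflexive (R.sym (∣∣² z)))))
      (sq-cancel-≤ 0≤∣ z ∣ (RO.trans (RO.reflexive (solve 1 (λ a → (:- a) :* (:- a) := a :* a) R.refl b))
        (RO.trans h (RO.reflexive (R.sym (∣∣² z))))))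
      where
      h : b * b ≤ normSq z
      h = ≤-by (0≤x² a) (solve 2 (λ a b → (a :+ b) :- b := a) R.refl (a * a) (b * b))

    ∣∣≤re+im : ∀ z {c d} → ∣ re z ∣ℝ ≤ c → ∣ im z ∣ℝ ≤ d → ∣ z ∣ ≤ c + d
    ∣∣≤re+im z@(a +i b) {c} {d} p q = sq-cancel-≤ (0≤+ 0≤c 0≤d) (begin
      ∣ z ∣ * ∣ z ∣       ≈⟨ ∣∣² z ⟩
      a * a + b * b       ≤⟨ +-mono-≤ (sq-≤ (RO.trans (x≤∣x∣ a) p) (RO.trans (-x≤∣x∣ a) p))
                                      (sq-≤ (RO.trans (x≤∣x∣ b) q) (RO.trans (-x≤∣x∣ b) q)) ⟩
      c * c + d * d       ≤⟨ ≤-by (0≤+ (0≤* 0≤c 0≤d) (0≤* 0≤c 0≤d)) (solve 2 (λ c d →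
        (c :+ d) :* (c :+ d) :- (c :* c :+ d :* d) := c :* d :+ c :* d) R.refl c d) ⟩
      (c + d) * (c + d)   ∎)
      where
      open ≤-Reasoning
      0≤c = RO.trans (0≤∣∣ a) p
      0≤d = RO.trans (0≤∣∣ b) q

    ∣∣≤0⇒≈0 : ∀ {z} → ∣ z ∣ ≤ 0# → z ≈ᶜ 0ᶜ
    ∣∣≤0⇒≈0 {z} p = zero′ (RO.trans (∣re∣≤ z) p) , zero′ (RO.trans (∣im∣≤ z) p)
      where
      zero′ : ∣ x ∣ℝ ≤ 0# → x ≈ 0#
      zero′ {x} q = RO.antisym (RO.trans (x≤∣x∣ x) q) (≤-by (0≤y-x (RO.trans (-x≤∣x∣ x) q))
        (solve 1 (λ x → x :- :0 := :0 :- (:- x)) R.refl x))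

    ∣ofℝ∣ : 0# ≤ x → ∣ ofℝ x ∣ ≈ x
    ∣ofℝ∣ {x} p = sq-cancel-≈ 0≤∣ ofℝ x ∣ p (R.trans (∣∣² (ofℝ x))
      (solve 1 (λ x → x :* x :+ :0 :* :0 := x :* x) R.refl x))

    ∣0∣ : ∣ 0ᶜ ∣ ≈ 0#
    ∣0∣ = ∣ofℝ∣ RO.refl

    ∣1∣ : ∣ 1ᶜ ∣ ≈ 1#
    ∣1∣ = ∣ofℝ∣ 0≤1

    ∣-ᶜ∣ : ∀ z → ∣ -ᶜ z ∣ ≈ ∣ z ∣
    ∣-ᶜ∣ z@(a +i b) = sq-cancel-≈ 0≤∣ -ᶜ z ∣ 0≤∣ z ∣ (R.trans (∣∣² (-ᶜ z)) (R.trans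
      (solve 2 (λ a b → (:- a) :* (:- a) :+ (:- b) :* (:- b) := a :* a :+ b :* b) R.refl a b) (R.sym (∣∣² z))))

    infix 9 _⁻¹ᶜ
    _⁻¹ᶜ : ℂ → ℂ
    z ⁻¹ᶜ = (re z * normSq z ⁻¹) +i (- im z * normSq z ⁻¹)

    ⁻¹ᶜ-inverse : ∀ {z} → 0# < ∣ z ∣ → z *ᶜ z ⁻¹ᶜ ≈ᶜ 1ᶜ
    ⁻¹ᶜ-inverse {z@(a +i b)} p =
      R.trans (solve 3 (λ a b i → a :* (a :* i) :- b :* (:- b :* i) := (a :* a :+ b :* b) :* i)
        R.refl a b (normSq z ⁻¹)) (⁻¹-inverseʳ 0<n) ,
      solve 3 (λ a b i → a :* (:- b :* i) :+ b :* (a :* i) := :0) R.refl a b (normSq z ⁻¹)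
      where
      0<n : 0# < normSq z
      0<n = <-≤-trans (0<* p p) (RO.reflexive (∣∣² z))

    ∣⁻¹ᶜ∣ : ∀ {z} → 0# < ∣ z ∣ → ∣ z ⁻¹ᶜ ∣ ≈ ∣ z ∣ ⁻¹
    ∣⁻¹ᶜ∣ {z} p = begin
      ∣ z ⁻¹ᶜ ∣                           ≈⟨ R.*-identityˡ _ ⟨
      1# * ∣ z ⁻¹ᶜ ∣                      ≈⟨ R.*-congʳ (⁻¹-inverseˡ p) ⟨
      ∣ z ∣ ⁻¹ * ∣ z ∣ * ∣ z ⁻¹ᶜ ∣        ≈⟨ R.*-assoc _ _ _ ⟩
      ∣ z ∣ ⁻¹ * (∣ z ∣ * ∣ z ⁻¹ᶜ ∣)      ≈⟨ R.*-congˡ (R.sym (∣∣-* z (z ⁻¹ᶜ))) ⟩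
      ∣ z ∣ ⁻¹ * ∣ z *ᶜ z ⁻¹ᶜ ∣           ≈⟨ R.*-congˡ (R.trans (∣∣ᶜ-cong (⁻¹ᶜ-inverse p)) ∣1∣) ⟩
      ∣ z ∣ ⁻¹ * 1#                       ≈⟨ R.*-identityʳ _ ⟩
      ∣ z ∣ ⁻¹                            ∎
      where open import Relation.Binary.Reasoning.Setoid R.setoid

    geometric-limitᶜ : 0# ≤ θ → θ < 1# → 0# ≤ c → (a : ℕ → ℂ) →
      (∀ n → ∣ a (suc n) +ᶜ -ᶜ a n ∣ ≤ c * θ ^ n) →
      ∃[ l ] ∀ n → ∣ l +ᶜ -ᶜ a n ∣ ≤ (c * (1# - θ) ⁻¹ + c * (1# - θ) ⁻¹) * θ ^ n
    geometric-limitᶜ {θ} {c} 0≤θ θ<1 0≤c a step =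
      let (l₁ , p) = geometric-limit 0≤θ θ<1 0≤c (λ n → re (a n)) (λ n → RO.trans (∣re∣≤ (a (suc n) +ᶜ -ᶜ a n)) (step n))
          (l₂ , q) = geometric-limit 0≤θ θ<1 0≤c (λ n → im (a n)) (λ n → RO.trans (∣im∣≤ (a (suc n) +ᶜ -ᶜ a n)) (step n))
      in l₁ +i l₂ , λ n → RO.trans (∣∣≤re+im ((l₁ +i l₂) +ᶜ -ᶜ a n) (p n) (q n)) (RO.reflexive (R.sym (R.distribʳ _ _ _)))

  open ComplexNumbers public

  -- Norms on ℂ^d: their equivalence, and the induced matrix norms.

  module VectorNorms where

    module ∑ᶜ = SemiringSum ℂR.semiring
    module ∑ℝ = SemiringSum R.semiring
    module ℂS = IntegerSolver ℂ-commutativeRing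
    module VecEq = VectorEquality ℂ-setoid
    module ≋-Reasoning {d : ℕ} = SetoidReasoning (VecEq.≋-setoid d)

    private
      variable
        d n : ℕ
        u v w : ℂ^ d
        M : Matrix d

    ≋-refl : v ≋ v
    ≋-refl _ = ℂR.refl

    ≋-sym : u ≋ v → v ≋ u
    ≋-sym p i = ℂR.sym (p i)

    ≋-trans : u ≋ v → v ≋ w → u ≋ w
    ≋-trans p q i = ℂR.trans (p i) (q i)

    +ᵛ-cong : {u v w t : ℂ^ d} → u ≋ v → w ≋ t → u +ᵛ w ≋ v +ᵛ t
    +ᵛ-cong p q i = ℂR.+-cong (p i) (q i)

    -ᵛ-cong : {u v w t : ℂ^ d} → u ≋ v → w ≋ t → u -ᵛ w ≋ v -ᵛ t
    -ᵛ-cong p q i = ℂR.+-cong (p i) (ℂR.-‿cong (q i))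

    •-cong : ∀ {a b} {u v : ℂ^ d} → a ≈ᶜ b → u ≋ v → a • u ≋ b • v
    •-cong p q i = ℂR.*-cong p (q i)

    •-congˡ : ∀ a {u v : ℂ^ d} → u ≋ v → a • u ≋ a • v
    •-congˡ a q i = ℂR.*-congˡ (q i)

    0ᵛ-identityˡ : ∀ (v : ℂ^ d) → 0ᵛ +ᵛ v ≋ v
    0ᵛ-identityˡ v i = ℂR.+-identityˡ (v i)

    0ᵛ-identityʳ : ∀ (v : ℂ^ d) → v +ᵛ 0ᵛ ≋ v
    0ᵛ-identityʳ v i = ℂR.+-identityʳ (v i)

    •-zeroʳ : ∀ a → a • 0ᵛ {d} ≋ 0ᵛ
    •-zeroʳ a i = ℂR.zeroʳ a

    •-zeroˡ : ∀ (v : ℂ^ d) → 0ᶜ • v ≋ 0ᵛ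
    •-zeroˡ v i = ℂR.zeroˡ (v i)

    •-assoc : ∀ a b (v : ℂ^ d) → a • b • v ≋ (a *ᶜ b) • v
    •-assoc a b v i = ℂR.sym (ℂR.*-assoc a b (v i))

    •-identity : ∀ (v : ℂ^ d) → 1ᶜ • v ≋ v
    •-identity v i = ℂR.*-identityˡ (v i)

    •-inverse : ∀ {z} (v : ℂ^ d) → 0# < ∣ z ∣ → z • z ⁻¹ᶜ • v ≋ v
    •-inverse {z = z} v 0<z = ≋-trans (•-assoc z (z ⁻¹ᶜ) v)
      (≋-trans (•-cong {u = v} (⁻¹ᶜ-inverse 0<z) ≋-refl) (•-identity v))

    -ᵛ-self : u ≋ v → u -ᵛ v ≋ 0ᵛ
    -ᵛ-self {u = u} p i = ℂR.trans (ℂR.+-congˡ (ℂR.-‿cong (ℂR.sym (p i)))) (ℂR.-‿inverseʳ (u i))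

    -ᵛ-zero⁻¹ : u -ᵛ v ≋ 0ᵛ → u ≋ v
    -ᵛ-zero⁻¹ {u = u} {v} p i = ℂR.trans
      (ℂS.solve 2 (λ a b → a ℂS.:= (a ℂS.:- b) ℂS.:+ b) ℂR.refl (u i) (v i))
      (ℂR.trans (ℂR.+-congʳ (p i)) (ℂR.+-identityˡ (v i)))

    ∑-cong : {f g : Fin n → ℂ^ d} → (∀ j → f j ≋ g j) → ∑ f ≋ ∑ g
    ∑-cong p i = ∑ᶜ.sum-cong-≋ (λ j → p j i)

    ∑-zero : {f : Fin n → ℂ^ d} → (∀ j → f j ≋ 0ᵛ) → ∑ f ≋ 0ᵛ
    ∑-zero {n = n} p i = ℂR.trans (∑ᶜ.sum-cong-≋ (λ j → p j i)) (∑ᶜ.sum-replicate-zero n)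

    ∑-+ : ∀ (f g : Fin n → ℂ^ d) → ∑ (λ j → f j +ᵛ g j) ≋ ∑ f +ᵛ ∑ g
    ∑-+ f g i = ∑ᶜ.∑-distrib-+ (λ j → f j i) (λ j → g j i)

    ∑-• : ∀ a (f : Fin n → ℂ^ d) → ∑ (λ j → a • f j) ≋ a • ∑ f
    ∑-• a f i = ℂR.sym (∑ᶜ.*-distribˡ-sum a (λ j → f j i))

    ∑-swap : ∀ {m} (f : Fin m → Fin n → ℂ^ d) → ∑ (λ i → ∑ (f i)) ≋ ∑ (λ j → ∑ (λ i → f i j))
    ∑-swap f k = ∑ᶜ.∑-comm (λ i j → f i j k)

    ∑-- : ∀ (f g : Fin n → ℂ^ d) → ∑ (λ j → f j -ᵛ g j) ≋ ∑ f -ᵛ ∑ g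
    ∑-- {n = zero} f g i = ℂR.sym (ℂR.-‿inverseʳ 0ᶜ)
    ∑-- {n = suc n} f g i = ℂR.trans (ℂR.+-congˡ (∑-- (λ j → f (suc j)) (λ j → g (suc j)) i))
      (ℂS.solve 4 (λ a b c e → (a ℂS.:- b) ℂS.:+ (c ℂS.:- e) ℂS.:= (a ℂS.:+ c) ℂS.:- (b ℂS.:+ e)) ℂR.refl
        (f zero i) (g zero i) (∑ (λ j → f (suc j)) i) (∑ (λ j → g (suc j)) i))

    ⊙-cong : ∀ (M : Matrix d) {u v} → u ≋ v → M ⊙ u ≋ M ⊙ v
    ⊙-cong M p i = ∑ᶜ.sum-cong-≋ (λ j → ℂR.*-congˡ (p j))

    ⊙-+ : ∀ (M : Matrix d) u v → M ⊙ (u +ᵛ v) ≋ M ⊙ u +ᵛ M ⊙ v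
    ⊙-+ M u v i = ℂR.trans (∑ᶜ.sum-cong-≋ (λ j → ℂR.distribˡ (M i j) (u j) (v j)))
      (∑ᶜ.∑-distrib-+ (λ j → M i j *ᶜ u j) (λ j → M i j *ᶜ v j))

    ⊙-• : ∀ (M : Matrix d) a v → M ⊙ (a • v) ≋ a • (M ⊙ v)
    ⊙-• M a v i = ℂR.trans (∑ᶜ.sum-cong-≋ (λ j →
      ℂS.solve 3 (λ m a v → m ℂS.:* (a ℂS.:* v) ℂS.:= a ℂS.:* (m ℂS.:* v)) ℂR.refl (M i j) a (v j)))
      (ℂR.sym (∑ᶜ.*-distribˡ-sum a (λ j → M i j *ᶜ v j)))

    ⊙-0 : ∀ (M : Matrix d) → M ⊙ 0ᵛ ≋ 0ᵛ
    ⊙-0 {d} M i = ℂR.trans (∑ᶜ.sum-cong-≋ (λ j → ℂR.zeroʳ (M i j))) (∑ᶜ.sum-replicate-zero d)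

    ⊙-∑ : ∀ (M : Matrix d) (f : Fin n → ℂ^ d) → M ⊙ ∑ f ≋ ∑ (λ j → M ⊙ f j)
    ⊙-∑ M f i = ℂR.trans (∑ᶜ.sum-cong-≋ (λ k → ∑ᶜ.*-distribˡ-sum (M i k) (λ j → f j k)))
      (∑ᶜ.∑-comm (λ k j → M i k *ᶜ f j k))

    -ᵛ-as-+ : ∀ (u v : ℂ^ d) → u -ᵛ v ≋ u +ᵛ (-ᶜ 1ᶜ) • v
    -ᵛ-as-+ u v i = ℂS.solve 2 (λ a b → a ℂS.:- b ℂS.:= a ℂS.:+ (ℂS.:- ℂS.:1) ℂS.:* b) ℂR.refl (u i) (v i)

    ⊙-- : ∀ (M : Matrix d) u v → M ⊙ (u -ᵛ v) ≋ M ⊙ u -ᵛ M ⊙ v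
    ⊙-- M u v = begin
      M ⊙ (u -ᵛ v)                    ≈⟨ ⊙-cong M (-ᵛ-as-+ u v) ⟩
      M ⊙ (u +ᵛ (-ᶜ 1ᶜ) • v)          ≈⟨ ⊙-+ M u ((-ᶜ 1ᶜ) • v) ⟩
      M ⊙ u +ᵛ M ⊙ ((-ᶜ 1ᶜ) • v)      ≈⟨ +ᵛ-cong ≋-refl (⊙-• M (-ᶜ 1ᶜ) v) ⟩
      M ⊙ u +ᵛ (-ᶜ 1ᶜ) • (M ⊙ v)      ≈⟨ -ᵛ-as-+ (M ⊙ u) (M ⊙ v) ⟨
      M ⊙ u -ᵛ M ⊙ v                  ∎
      where open ≋-Reasoning

    ⊙-⊡ : ∀ (M N : Matrix d) v → (M ⊡ N) ⊙ v ≋ M ⊙ (N ⊙ v)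
    ⊙-⊡ M N v i = begin
      ∑ᶜ (λ k → ∑ᶜ (λ j → M i j *ᶜ N j k) *ᶜ v k)      ≈⟨ ∑ᶜ.sum-cong-≋ (λ k → ∑ᶜ.*-distribʳ-sum (v k) (λ j → M i j *ᶜ N j k)) ⟩
      ∑ᶜ (λ k → ∑ᶜ (λ j → (M i j *ᶜ N j k) *ᶜ v k))    ≈⟨ ∑ᶜ.∑-comm (λ k j → (M i j *ᶜ N j k) *ᶜ v k) ⟩
      ∑ᶜ (λ j → ∑ᶜ (λ k → (M i j *ᶜ N j k) *ᶜ v k))    ≈⟨ ∑ᶜ.sum-cong-≋ (λ j → ∑ᶜ.sum-cong-≋ (λ k → ℂR.*-assoc (M i j) (N j k) (v k))) ⟩
      ∑ᶜ (λ j → ∑ᶜ (λ k → M i j *ᶜ (N j k *ᶜ v k)))    ≈⟨ ∑ᶜ.sum-cong-≋ (λ j → ∑ᶜ.*-distribˡ-sum (M i j) (λ k → N j k *ᶜ v k)) ⟨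
      ∑ᶜ (λ j → M i j *ᶜ ∑ᶜ (λ k → N j k *ᶜ v k))      ∎
      where open SetoidReasoning ℂ-setoid

    ∑ᴹ-⊙ : ∀ (A : Fin n → Matrix d) v → ∑ᴹ A ⊙ v ≋ ∑ (λ r → A r ⊙ v)
    ∑ᴹ-⊙ A v i = ℂR.trans (∑ᶜ.sum-cong-≋ (λ j → ∑ᶜ.*-distribʳ-sum (v j) (λ r → A r i j)))
      (∑ᶜ.∑-comm (λ j r → A r i j *ᶜ v j))

    ⊙-1ᴹ : ∀ (v : ℂ^ d) → 1ᴹ ⊙ v ≋ v
    ⊙-1ᴹ {suc d} v zero = ℂR.trans
      (ℂR.+-cong (ℂR.*-identityˡ (v zero)) (ℂR.trans (∑ᶜ.sum-cong-≋ (λ j → ℂR.zeroˡ (v (suc j)))) (∑ᶜ.sum-replicate-zero d)))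
      (ℂR.+-identityʳ (v zero))
    ⊙-1ᴹ {suc d} v (suc i) = ℂR.trans (ℂR.+-cong (ℂR.zeroˡ (v zero))
      (ℂR.trans (∑ᶜ.sum-cong-≋ (λ j → ℂR.*-congʳ (1ᴹ-suc j))) (⊙-1ᴹ (λ j → v (suc j)) i)))
      (ℂR.+-identityˡ (v (suc i)))
      where
      1ᴹ-suc : ∀ j → 1ᴹ (suc i) (suc j) ≈ᶜ 1ᴹ i j
      1ᴹ-suc j with i Fin.≟ j
      ... | yes _ = ℂR.refl
      ... | no  _ = ℂR.refl

    sum-mono : {f g : Fin n → ℝ} → (∀ i → f i ≤ g i) → sum f ≤ sum g
    sum-mono {n = zero}  p = RO.refl
    sum-mono {n = suc n} p = +-mono-≤ (p zero) (sum-mono (λ i → p (suc i)))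

    0≤sum : {f : Fin n → ℝ} → (∀ i → 0# ≤ f i) → 0# ≤ sum f
    0≤sum {n = zero}  p = RO.refl
    0≤sum {n = suc n} p = 0≤+ (p zero) (0≤sum (λ i → p (suc i)))

    term≤sum : (f : Fin n → ℝ) → (∀ i → 0# ≤ f i) → ∀ i → f i ≤ sum f
    term≤sum f p zero = RO.trans (RO.reflexive (R.sym (R.+-identityʳ _))) (+-monoʳ-≤ _ (0≤sum (λ i → p (suc i))))
    term≤sum f p (suc i) = RO.trans (RO.reflexive (R.sym (R.+-identityˡ _)))
      (+-mono-≤ (p zero) (term≤sum (f ∘ suc) (λ i → p (suc i)) i))

    ∣∑∣≤ : ∀ (f : Fin n → ℂ) → ∣ ∑ᶜ f ∣ ≤ sum (λ j → ∣ f j ∣)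
    ∣∑∣≤ {n = zero}  f = RO.reflexive ∣0∣
    ∣∑∣≤ {n = suc n} f = RO.trans (∣∣-+ (f zero) (∑ᶜ (f ∘ suc))) (+-monoʳ-≤ _ (∣∑∣≤ (f ∘ suc)))

    sup-nonNegative : ∀ P → (∀ x → P x → 0# ≤ x) → 0# ≤ sup P
    sup-nonNegative P h with em {∃ P × ∃ (UpperBound P)}
    ... | yes ((x , px) , bdd) = RO.trans (h x px) (proj₁ (proj₂ (complete P (x , px) bdd)) x px)
    ... | no  _                = RO.refl

    module NormProperties (N : Norm d) where
      open Norm N

      ‖0‖ : ‖ 0ᵛ ‖ ≈ 0#
      ‖0‖ = R.trans (cong (≋-sym (•-zeroˡ 0ᵛ))) (R.trans (homogeneous 0ᶜ 0ᵛ) (R.trans (R.*-congʳ ∣0∣) (R.zeroˡ _)))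

      ‖≋0‖ : v ≋ 0ᵛ → ‖ v ‖ ≈ 0#
      ‖≋0‖ p = R.trans (cong p) ‖0‖

      ‖-‖≤ : ∀ u v → ‖ u -ᵛ v ‖ ≤ ‖ u ‖ + ‖ v ‖
      ‖-‖≤ u v = begin
        ‖ u -ᵛ v ‖                      ≈⟨ cong (-ᵛ-as-+ u v) ⟩
        ‖ u +ᵛ (-ᶜ 1ᶜ) • v ‖            ≤⟨ triangle u ((-ᶜ 1ᶜ) • v) ⟩
        ‖ u ‖ + ‖ (-ᶜ 1ᶜ) • v ‖         ≈⟨ R.+-congˡ (homogeneous (-ᶜ 1ᶜ) v) ⟩
        ‖ u ‖ + ∣ -ᶜ 1ᶜ ∣ * ‖ v ‖       ≈⟨ R.+-congˡ (R.*-congʳ (R.trans (∣-ᶜ∣ 1ᶜ) ∣1∣)) ⟩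
        ‖ u ‖ + 1# * ‖ v ‖              ≈⟨ R.+-congˡ (R.*-identityˡ _) ⟩
        ‖ u ‖ + ‖ v ‖                   ∎
        where open ≤-Reasoning

      ‖-‖-sym : ∀ u v → ‖ u -ᵛ v ‖ ≈ ‖ v -ᵛ u ‖
      ‖-‖-sym u v = R.trans (cong λ i → ℂS.solve 2 (λ a b → a ℂS.:- b ℂS.:= (ℂS.:- ℂS.:1) ℂS.:* (b ℂS.:- a)) ℂR.refl (u i) (v i))
        (R.trans (homogeneous (-ᶜ 1ᶜ) (v -ᵛ u))
          (R.trans (R.*-congʳ (R.trans (∣-ᶜ∣ 1ᶜ) ∣1∣)) (R.*-identityˡ _)))

      ‖-‖-triangle : ∀ u v w → ‖ u -ᵛ w ‖ ≤ ‖ u -ᵛ v ‖ + ‖ v -ᵛ w ‖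
      ‖-‖-triangle u v w = RO.trans (RO.reflexive (cong λ i →
        ℂS.solve 3 (λ a b c → a ℂS.:- c ℂS.:= (a ℂS.:- b) ℂS.:+ (b ℂS.:- c)) ℂR.refl (u i) (v i) (w i)))
        (triangle (u -ᵛ v) (v -ᵛ w))

      ‖∑‖≤ : ∀ (f : Fin n → ℂ^ d) → ‖ ∑ f ‖ ≤ sum (λ j → ‖ f j ‖)
      ‖∑‖≤ {n = zero}  f = RO.reflexive ‖0‖
      ‖∑‖≤ {n = suc n} f = RO.trans (triangle (f zero) (∑ (f ∘ suc))) (+-monoʳ-≤ _ (‖∑‖≤ (f ∘ suc)))

      ‖‖≤0⇒≋0 : ‖ v ‖ ≤ 0# → v ≋ 0ᵛ
      ‖‖≤0⇒≋0 {v} p = definite v (RO.antisym p (nonNegative v))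

    infixr 5 _◂_
    _◂_ : ℂ → ℂ^ d → ℂ^ (suc d)
    (a ◂ v) zero    = a
    (a ◂ v) (suc i) = v i

    -- Carries the induction on the dimension in both halves of the equivalence of norms.
    restrict : Norm (suc d) → Norm d
    restrict N = record
      { ‖_‖         = λ v → N.‖ 0ᶜ ◂ v ‖
      ; cong        = λ p → N.cong λ { zero → ℂR.refl ; (suc i) → p i }
      ; nonNegative = λ v → N.nonNegative _
      ; definite    = λ v p i → N.definite _ p (suc i)
      ; homogeneous = λ z v → R.trans (N.cong λ { zero → ℂR.sym (ℂR.zeroʳ z) ; (suc i) → ℂR.refl }) (N.homogeneous z (0ᶜ ◂ v))
      ; triangle    = λ u v → RO.trans (RO.reflexive (N.cong λ { zero → ℂR.sym (ℂR.+-identityˡ 0ᶜ) ; (suc i) → ℂR.refl }))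
                                (N.triangle (0ᶜ ◂ u) (0ᶜ ◂ v))
      }
      where module N = Norm N

    module _ (N : Norm (suc d)) where
      open Norm N
      open NormProperties N
      open ≤-Reasoning

      first : ℂ^ (suc d)
      first = 1ᶜ ◂ 0ᵛ

      split-first : ∀ v → v ≋ v zero • first +ᵛ (0ᶜ ◂ v ∘ suc)
      split-first v zero    = ℂS.solve 1 (λ a → a ℂS.:= a ℂS.:* ℂS.:1 ℂS.:+ ℂS.:0) ℂR.refl (v zero)
      split-first v (suc i) = ℂS.solve 2 (λ a b → b ℂS.:= a ℂS.:* ℂS.:0 ℂS.:+ b) ℂR.refl (v zero) (v (suc i))

      norm-split-first-≤ : ∀ v → ‖ v ‖ ≤ ∣ v zero ∣ * ‖ first ‖ + ‖ 0ᶜ ◂ v ∘ suc ‖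
      norm-split-first-≤ v = begin
        ‖ v ‖                                              ≈⟨ cong (split-first v) ⟩
        ‖ v zero • first +ᵛ (0ᶜ ◂ v ∘ suc) ‖               ≤⟨ triangle _ _ ⟩
        ‖ v zero • first ‖ + ‖ 0ᶜ ◂ v ∘ suc ‖              ≈⟨ R.+-congʳ (homogeneous (v zero) first) ⟩
        ∣ v zero ∣ * ‖ first ‖ + ‖ 0ᶜ ◂ v ∘ suc ‖          ∎

      norm-tail-≤ : ∀ v → ‖ 0ᶜ ◂ v ∘ suc ‖ ≤ ‖ v ‖ + ∣ v zero ∣ * ‖ first ‖
      norm-tail-≤ v = begin
        ‖ 0ᶜ ◂ v ∘ suc ‖                        ≈⟨ cong eq ⟩
        ‖ v -ᵛ v zero • first ‖                 ≤⟨ ‖-‖≤ v (v zero • first) ⟩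
        ‖ v ‖ + ‖ v zero • first ‖              ≈⟨ R.+-congˡ (homogeneous (v zero) first) ⟩
        ‖ v ‖ + ∣ v zero ∣ * ‖ first ‖          ∎
        where
        eq : (0ᶜ ◂ v ∘ suc) ≋ v -ᵛ v zero • first
        eq zero    = ℂS.solve 1 (λ a → ℂS.:0 ℂS.:= a ℂS.:- a ℂS.:* ℂS.:1) ℂR.refl (v zero)
        eq (suc i) = ℂS.solve 2 (λ a b → b ℂS.:= b ℂS.:- a ℂS.:* ℂS.:0) ℂR.refl (v zero) (v (suc i))

    norm≤coordinates : ∀ (N : Norm d) → let open Norm N in
      ∃[ b ] 0# ≤ b × (∀ v m → (∀ i → ∣ v i ∣ ≤ m) → ‖ v ‖ ≤ b * m)
    norm≤coordinates {zero} N = 0# , RO.refl , λ v m _ →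
      RO.reflexive (R.trans (NormProperties.‖≋0‖ N {v = v} (λ ())) (R.sym (R.zeroˡ m)))
    norm≤coordinates {suc d} N =
      let (b , 0≤b , h) = norm≤coordinates (restrict N) in
      ‖ first N ‖ + b , 0≤+ (nonNegative (first N)) 0≤b , λ v m v≤m → begin
        ‖ v ‖                                           ≤⟨ norm-split-first-≤ N v ⟩
        ∣ v zero ∣ * ‖ first N ‖ + ‖ 0ᶜ ◂ v ∘ suc ‖     ≤⟨ +-mono-≤ (*-monoʳ-≤ (nonNegative (first N)) (v≤m zero))
                                                              (h (v ∘ suc) m (v≤m ∘ suc)) ⟩
        m * ‖ first N ‖ + b * m                         ≈⟨ solve 3 (λ m f b → m :* f :+ b :* m := (f :+ b) :* m) R.refl m ‖ first N ‖ b ⟩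
        (‖ first N ‖ + b) * m                           ∎
      where
      open Norm N
      open ≤-Reasoning

    -- If the distance from the first basis vector to the span of the others were
    -- 0, a minimising sequence would converge, by the equivalence in dimension d.
    coordinates≤norm : ∀ (N : Norm d) → let open Norm N in
      ∃[ c ] 0# ≤ c × (∀ v i → ∣ v i ∣ ≤ c * ‖ v ‖)
    coordinates≤norm {zero} N = 0# , RO.refl , λ v ()
    coordinates≤norm {suc d} N = result
      where
      open Norm N
      open NormProperties N
      open ≤-Reasoning
      ih = coordinates≤norm (restrict N)
      c = proj₁ ih
      0≤c = proj₁ (proj₂ ih)
      coord = proj₂ (proj₂ ih)

      distance : ∃[ δ ] 0# < δ × (∀ w → δ ≤ ‖ 1ᶜ ◂ w ‖)
      distance with em {∃[ δ ] 0# < δ × (∀ w → δ ≤ ‖ 1ᶜ ◂ w ‖)}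
      ... | yes p = p
      -- The limit 1 ◂ l of the minimising sequence has norm 0, although its first coordinate is 1.
      ... | no ¬p = ⊥-elim (R.0≉1 (R.sym (proj₁ (‖‖≤0⇒≋0 ‖1◂l‖≤0 zero))))
        where
        near : ∀ k → ∃[ w ] ‖ 1ᶜ ◂ w ‖ ≤ ½ ^ k
        near k with em {∃[ w ] ‖ 1ᶜ ◂ w ‖ ≤ ½ ^ k}
        ... | yes q = q
        ... | no ¬q = ⊥-elim (¬p (½ ^ k , 0<^ 0<½ k , λ w → ≮⇒≥ λ r → ¬q (w , <⇒≤ r)))
        s : ℕ → ℂ^ d
        s k = proj₁ (near k)
        sub : ∀ (u v : ℂ^ d) → (0ᶜ ◂ (u -ᵛ v)) ≋ (1ᶜ ◂ u) -ᵛ (1ᶜ ◂ v)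
        sub u v zero    = ℂR.sym (ℂR.-‿inverseʳ 1ᶜ)
        sub u v (suc i) = ℂR.refl
        step : ∀ i k → ∣ s (suc k) i +ᶜ -ᶜ s k i ∣ ≤ c * 2# * ½ ^ k
        step i k = begin
          ∣ s (suc k) i +ᶜ -ᶜ s k i ∣                       ≤⟨ coord (s (suc k) -ᵛ s k) i ⟩
          c * ‖ 0ᶜ ◂ (s (suc k) -ᵛ s k) ‖                   ≈⟨ R.*-congˡ (cong (sub (s (suc k)) (s k))) ⟩
          c * ‖ (1ᶜ ◂ s (suc k)) -ᵛ (1ᶜ ◂ s k) ‖            ≤⟨ *-monoˡ-≤ 0≤c (RO.trans (‖-‖≤ _ _) (+-mono-≤ (proj₂ (near (suc k))) (proj₂ (near k)))) ⟩
          c * (½ * ½ ^ k + ½ ^ k)                           ≤⟨ *-monoˡ-≤ 0≤c (R.+-monoˡ-≤ _ (*-monoʳ-≤ (0≤^ (<⇒≤ 0<½) k) (<⇒≤ ½<1))) ⟩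
          c * (1# * ½ ^ k + ½ ^ k)                          ≈⟨ solve 2 (λ c p → c :* (:1 :* p :+ p) := c :* (:1 :+ :1) :* p) R.refl c (½ ^ k) ⟩
          c * 2# * ½ ^ k                                    ∎
        limits : ∀ i → _
        limits i = geometric-limitᶜ (<⇒≤ 0<½) ½<1 (0≤* 0≤c (<⇒≤ 0<2)) (λ k → s k i) (step i)
        l : ℂ^ d
        l i = proj₁ (limits i)
        e = c * 2# * (1# - ½) ⁻¹ + c * 2# * (1# - ½) ⁻¹
        upper = norm≤coordinates (restrict N)
        b = proj₁ upper
        ‖1◂l‖≤ : ∀ k → ‖ 1ᶜ ◂ l ‖ ≤ (b * e + 1#) * ½ ^ k
        ‖1◂l‖≤ k = begin
          ‖ 1ᶜ ◂ l ‖                                  ≈⟨ cong eq ⟩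
          ‖ (0ᶜ ◂ (l -ᵛ s k)) +ᵛ (1ᶜ ◂ s k) ‖         ≤⟨ triangle _ _ ⟩
          ‖ 0ᶜ ◂ (l -ᵛ s k) ‖ + ‖ 1ᶜ ◂ s k ‖          ≤⟨ +-mono-≤ (proj₂ (proj₂ upper) (l -ᵛ s k) (e * ½ ^ k) (λ i → proj₂ (limits i) k)) (proj₂ (near k)) ⟩
          b * (e * ½ ^ k) + ½ ^ k                     ≈⟨ solve 3 (λ b e p → b :* (e :* p) :+ p := (b :* e :+ :1) :* p) R.refl b e (½ ^ k) ⟩
          (b * e + 1#) * ½ ^ k                        ∎
          where
          eq : (1ᶜ ◂ l) ≋ (0ᶜ ◂ (l -ᵛ s k)) +ᵛ (1ᶜ ◂ s k)
          eq zero    = ℂR.sym (ℂR.+-identityˡ 1ᶜ)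
          eq (suc i) = ℂS.solve 2 (λ a b → a ℂS.:= (a ℂS.:- b) ℂS.:+ b) ℂR.refl (l i) (s k i)
        ‖1◂l‖≤0 : ‖ 1ᶜ ◂ l ‖ ≤ 0#
        ‖1◂l‖≤0 = ≤-from-geometric (<⇒≤ 0<½) ½<1 (b * e + 1#) ‖1◂l‖≤

      δ = proj₁ distance
      0<δ = proj₁ (proj₂ distance)
      0≤δ⁻¹ = 0≤⁻¹ 0<δ
      f = ‖ first N ‖

      head≤ : ∀ v → ∣ v zero ∣ ≤ δ ⁻¹ * ‖ v ‖
      head≤ v = *-cancel-≤ 0<δ (RO.trans δ∣v₀∣≤ (RO.reflexive (R.sym
        (R.trans (R.sym (R.*-assoc _ _ _)) (R.trans (R.*-congʳ (⁻¹-inverseʳ 0<δ)) (R.*-identityˡ _))))))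
        where
        δ∣v₀∣≤ : δ * ∣ v zero ∣ ≤ ‖ v ‖
        δ∣v₀∣≤ with em {0# < ∣ v zero ∣}
        ... | no ¬p = begin
          δ * ∣ v zero ∣   ≤⟨ *-monoˡ-≤ (<⇒≤ 0<δ) (≮⇒≥ ¬p) ⟩
          δ * 0#           ≈⟨ R.zeroʳ δ ⟩
          0#               ≤⟨ nonNegative v ⟩
          ‖ v ‖            ∎
        -- After division by its first coordinate, v has the form 1 ◂ t, of norm at least δ.
        ... | yes p = begin
          δ * ∣ v zero ∣             ≤⟨ *-monoʳ-≤ (<⇒≤ p) (proj₂ (proj₂ distance) t) ⟩
          ‖ 1ᶜ ◂ t ‖ * ∣ v zero ∣    ≈⟨ R.*-comm _ _ ⟩
          ∣ v zero ∣ * ‖ 1ᶜ ◂ t ‖    ≈⟨ homogeneous (v zero) (1ᶜ ◂ t) ⟨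
          ‖ v zero • (1ᶜ ◂ t) ‖      ≈⟨ cong eq ⟩
          ‖ v ‖                      ∎
          where
          t : ℂ^ d
          t = (v zero ⁻¹ᶜ) • (v ∘ suc)
          eq : v zero • (1ᶜ ◂ t) ≋ v
          eq zero    = ℂR.*-identityʳ (v zero)
          eq (suc i) = •-inverse (v ∘ suc) p i

      -- A common constant: δ⁻¹ serves the first coordinate and c (1 + δ⁻¹ f) the others, whose part
      -- of v is v minus a multiple of the first basis vector.
      k = δ ⁻¹ + c * (1# + δ ⁻¹ * f)
      0≤c[1+δ⁻¹f] : 0# ≤ c * (1# + δ ⁻¹ * f)
      0≤c[1+δ⁻¹f] = 0≤* 0≤c (0≤+ 0≤1 (0≤* 0≤δ⁻¹ (nonNegative (first N))))

      bound : ∀ v i → ∣ v i ∣ ≤ k * ‖ v ‖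
      bound v zero = RO.trans (head≤ v) (*-monoʳ-≤ (nonNegative v)
        (≤-by 0≤c[1+δ⁻¹f] (solve 2 (λ a b → (a :+ b) :- a := b) R.refl (δ ⁻¹) (c * (1# + δ ⁻¹ * f)))))
      bound v (suc i) = begin
        ∣ v (suc i) ∣                           ≤⟨ coord (v ∘ suc) i ⟩
        c * ‖ 0ᶜ ◂ v ∘ suc ‖                    ≤⟨ *-monoˡ-≤ 0≤c (norm-tail-≤ N v) ⟩
        c * (‖ v ‖ + ∣ v zero ∣ * f)            ≤⟨ *-monoˡ-≤ 0≤c (+-monoʳ-≤ _ (*-monoʳ-≤ (nonNegative (first N)) (head≤ v))) ⟩
        c * (‖ v ‖ + δ ⁻¹ * ‖ v ‖ * f)          ≤⟨ ≤-by (0≤* 0≤δ⁻¹ (nonNegative v)) (solve 4 (λ c n i f →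
          (i :+ c :* (:1 :+ i :* f)) :* n :- c :* (n :+ i :* n :* f) := i :* n) R.refl c ‖ v ‖ (δ ⁻¹) f) ⟩
        k * ‖ v ‖                               ∎

      result : ∃[ c ] 0# ≤ c × (∀ v i → ∣ v i ∣ ≤ c * ‖ v ‖)
      result = k , 0≤+ 0≤δ⁻¹ 0≤c[1+δ⁻¹f] , bound

    module _ (N : Norm d) where
      open Norm N
      open NormProperties N
      open ≤-Reasoning

      -- Bounds the set whose supremum is `induced M`; on an unbounded set `sup` would take its
      -- default value 0.
      matrix-bounded : ∀ M → ∃[ a ] 0# ≤ a × (∀ v → ‖ M ⊙ v ‖ ≤ a * ‖ v ‖)
      matrix-bounded M =
        let (b , 0≤b , upper) = norm≤coordinates N
            (c , 0≤c , lower) = coordinates≤norm N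
            row = λ i → sum (λ j → ∣ M i j ∣)
            0≤row = λ i → 0≤sum (λ j → 0≤∣ M i j ∣)
            t = sum row
            0≤t = 0≤sum 0≤row
        in b * (t * c) , 0≤* 0≤b (0≤* 0≤t 0≤c) , λ v →
        let entry : ∀ i → ∣ (M ⊙ v) i ∣ ≤ t * c * ‖ v ‖
            entry i = begin
              ∣ (M ⊙ v) i ∣                              ≤⟨ ∣∑∣≤ (λ j → M i j *ᶜ v j) ⟩
              sum (λ j → ∣ M i j *ᶜ v j ∣)               ≈⟨ ∑ℝ.sum-cong-≋ (λ j → ∣∣-* (M i j) (v j)) ⟩
              sum (λ j → ∣ M i j ∣ * ∣ v j ∣)            ≤⟨ sum-mono (λ j → *-monoˡ-≤ 0≤∣ M i j ∣ (lower v j)) ⟩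
              sum (λ j → ∣ M i j ∣ * (c * ‖ v ‖))        ≈⟨ ∑ℝ.*-distribʳ-sum (c * ‖ v ‖) (λ j → ∣ M i j ∣) ⟨
              row i * (c * ‖ v ‖)                        ≤⟨ *-monoʳ-≤ (0≤* 0≤c (nonNegative v)) (term≤sum row 0≤row i) ⟩
              t * (c * ‖ v ‖)                            ≈⟨ R.*-assoc _ _ _ ⟨
              t * c * ‖ v ‖                              ∎
        in RO.trans (upper (M ⊙ v) _ entry) (RO.reflexive (R.sym (R.*-assoc _ _ _)))

      0≤induced : ∀ M → 0# ≤ induced M
      0≤induced M = sup-nonNegative _ λ { x (v , _ , eq) → RO.trans (nonNegative (M ⊙ v)) (RO.reflexive (R.sym eq)) }

      -- The supremum runs over unit vectors, so that v is normalised. This is impossible only for v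
      -- = 0, a case that also covers the absence of unit vectors, when `induced M` is the default
      -- 0.
      induced-bound : ∀ M v → ‖ M ⊙ v ‖ ≤ induced M * ‖ v ‖
      induced-bound M v with em {0# < ‖ v ‖}
      ... | no ¬p = begin
        ‖ M ⊙ v ‖             ≈⟨ ‖≋0‖ (≋-trans (⊙-cong M (‖‖≤0⇒≋0 {v = v} (≮⇒≥ ¬p))) (⊙-0 M)) ⟩
        0#                    ≤⟨ 0≤* (0≤induced M) (nonNegative v) ⟩
        induced M * ‖ v ‖     ∎
      ... | yes p = begin
        ‖ M ⊙ v ‖                      ≈⟨ cong (⊙-cong M v≋) ⟩
        ‖ M ⊙ (z • t) ‖                ≈⟨ cong (⊙-• M z t) ⟩
        ‖ z • (M ⊙ t) ‖                ≈⟨ homogeneous z (M ⊙ t) ⟩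
        ∣ z ∣ * ‖ M ⊙ t ‖              ≈⟨ R.*-congʳ ∣z∣ ⟩
        ‖ v ‖ * ‖ M ⊙ t ‖              ≤⟨ *-monoˡ-≤ (<⇒≤ p) (proj₁ isSup _ (t , ‖t‖ , R.refl)) ⟩
        ‖ v ‖ * induced M              ≈⟨ R.*-comm _ _ ⟩
        induced M * ‖ v ‖              ∎
        where
        z = ofℝ ‖ v ‖
        ∣z∣ : ∣ z ∣ ≈ ‖ v ‖
        ∣z∣ = ∣ofℝ∣ (<⇒≤ p)
        0<z : 0# < ∣ z ∣
        0<z = <-≤-trans p (RO.reflexive (R.sym ∣z∣))
        t = z ⁻¹ᶜ • v
        v≋ : v ≋ z • t
        v≋ = ≋-sym (•-inverse v 0<z)
        ‖t‖ : ‖ t ‖ ≈ 1#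
        ‖t‖ = R.trans (homogeneous (z ⁻¹ᶜ) v) (R.trans (R.*-cong (∣⁻¹ᶜ∣ 0<z) (R.sym ∣z∣)) (⁻¹-inverseˡ 0<z))
        isSup = sup-isSupremum (λ y → ∃[ v ] ‖ v ‖ ≈ 1# × y ≈ ‖ M ⊙ v ‖) (_ , t , ‖t‖ , R.refl)
          (let (a , 0≤a , h) = matrix-bounded M in a , λ { x (w , ‖w‖ , eq) → begin
            x            ≈⟨ eq ⟩
            ‖ M ⊙ w ‖    ≤⟨ h w ⟩
            a * ‖ w ‖    ≈⟨ R.*-congˡ ‖w‖ ⟩
            a * 1#       ≈⟨ R.*-identityʳ a ⟩
            a            ∎ })

  open VectorNorms public

  -- The joint spectral radius and the norms adapted to it.

  module SpectralRadius where

    ∈-words : ∀ {B K} (w : Word B K) → w ∈ words B K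
    ∈-words []      = here ≡.refl
    ∈-words (r ∷ w) = ∈-cartesianProductWith⁺ _∷_ (∈-allFin r) (∈-words w)

    module _ {B d : ℕ} (A : Fin B → Matrix d) where

      wordProduct-∷ʳ : ∀ {K} (w : Word B K) r v →
        wordProduct A (w ∷ʳ r) ⊙ v ≋ wordProduct A w ⊙ (A r ⊙ v)
      wordProduct-∷ʳ [] r v = begin
        (A r ⊡ 1ᴹ) ⊙ v      ≈⟨ ⊙-⊡ (A r) 1ᴹ v ⟩
        A r ⊙ (1ᴹ ⊙ v)      ≈⟨ ⊙-cong (A r) (⊙-1ᴹ v) ⟩
        A r ⊙ v             ≈⟨ ⊙-1ᴹ (A r ⊙ v) ⟨
        1ᴹ ⊙ (A r ⊙ v)      ∎
        where open ≋-Reasoning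
      wordProduct-∷ʳ (q ∷ w) r v = begin
        (A q ⊡ wordProduct A (w ∷ʳ r)) ⊙ v         ≈⟨ ⊙-⊡ (A q) (wordProduct A (w ∷ʳ r)) v ⟩
        A q ⊙ (wordProduct A (w ∷ʳ r) ⊙ v)         ≈⟨ ⊙-cong (A q) (wordProduct-∷ʳ w r v) ⟩
        A q ⊙ (wordProduct A w ⊙ (A r ⊙ v))        ≈⟨ ⊙-⊡ (A q) (wordProduct A w) (A r ⊙ v) ⟨
        (A q ⊡ wordProduct A w) ⊙ (A r ⊙ v)        ∎
        where open ≋-Reasoning

      -- The letters act in the order in which they are read, so that this is the
      -- product of the reversed word.
      act : ∀ {K} → Word B K → ℂ^ d → ℂ^ d
      act []      v = v
      act (r ∷ w) v = act w (A r ⊙ v)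

      act-cong : ∀ {K} (w : Word B K) {u v} → u ≋ v → act w u ≋ act w v
      act-cong []      p = p
      act-cong (r ∷ w) p = act-cong w (⊙-cong (A r) p)

      act-+ : ∀ {K} (w : Word B K) u v → act w (u +ᵛ v) ≋ act w u +ᵛ act w v
      act-+ []      u v = ≋-refl
      act-+ (r ∷ w) u v = ≋-trans (act-cong w (⊙-+ (A r) u v)) (act-+ w (A r ⊙ u) (A r ⊙ v))

      act-• : ∀ {K} (w : Word B K) a v → act w (a • v) ≋ a • act w v
      act-• []      a v = ≋-refl
      act-• (r ∷ w) a v = ≋-trans (act-cong w (⊙-• (A r) a v)) (act-• w a (A r ⊙ v))

      act-0 : ∀ {K} (w : Word B K) → act w 0ᵛ ≋ 0ᵛ
      act-0 []      = ≋-refl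
      act-0 (r ∷ w) = ≋-trans (act-cong w (⊙-0 (A r))) (act-0 w)

      -- The letters of w′ are those of w in reverse order. The estimates are uniform over all words
      -- of a given length, which reversal permutes.
      act-wordProduct : ∀ {K} (w : Word B K) → ∃[ w′ ] ∀ v → act w v ≋ wordProduct A {K} w′ ⊙ v
      act-wordProduct []      = [] , λ v → ≋-sym (⊙-1ᴹ v)
      act-wordProduct (r ∷ w) = let (w′ , h) = act-wordProduct w in
        w′ ∷ʳ r , λ v → ≋-trans (h (A r ⊙ v)) (≋-sym (wordProduct-∷ʳ w′ r v))

      -- The form in which the joint spectral radius enters the estimates: one norm and one positive
      -- length at which the products respect the rate lam. Such data exist for every lam > λ⋆, and
      -- for λ⋆ if it is attained.
      record Contraction (lam : ℝ) : Set where
        field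
          N         : Norm d
          T         : ℕ
          contracts : ∀ (w : Word B (suc T)) v → Norm.‖_‖ N (act w v) ≤ lam ^ suc T * Norm.‖_‖ N v

      module _ (N : Norm d) (T : ℕ) where
        open Norm N
        private
          norms = List.map (λ w → induced (wordProduct A w)) (words B (suc T))
          m = Extrema.max totalOrder 0# norms

        0≤max : 0# ≤ m
        0≤max = Extrema.v≤max⁺ totalOrder 0# norms (inj₁ RO.refl)

        0≤spectral : 0# ≤ spectral A N (suc T)
        0≤spectral = 0≤root T 0≤max

        spectral⇒contraction : ∀ {lam} → spectral A N (suc T) ≤ lam → Contraction lam
        spectral⇒contraction {lam} s≤l = record
          { N = N ; T = T ; contracts = λ w v → let (w′ , h) = act-wordProduct w in begin
            ‖ act w v ‖                                   ≈⟨ cong (h v) ⟩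
            ‖ wordProduct A w′ ⊙ v ‖                      ≤⟨ induced-bound N (wordProduct A w′) v ⟩
            induced (wordProduct A w′) * ‖ v ‖            ≤⟨ *-monoʳ-≤ (nonNegative v) (Extrema.v≤max⁺ totalOrder 0# norms
              (inj₂ (lose (∈-map⁺ (λ w → induced (wordProduct A w)) (∈-words w′)) RO.refl))) ⟩
            m * ‖ v ‖                                     ≈⟨ R.*-congʳ (root-power T 0≤max) ⟨
            spectral A N (suc T) ^ suc T * ‖ v ‖          ≤⟨ *-monoʳ-≤ (nonNegative v) (^-mono-≤ 0≤spectral s≤l (suc T)) ⟩
            lam ^ suc T * ‖ v ‖                           ∎ }
          where open ≤-Reasoning

      module _ {λ⋆ : ℝ} (jsr : IsJointSpectralRadius A λ⋆) where
        0≤λ⋆ : 0# ≤ λ⋆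
        0≤λ⋆ = ≮⇒≥ λ λ⋆<0 →
          let (N , lim) = jsr
              (n , h) = lim (0# - λ⋆) (0<y-x λ⋆<0)
          -- Index n + 1, since λ_T is meaningful for T ≥ 1 only.
          in <⇒≱ (h (suc n) (ℕ.n≤1+n n)) (RO.trans
            (R.+-monoˡ-≤ (- λ⋆) (0≤spectral N n)) (x≤∣x∣ _))

        jsr⇒contraction : ∀ {lam} → λ⋆ < lam → Contraction lam
        jsr⇒contraction {lam} λ⋆<lam =
          let (N , lim) = jsr
              (n , h) = lim (lam - λ⋆) (0<y-x λ⋆<lam)
          in spectral⇒contraction N n (≤-by (0≤y-x (RO.trans (x≤∣x∣ _) (<⇒≤ (h (suc n) (ℕ.n≤1+n n)))))
            (solve 3 (λ l s j → l :- s := (l :- j) :- (s :- j)) R.refl lam (spectral A N (suc n)) λ⋆))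

        attained⇒contraction : IsAttained A λ⋆ → Contraction λ⋆
        attained⇒contraction (N , suc T , _ , eq) = spectral⇒contraction N T (RO.reflexive (R.sym eq))

      -- v ≼ M bounds v in the norm max_{|w| ≤ T} λ^{-|w|} ‖A_w v‖, for which every
      -- A_r has operator norm at most λ.
      module Adapted {lam : ℝ} (0<lam : 0# < lam) (contraction : Contraction lam) where
        open Contraction contraction public
        open Norm N
        open NormProperties N
        open ≤-Reasoning

        infix 4 _≼_
        _≼_ : ℂ^ d → ℝ → Set
        v ≼ M = ∀ {i} → i ℕ.≤ T → (w : Word B i) → ‖ act w v ‖ ≤ lam ^ i * M

        private
          variable
            u v : ℂ^ d
            M M′ : ℝ

          0≤lam^ : ∀ i → 0# ≤ lam ^ i
          0≤lam^ = 0≤^ (<⇒≤ 0<lam)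

        ≼-cong : u ≋ v → v ≼ M → u ≼ M
        ≼-cong p h i≤T w = RO.trans (RO.reflexive (cong (act-cong w p))) (h i≤T w)

        ≼-mono : M ≤ M′ → v ≼ M → v ≼ M′
        ≼-mono p h {i} i≤T w = RO.trans (h i≤T w) (*-monoˡ-≤ (0≤lam^ i) p)

        ≼-+ : u ≼ M → v ≼ M′ → u +ᵛ v ≼ M + M′
        ≼-+ {u = u} {M = M} {v = v} {M′ = M′} p q {i} i≤T w = begin
          ‖ act w (u +ᵛ v) ‖            ≈⟨ cong (act-+ w u v) ⟩
          ‖ act w u +ᵛ act w v ‖        ≤⟨ triangle (act w u) (act w v) ⟩
          ‖ act w u ‖ + ‖ act w v ‖     ≤⟨ +-mono-≤ (p i≤T w) (q i≤T w) ⟩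
          lam ^ i * M + lam ^ i * M′    ≈⟨ R.distribˡ _ _ _ ⟨
          lam ^ i * (M + M′)            ∎

        ≼-• : ∀ a → v ≼ M → a • v ≼ ∣ a ∣ * M
        ≼-• {v = v} {M = M} a p {i} i≤T w = begin
          ‖ act w (a • v) ‖             ≈⟨ cong (act-• w a v) ⟩
          ‖ a • act w v ‖               ≈⟨ homogeneous a (act w v) ⟩
          ∣ a ∣ * ‖ act w v ‖           ≤⟨ *-monoˡ-≤ 0≤∣ a ∣ (p i≤T w) ⟩
          ∣ a ∣ * (lam ^ i * M)         ≈⟨ solve 3 (λ a l m → a :* (l :* m) := l :* (a :* m)) R.refl ∣ a ∣ (lam ^ i) M ⟩
          lam ^ i * (∣ a ∣ * M)         ∎

        ≼-0 : v ≋ 0ᵛ → 0# ≤ M → v ≼ M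
        ≼-0 p 0≤M {i} i≤T w = RO.trans (RO.reflexive (‖≋0‖ (≋-trans (act-cong w p) (act-0 w)))) (0≤* (0≤lam^ i) 0≤M)

        ≼⇒≤ : v ≼ M → ‖ v ‖ ≤ M
        ≼⇒≤ p = RO.trans (p ℕ.z≤n []) (RO.reflexive (R.*-identityˡ _))

        ≼-step : ∀ r → v ≼ M → A r ⊙ v ≼ lam * M
        ≼-step {v = v} {M = M} r p {i} i≤T w with ℕ.m≤n⇒m<n∨m≡n i≤T
        ... | inj₁ i<T    = RO.trans (p i<T (r ∷ w)) (RO.reflexive
          (solve 3 (λ l q m → l :* q :* m := q :* (l :* m)) R.refl lam (lam ^ i) M))
        ... | inj₂ ≡.refl = begin
          ‖ act (r ∷ w) v ‖       ≤⟨ contracts (r ∷ w) v ⟩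
          lam ^ suc T * ‖ v ‖     ≤⟨ *-monoˡ-≤ (0≤lam^ (suc T)) (≼⇒≤ p) ⟩
          lam * lam ^ T * M       ≈⟨ solve 3 (λ l q m → l :* q :* m := q :* (l :* m)) R.refl lam (lam ^ T) M ⟩
          lam ^ T * (lam * M)     ∎

        -- The converse of `≼⇒≤`, up to a constant. Each letter has norm at most lam b with b = 1 +
        -- a/lam; the summand 1 makes b ≥ 1, so that b^T serves for all lengths i ≤ T. This division
        -- calls for a positive lam.
        norm-≼ : ∃[ c ] 0# ≤ c × ∀ v → v ≼ c * ‖ v ‖
        norm-≼ = b ^ T , 0≤^ 0≤b T , λ v {i} i≤T w → begin
          ‖ act w v ‖                    ≤⟨ act-bound w v ⟩
          lam ^ i * (b ^ i * ‖ v ‖)      ≤⟨ *-monoˡ-≤ (0≤lam^ i) (*-monoʳ-≤ (nonNegative v) (^-monoʳ-≤ 1≤b i≤T)) ⟩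
          lam ^ i * (b ^ T * ‖ v ‖)      ∎
          where
          bounds = λ r → matrix-bounded N (A r)
          a = sum (λ r → proj₁ (bounds r))
          0≤bounds = λ r → proj₁ (proj₂ (bounds r))
          b = 1# + a * lam ⁻¹
          0≤a*lam⁻¹ = 0≤* (0≤sum 0≤bounds) (0≤⁻¹ 0<lam)
          1≤b : 1# ≤ b
          1≤b = ≤-by 0≤a*lam⁻¹ (solve 1 (λ x → (:1 :+ x) :- :1 := x) R.refl (a * lam ⁻¹))
          0≤b = RO.trans 0≤1 1≤b
          letter-bound : ∀ r v → ‖ A r ⊙ v ‖ ≤ lam * b * ‖ v ‖
          letter-bound r v = begin
            ‖ A r ⊙ v ‖                         ≤⟨ proj₂ (proj₂ (bounds r)) v ⟩
            proj₁ (bounds r) * ‖ v ‖            ≤⟨ *-monoʳ-≤ (nonNegative v) (term≤sum (λ r → proj₁ (bounds r)) 0≤bounds r) ⟩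
            a * ‖ v ‖                           ≈⟨ R.*-congʳ (R.trans (R.*-congˡ (⁻¹-inverseʳ 0<lam)) (R.*-identityʳ a)) ⟨
            a * (lam * lam ⁻¹) * ‖ v ‖          ≤⟨ ≤-by (0≤* (<⇒≤ 0<lam) (nonNegative v)) (solve 4 (λ a l i n →
              l :* (:1 :+ a :* i) :* n :- a :* (l :* i) :* n := l :* n) R.refl a lam (lam ⁻¹) ‖ v ‖) ⟩
            lam * b * ‖ v ‖                     ∎
          act-bound : ∀ {i} (w : Word B i) v → ‖ act w v ‖ ≤ lam ^ i * (b ^ i * ‖ v ‖)
          act-bound [] v = RO.reflexive (R.sym (R.trans (R.*-identityˡ _) (R.*-identityˡ _)))
          act-bound {suc i} (r ∷ w) v = begin
            ‖ act w (A r ⊙ v) ‖                          ≤⟨ act-bound w (A r ⊙ v) ⟩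
            lam ^ i * (b ^ i * ‖ A r ⊙ v ‖)              ≤⟨ *-monoˡ-≤ (0≤lam^ i) (*-monoˡ-≤ (0≤^ 0≤b i) (letter-bound r v)) ⟩
            lam ^ i * (b ^ i * (lam * b * ‖ v ‖))        ≈⟨ solve 5 (λ p q l b n → p :* (q :* (l :* b :* n)) := l :* p :* (b :* q :* n))
              R.refl (lam ^ i) (b ^ i) lam b ‖ v ‖ ⟩
            lam ^ suc i * (b ^ suc i * ‖ v ‖)            ∎

        ≼-∑ : ∀ {n} {f : Fin n → ℂ^ d} {q} → 0# ≤ q → (∀ r → f r ≼ q) → ∑ f ≼ ofℕ n * q
        ≼-∑ {zero}      0≤q h = ≼-0 ≋-refl (RO.reflexive (R.sym (R.zeroˡ _)))
        ≼-∑ {suc n} {f} 0≤q h = ≼-mono (RO.reflexive (solve 2 (λ n q → q :+ n :* q := (:1 :+ n) :* q) R.refl (ofℕ n) _))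
          (≼-+ {u = f zero} (h zero) (≼-∑ 0≤q (h ∘ suc)))

        -- The exceptional term enters with coefficient 1 and not n: a recursion with a single
        -- active branch keeps the rate lam, where the plain triangle inequality would give n lam.
        ≼-∑-exceptional : ∀ {n} {f : Fin n → ℂ^ d} {q s} (P : Fin n → Set) → (∀ {r r′} → P r → P r′ → r ≡ r′) →
          0# ≤ q → 0# ≤ s → (∀ r → ¬ P r → f r ≼ q) → (∀ r → P r → f r ≼ s) → ∑ f ≼ s + ofℕ n * q
        ≼-∑-exceptional {zero} {q = q} P unique 0≤q 0≤s hq hs = ≼-0 ≋-refl (0≤+ 0≤s (RO.reflexive (R.sym (R.zeroˡ q))))
        ≼-∑-exceptional {suc n} {f} {q} {s} P unique 0≤q 0≤s hq hs with em {P zero}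
        ... | yes p = ≼-mono (≤-by 0≤q (solve 3 (λ n q s → (s :+ (:1 :+ n) :* q) :- (s :+ n :* q) := q) R.refl (ofℕ n) q s))
          (≼-+ {u = f zero} (hs zero p) (≼-∑ 0≤q (λ r → hq (suc r) (λ p′ → Fin.0≢1+n (unique p p′)))))
        ... | no ¬p = ≼-mono (RO.reflexive (solve 3 (λ n q s → q :+ (s :+ n :* q) := s :+ (:1 :+ n) :* q) R.refl (ofℕ n) q s))
          (≼-+ {u = f zero} (hq zero ¬p) (≼-∑-exceptional (P ∘ suc) (λ p p′ → Fin.suc-injective (unique p p′)) 0≤q 0≤s
            (hq ∘ suc) (hs ∘ suc)))

  open SpectralRadius public

  -- Partial sums, extended to all real arguments.

  module PartialSums where

    when-yes : ∀ {d} {v : ℂ^ d} {P} → P → v when P ≋ v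
    when-yes {P = P} p with em {P}
    ... | yes _ = ≋-refl
    ... | no ¬p = ⊥-elim (¬p p)

    when-no : ∀ {d} {v : ℂ^ d} {P} → ¬ P → v when P ≋ 0ᵛ
    when-no {P = P} ¬p with em {P}
    ... | yes p = ⊥-elim (¬p p)
    ... | no _  = ≋-refl

    when-⇔ : ∀ {d} {u v : ℂ^ d} {P P′} → u ≋ v → (P → P′) → (P′ → P) → u when P ≋ v when P′
    when-⇔ {P = P} {P′} eq f g with em {P} | em {P′}
    ... | yes _ | yes _ = eq
    ... | no  _ | no  _ = ≋-refl
    ... | yes p | no ¬p = ⊥-elim (¬p (f p))
    ... | no ¬p | yes p = ⊥-elim (¬p (g p))

    InUnit : ℝ → Set
    InUnit x = 0# ≤ x × x < 1#

    trichotomy : ∀ x → x < 0# ⊎ InUnit x ⊎ 1# ≤ x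
    trichotomy x with em {x < 0#} | em {x < 1#}
    ... | yes p | _     = inj₁ p
    ... | no ¬p | yes q = inj₂ (inj₁ (≮⇒≥ ¬p , q))
    ... | no ¬p | no ¬q = inj₂ (inj₂ (≮⇒≥ ¬q))

    1≤x-m : ∀ {m n x} → suc m ℕ.≤ n → 0# ≤ x - ofℕ n → 1# ≤ x - ofℕ m
    1≤x-m {m} {n} {x} m<n h = ≤-by (0≤+ h (0≤y-x (ofℕ-mono m<n)))
      (solve 3 (λ x m n → (x :- m) :- :1 := (x :- n) :+ (n :- (:1 :+ m))) R.refl x (ofℕ m) (ofℕ n))

    x-n<0 : ∀ {m n x} → suc m ℕ.≤ n → x - ofℕ m < 1# → x - ofℕ n < 0#
    x-n<0 {m} {n} {x} m<n h = <-by (0<+ (0<y-x h) (0≤y-x (ofℕ-mono m<n)))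
      (solve 3 (λ x m n → :0 :- (x :- n) := (:1 :- (x :- m)) :+ (n :- (:1 :+ m))) R.refl x (ofℕ m) (ofℕ n))

    ∑ᴸ-++ : ∀ {d} {X : Set} (f : X → ℂ^ d) xs ys → ∑ᴸ f (xs ++ ys) ≋ ∑ᴸ f xs +ᵛ ∑ᴸ f ys
    ∑ᴸ-++ f [] ys = ≋-sym (0ᵛ-identityˡ (∑ᴸ f ys))
    ∑ᴸ-++ f (x ∷ xs) ys i = ℂR.trans (ℂR.+-congˡ (∑ᴸ-++ f xs ys i))
      (ℂR.sym (ℂR.+-assoc (f x i) (∑ᴸ f xs i) (∑ᴸ f ys i)))

    filteredSum : ∀ {d} {X : Set} (f : X → ℂ^ d) (P : X → Set) → List X → ℂ^ d
    filteredSum f P xs = ∑ᴸ f (List.filter (λ x → em {P x}) xs)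

    filteredSum-∷ : ∀ {d} {X : Set} (f : X → ℂ^ d) P x xs →
      filteredSum f P (x ∷ xs) ≋ f x when P x +ᵛ filteredSum f P xs
    filteredSum-∷ f P x xs with em {P x}
    ... | yes _ = ≋-refl
    ... | no  _ = ≋-sym (0ᵛ-identityˡ (filteredSum f P xs))

    filteredSum-++ : ∀ {d} {X : Set} (f : X → ℂ^ d) P xs ys →
      filteredSum f P (xs ++ ys) ≋ filteredSum f P xs +ᵛ filteredSum f P ys
    filteredSum-++ f P xs ys = ≋-trans
      (λ i → ℂR.reflexive (≡.cong (λ l → ∑ᴸ f l i) (List.filter-++ (λ x → em {P x}) xs ys)))
      (∑ᴸ-++ f (List.filter (λ x → em {P x}) xs) (List.filter (λ x → em {P x}) ys))

    filteredSum-map : ∀ {d} {X Y : Set} (M : Matrix d) (h : X → Y) (f : Y → ℂ^ d) (g : X → ℂ^ d) P P′ →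
      (∀ x → f (h x) ≋ M ⊙ g x) → (∀ x → P (h x) → P′ x) → (∀ x → P′ x → P (h x)) →
      ∀ xs → filteredSum f P (List.map h xs) ≋ M ⊙ filteredSum g P′ xs
    filteredSum-map M h f g P P′ eq to from [] = ≋-sym (⊙-0 M)
    filteredSum-map M h f g P P′ eq to from (x ∷ xs) = begin
      filteredSum f P (h x ∷ List.map h xs)                  ≈⟨ filteredSum-∷ f P (h x) (List.map h xs) ⟩
      f (h x) when P (h x) +ᵛ filteredSum f P (List.map h xs)
        ≈⟨ +ᵛ-cong (≋-trans (when-⇔ (eq x) (to x) (from x)) (when-⊙ (g x) (P′ x))) (filteredSum-map M h f g P P′ eq to from xs) ⟩
      M ⊙ (g x when P′ x) +ᵛ M ⊙ filteredSum g P′ xs         ≈⟨ ⊙-+ M (g x when P′ x) (filteredSum g P′ xs) ⟨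
      M ⊙ (g x when P′ x +ᵛ filteredSum g P′ xs)             ≈⟨ ⊙-cong M (filteredSum-∷ g P′ x xs) ⟨
      M ⊙ filteredSum g P′ (x ∷ xs)                          ∎
      where
      open ≋-Reasoning
      when-⊙ : ∀ v P → (M ⊙ v) when P ≋ M ⊙ (v when P)
      when-⊙ v P with em {P}
      ... | yes _ = ≋-refl
      ... | no  _ = ≋-sym (⊙-0 M)

    filteredSum-cartesian : ∀ {d} {X Y Z : Set} (c : X → Y → Z) (f : Z → ℂ^ d) P {n} (h : Fin n → X) ys →
      filteredSum f P (List.cartesianProductWith c (List.tabulate h) ys) ≋
      ∑ (λ r → filteredSum f P (List.map (c (h r)) ys))
    filteredSum-cartesian c f P {zero}  h ys = ≋-refl
    filteredSum-cartesian c f P {suc n} h ys = ≋-trans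
      (filteredSum-++ f P (List.map (c (h zero)) ys) (List.cartesianProductWith c (List.tabulate (h ∘ suc)) ys))
      (+ᵛ-cong ≋-refl (filteredSum-cartesian c f P (h ∘ suc) ys))

    ^ᴹ-suc : ∀ {d} (M : Matrix d) K v → (M ^ᴹ suc K) ⊙ v ≋ (M ^ᴹ K) ⊙ (M ⊙ v)
    ^ᴹ-suc M zero v = ≋-trans (⊙-⊡ M 1ᴹ v) (≋-trans (⊙-cong M (⊙-1ᴹ v)) (≋-sym (⊙-1ᴹ (M ⊙ v))))
    ^ᴹ-suc M (suc K) v = begin
      (M ⊡ M ^ᴹ suc K) ⊙ v          ≈⟨ ⊙-⊡ M (M ^ᴹ suc K) v ⟩
      M ⊙ ((M ^ᴹ suc K) ⊙ v)        ≈⟨ ⊙-cong M (^ᴹ-suc M K v) ⟩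
      M ⊙ ((M ^ᴹ K) ⊙ (M ⊙ v))      ≈⟨ ⊙-⊡ M (M ^ᴹ K) (M ⊙ v) ⟨
      (M ^ᴹ suc K) ⊙ (M ⊙ v)        ∎
      where open ≋-Reasoning

    module Summation {B d : ℕ} (2≤B : 2 ℕ.≤ B) (A : Fin B → Matrix d) where

      1≤B : 1# ≤ ofℕ B
      1≤B = 1≤ofℕ (ℕ.≤-trans (ℕ.s≤s ℕ.z≤n) 2≤B)

      0<B : 0# < ofℕ B
      0<B = <-≤-trans 0<1 1≤B

      β : ℝ
      β = ofℕ B ⁻¹

      0<β : 0# < β
      0<β = 0<⁻¹ 0<B

      Bβ : ofℕ B * β ≈ 1#
      Bβ = ⁻¹-inverseʳ 0<B

      β<1 : β < 1#
      β<1 = ≰⇒> λ 1≤β → <⇒≱ 1<B (begin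
        ofℕ B         ≈⟨ R.*-identityʳ _ ⟨
        ofℕ B * 1#    ≤⟨ *-monoˡ-≤ (<⇒≤ 0<B) 1≤β ⟩
        ofℕ B * β     ≈⟨ Bβ ⟩
        1#            ∎)
        where
        open ≤-Reasoning
        1<B : 1# < ofℕ B
        1<B = <-≤-trans (<-by 0<1 (solve 0 (:1 :+ (:1 :+ :0) :- :1 := :1) R.refl)) (ofℕ-mono 2≤B)

      branch : Fin B → ℝ → ℝ
      branch r x = ofℕ B * x - ofℕ (toℕ r)

      branch-cong : ∀ r {x y} → x ≈ y → branch r x ≈ branch r y
      branch-cong r p = R.+-congʳ (R.*-congˡ p)

      -- The intervals [r, r + 1) are disjoint, so that the integer part of B x is the only
      -- candidate.
      branch-unique : ∀ {x r r′} → InUnit (branch r x) → InUnit (branch r′ x) → r ≡ r′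
      branch-unique {x} {r} {r′} (p , q) (p′ , q′) with ℕ.<-cmp (toℕ r) (toℕ r′)
      ... | tri< r<r′ _ _ = ⊥-elim (<⇒≱ q (1≤x-m r<r′ p′))
      ... | tri≈ _ eq _   = Fin.toℕ-injective eq
      ... | tri> _ _ r′<r = ⊥-elim (<⇒≱ q′ (1≤x-m r′<r p))

      branch<0 : ∀ {x} r → x < 0# → branch r x < 0#
      branch<0 {x} r x<0 = <-by (0<+ (0<* 0<B (0<y-x x<0)) (0≤ofℕ (toℕ r)))
        (solve 3 (λ b x r → :0 :- (b :* x :- r) := b :* (:0 :- x) :+ r) R.refl (ofℕ B) x (ofℕ (toℕ r)))

      r+1≤B : ∀ (r : Fin B) → 0# ≤ ofℕ B - (1# + ofℕ (toℕ r))
      r+1≤B r = 0≤y-x (ofℕ-mono (Fin.toℕ<n r))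

      -- 1 - B^(-K) is the greatest value of (0.w)_B on words of length K. As r ≤ B - 1, a point
      -- beyond this threshold for length K + 1 has all its branches beyond the one for length K.
      branch-top : ∀ {x} K r → 1# - β ^ suc K ≤ x → 1# - β ^ K ≤ branch r x
      branch-top {x} K r h = ≤-by (0≤+ (0≤* (<⇒≤ 0<B) (0≤y-x h)) (r+1≤B r)) (R.trans
        (R.+-congˡ (R.-‿cong (R.+-congˡ (R.-‿cong (R.trans (R.sym (R.*-identityˡ _)) (R.*-congʳ (R.sym Bβ)))))))
        (solve 5 (λ b x r i p → (b :* x :- r) :- (:1 :- b :* i :* p) :=
          b :* (x :- (:1 :- i :* p)) :+ (b :- (:1 :+ r))) R.refl (ofℕ B) x (ofℕ (toℕ r)) β (β ^ K)))

      1-β^≤1 : ∀ {x} K → 1# ≤ x → 1# - β ^ K ≤ x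
      1-β^≤1 K h = RO.trans (≤-by (0≤^ (<⇒≤ 0<β) K) (solve 1 (λ p → :1 :- (:1 :- p) := p) R.refl (β ^ K))) h

      -- The sum 𝐒_K^v(x), extended to all real x by the recursion on the first
      -- digit: it vanishes for x < 0 and equals Q^K v for x ≥ 1.
      partialSum : ℂ^ d → ℕ → ℝ → ℂ^ d
      partialSum v zero    x = v when (0# ≤ x)
      partialSum v (suc K) x = ∑ (λ r → A r ⊙ partialSum v K (branch r x))

      partialSum-cong : ∀ {u v} K {x y} → u ≋ v → x ≈ y → partialSum u K x ≋ partialSum v K y
      partialSum-cong zero p eq = when-⇔ p (λ h → RO.trans h (RO.reflexive eq)) (λ h → RO.trans h (RO.reflexive (R.sym eq)))
      partialSum-cong (suc K) p eq = ∑-cong (λ r → ⊙-cong (A r) (partialSum-cong K p (branch-cong r eq)))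

      partialSum-+ : ∀ u v K x → partialSum (u +ᵛ v) K x ≋ partialSum u K x +ᵛ partialSum v K x
      partialSum-+ u v zero x with em {0# ≤ x}
      ... | yes _ = ≋-refl
      ... | no  _ = ≋-sym (0ᵛ-identityˡ 0ᵛ)
      partialSum-+ u v (suc K) x = ≋-trans
        (∑-cong (λ r → ≋-trans (⊙-cong (A r) (partialSum-+ u v K (branch r x)))
                               (⊙-+ (A r) (partialSum u K (branch r x)) (partialSum v K (branch r x)))))
        (∑-+ (λ r → A r ⊙ partialSum u K (branch r x)) (λ r → A r ⊙ partialSum v K (branch r x)))

      partialSum-• : ∀ a v K x → partialSum (a • v) K x ≋ a • partialSum v K x
      partialSum-• a v zero x with em {0# ≤ x}
      ... | yes _ = ≋-refl
      ... | no  _ = ≋-sym (•-zeroʳ a)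
      partialSum-• a v (suc K) x = ≋-trans
        (∑-cong (λ r → ≋-trans (⊙-cong (A r) (partialSum-• a v K (branch r x)))
                               (⊙-• (A r) a (partialSum v K (branch r x)))))
        (∑-• a (λ r → A r ⊙ partialSum v K (branch r x)))

      partialSum-0 : ∀ K x → partialSum 0ᵛ K x ≋ 0ᵛ
      partialSum-0 K x = ≋-trans (partialSum-cong K (≋-sym (•-zeroˡ 0ᵛ)) R.refl)
        (≋-trans (partialSum-• 0ᶜ 0ᵛ K x) (•-zeroˡ (partialSum 0ᵛ K x)))

      partialSum-∑ : ∀ {n} (f : Fin n → ℂ^ d) K x → partialSum (∑ f) K x ≋ ∑ (λ j → partialSum (f j) K x)
      partialSum-∑ {zero}  f K x = partialSum-0 K x
      partialSum-∑ {suc n} f K x = ≋-trans (partialSum-+ (f zero) (∑ (f ∘ suc)) K x)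
        (+ᵛ-cong ≋-refl (partialSum-∑ (f ∘ suc) K x))

      partialSum-<0 : ∀ {v x} K → x < 0# → partialSum v K x ≋ 0ᵛ
      partialSum-<0 zero x<0 = when-no (<⇒≱ x<0)
      partialSum-<0 (suc K) x<0 = ∑-zero (λ r → ≋-trans (⊙-cong (A r) (partialSum-<0 K (branch<0 r x<0))) (⊙-0 (A r)))

      -- Beyond the greatest radix all words count, even if x < 1. This margin is what
      -- `partialSum-variation` needs, where y ≥ 1 does not exclude x < 1.
      partialSum-top : ∀ {v x} K → 1# - β ^ K ≤ x → partialSum v K x ≋ (∑ᴹ A ^ᴹ K) ⊙ v
      partialSum-top {v} zero h = ≋-trans (when-yes (RO.trans (RO.reflexive (R.sym (R.-‿inverseʳ 1#))) h)) (≋-sym (⊙-1ᴹ v))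
      partialSum-top {v} {x} (suc K) h = begin
        ∑ (λ r → A r ⊙ partialSum v K (branch r x))      ≈⟨ ∑-cong (λ r → ⊙-cong (A r) (partialSum-top K (branch-top K r h))) ⟩
        ∑ (λ r → A r ⊙ ((∑ᴹ A ^ᴹ K) ⊙ v))                ≈⟨ ∑ᴹ-⊙ A ((∑ᴹ A ^ᴹ K) ⊙ v) ⟨
        ∑ᴹ A ⊙ ((∑ᴹ A ^ᴹ K) ⊙ v)                         ≈⟨ ⊙-⊡ (∑ᴹ A) (∑ᴹ A ^ᴹ K) v ⟨
        (∑ᴹ A ^ᴹ suc K) ⊙ v                              ∎
        where open ≋-Reasoning

      partialSum-≥1 : ∀ {v x} K → 1# ≤ x → partialSum v K x ≋ (∑ᴹ A ^ᴹ K) ⊙ v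
      partialSum-≥1 K h = partialSum-top K (1-β^≤1 K h)

      radix-∷ : ∀ {K} r (w : Word B K) → ofℕ B * radix (r ∷ w) ≈ ofℕ (toℕ r) + radix w
      radix-∷ {K} r w = begin
        ofℕ B * (ofℕ (toℕ r) * (β * 1#) + sum f)                  ≈⟨ R.distribˡ _ _ _ ⟩
        ofℕ B * (ofℕ (toℕ r) * (β * 1#)) + ofℕ B * sum f          ≈⟨ R.+-cong (scale (ofℕ (toℕ r)) 1#) (∑ℝ.*-distribˡ-sum (ofℕ B) f) ⟩
        ofℕ (toℕ r) * 1# + sum (λ i → ofℕ B * f i)                ≈⟨ R.+-cong (R.*-identityʳ _)
          (∑ℝ.sum-cong-≋ (λ i → scale (ofℕ (toℕ (Vec.lookup w i))) (β ^ suc (toℕ i)))) ⟩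
        ofℕ (toℕ r) + radix w                                     ∎
        where
        f : Fin K → ℝ
        f i = ofℕ (toℕ (Vec.lookup w i)) * β ^ suc (suc (toℕ i))
        open import Relation.Binary.Reasoning.Setoid R.setoid
        scale : ∀ a p → ofℕ B * (a * (β * p)) ≈ a * p
        scale a p = R.trans (solve 4 (λ b a i p → b :* (a :* (i :* p)) := b :* i :* (a :* p)) R.refl (ofℕ B) a β p)
          (R.trans (R.*-congʳ Bβ) (R.*-identityˡ _))

      radix-∷-≤ : ∀ {K} r (w : Word B K) x → radix (r ∷ w) ≤ x → radix w ≤ branch r x
      radix-∷-≤ r w x h = ≤-by (0≤* (<⇒≤ 0<B) (0≤y-x h)) (R.trans
        (solve 4 (λ b x r w → (b :* x :- r) :- w := b :* x :- (r :+ w)) R.refl (ofℕ B) x (ofℕ (toℕ r)) (radix w))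
        (R.trans (R.+-congˡ (R.-‿cong (R.sym (radix-∷ r w))))
          (solve 3 (λ b x w → b :* x :- b :* w := b :* (x :- w)) R.refl (ofℕ B) x (radix (r ∷ w)))))

      radix-∷-≥ : ∀ {K} r (w : Word B K) x → radix w ≤ branch r x → radix (r ∷ w) ≤ x
      radix-∷-≥ r w x h = *-cancel-≤ 0<B (RO.trans (RO.reflexive (radix-∷ r w))
        (≤-by (0≤y-x h) (solve 4 (λ b x r w → b :* x :- (r :+ w) := (b :* x :- r) :- w) R.refl (ofℕ B) x (ofℕ (toℕ r)) (radix w))))

      -- A word r ∷ w counts for x exactly if w counts for B x - r, and `words` lists the words by
      -- their first letter.
      S≋partialSum : ∀ v K x → filteredSum (λ w → wordProduct A w ⊙ v) (λ w → radix w ≤ x) (words B K) ≋ partialSum v K x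
      S≋partialSum v zero x = begin
        filteredSum (λ w → wordProduct A w ⊙ v) (λ w → radix w ≤ x) ([] ∷ [])
          ≈⟨ filteredSum-∷ (λ w → wordProduct A w ⊙ v) (λ w → radix w ≤ x) [] [] ⟩
        (1ᴹ ⊙ v) when (0# ≤ x) +ᵛ 0ᵛ      ≈⟨ 0ᵛ-identityʳ ((1ᴹ ⊙ v) when (0# ≤ x)) ⟩
        (1ᴹ ⊙ v) when (0# ≤ x)            ≈⟨ when-⇔ (⊙-1ᴹ v) (λ h → h) (λ h → h) ⟩
        v when (0# ≤ x)                   ∎
        where open ≋-Reasoning
      S≋partialSum v (suc K) x = ≋-trans
        (filteredSum-cartesian _∷_ (λ w → wordProduct A w ⊙ v) (λ w → radix w ≤ x) (λ r → r) (words B K))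
        (∑-cong (λ r → ≋-trans
          (filteredSum-map (A r) (r ∷_) (λ w → wordProduct A w ⊙ v) (λ w → wordProduct A w ⊙ v)
            (λ w → radix w ≤ x) (λ w → radix w ≤ branch r x)
            (λ w → ⊙-⊡ (A r) (wordProduct A w) v) (λ w → radix-∷-≤ r w x) (λ w → radix-∷-≥ r w x) (words B K))
          (⊙-cong (A r) (S≋partialSum v K (branch r x)))))

      -- Two families with the recursion of `partialSum` that agree outside [0,1) differ by a family
      -- of this kind.
      record IsHomogeneous (E : ℕ → ℝ → ℂ^ d) : Set where
        field
          recursion : ∀ K x → E (suc K) x ≋ ∑ (λ r → A r ⊙ E K (branch r x))
          support   : ∀ K x → ¬ InUnit x → E K x ≋ 0ᵛ

      module Growth {lam : ℝ} (0<lam : 0# < lam) (contraction : Contraction A lam) where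
        open Adapted A 0<lam contraction
        open Norm N
        private
          0≤lam = <⇒≤ 0<lam

        -- Branches outside [0,1) contribute 0, so that each step applies at most one matrix A_r to
        -- a non-zero value. In the adapted norm this costs the factor lam and no constant.
        homogeneous-bound : ∀ {E} → IsHomogeneous E → ∀ {M} → 0# ≤ M → (∀ x → E 0 x ≼ M) → ∀ K x → E K x ≼ M * lam ^ K
        homogeneous-bound {E} hom {M} 0≤M h zero x = ≼-mono {v = E 0 x} (RO.reflexive (R.sym (R.*-identityʳ M))) (h x)
        homogeneous-bound {E} hom {M} 0≤M h (suc K) x = ≼-cong (recursion K x)
          (≼-mono {v = ∑ (λ r → A r ⊙ E K (branch r x))} (RO.reflexive (solve 4 (λ n m l p →
            l :* (m :* p) :+ n :* :0 := m :* (l :* p)) R.refl (ofℕ B) M lam (lam ^ K)))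
          (≼-∑-exceptional {f = λ r → A r ⊙ E K (branch r x)} (λ r → InUnit (branch r x)) (branch-unique {x}) RO.refl
            (0≤* 0≤lam (0≤* 0≤M (0≤^ 0≤lam K)))
            (λ r ¬p → ≼-0 (≋-trans (⊙-cong (A r) (support K (branch r x) ¬p)) (⊙-0 (A r))) RO.refl)
            (λ r p → ≼-step {v = E K (branch r x)} r (homogeneous-bound hom 0≤M h K (branch r x)))))
          where open IsHomogeneous hom

        -- The summand B lam q K accounts for the branches outside [0,1): there are at most B of
        -- them, and each is A_r Q^K v or 0.
        partialSum-growth : ∀ {v} (q s : ℕ → ℝ) → (∀ K → 0# ≤ q K) → (∀ K → 0# ≤ s K) →
          (∀ K → (∑ᴹ A ^ᴹ K) ⊙ v ≼ q K) → q 0 ≤ s 0 →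
          (∀ K → lam * s K + ofℕ B * (lam * q K) ≤ s (suc K)) →
          ∀ K x → partialSum v K x ≼ s K
        partialSum-growth {v} q s 0≤q 0≤s hq hs step zero x with em {0# ≤ x}
        ... | yes _ = ≼-mono {v = v} hs (≼-cong {u = v} (≋-sym (⊙-1ᴹ v)) (hq 0))
        ... | no  _ = ≼-0 ≋-refl (0≤s 0)
        partialSum-growth {v} q s 0≤q 0≤s hq hs step (suc K) x =
          ≼-mono {v = partialSum v (suc K) x} (step K)
            (≼-∑-exceptional {f = λ r → A r ⊙ partialSum v K (branch r x)} (λ r → InUnit (branch r x)) (branch-unique {x})
              (0≤* 0≤lam (0≤q K)) (0≤* 0≤lam (0≤s K))
              (λ r ¬p → ≼-step {v = partialSum v K (branch r x)} r (outside r ¬p))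
              (λ r p → ≼-step {v = partialSum v K (branch r x)} r (partialSum-growth q s 0≤q 0≤s hq hs step K (branch r x))))
          where
          outside : ∀ r → ¬ InUnit (branch r x) → partialSum v K (branch r x) ≼ q K
          outside r ¬p with trichotomy (branch r x)
          ... | inj₁ p        = ≼-0 (partialSum-<0 K p) (0≤q K)
          ... | inj₂ (inj₁ p) = ⊥-elim (¬p p)
          ... | inj₂ (inj₂ p) = ≼-cong (partialSum-≥1 K p) (hq K)

        -- Fewer than two words w of length K satisfy x < (0.w)_B ≤ y.
        partialSum-variation : ∀ {v M} → 0# ≤ M → v ≼ M → ∀ K {x y} → x ≤ y → y - x < β ^ K →
          partialSum v K y -ᵛ partialSum v K x ≼ M * lam ^ K
        partialSum-variation {v} {M} 0≤M h zero {x} {y} x≤y y-x<1 with em {0# ≤ y} | em {0# ≤ x}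
        ... | no  _ | no  _  = ≼-0 (-ᵛ-self {u = 0ᵛ} ≋-refl) (0≤* 0≤M 0≤1)
        ... | yes _ | no  _  = ≼-mono {v = v -ᵛ 0ᵛ} (RO.reflexive (R.sym (R.*-identityʳ M)))
          (≼-cong (λ i → ℂS.solve 1 (λ a → a ℂS.:- ℂS.:0 ℂS.:= a) ℂR.refl (v i)) h)
        ... | yes _ | yes _  = ≼-0 (-ᵛ-self {u = v} ≋-refl) (0≤* 0≤M 0≤1)
        ... | no ¬p | yes p  = ⊥-elim (¬p (RO.trans p x≤y))
        partialSum-variation {v} {M} 0≤M h (suc K) {x} {y} x≤y y-x<β = ≼-cong eq
          (≼-mono {v = ∑ f} (RO.reflexive (solve 4 (λ n m l p →
            l :* (m :* p) :+ n :* :0 := m :* (l :* p)) R.refl (ofℕ B) M lam (lam ^ K)))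
          (≼-∑-exceptional {f = f} (λ r → InUnit (branch r y)) (branch-unique {y}) RO.refl
            (0≤* 0≤lam (0≤* 0≤M (0≤^ 0≤lam K)))
            (λ r ¬p → ≼-0 (≋-trans (⊙-cong (A r) (outside r ¬p)) (⊙-0 (A r))) RO.refl)
            (λ r p → ≼-step {v = δ r} r (partialSum-variation 0≤M h K (branch-≤ r) (branch-close r)))))
          where
          δ f : Fin B → ℂ^ d
          δ r = partialSum v K (branch r y) -ᵛ partialSum v K (branch r x)
          f r = A r ⊙ δ r
          eq : partialSum v (suc K) y -ᵛ partialSum v (suc K) x ≋ ∑ f
          eq = ≋-trans (≋-sym (∑-- (λ r → A r ⊙ partialSum v K (branch r y)) (λ r → A r ⊙ partialSum v K (branch r x))))
            (∑-cong (λ r → ≋-sym (⊙-- (A r) (partialSum v K (branch r y)) (partialSum v K (branch r x)))))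
          difference : ∀ r → branch r y - branch r x ≈ ofℕ B * (y - x)
          difference r = solve 4 (λ b x y r → (b :* y :- r) :- (b :* x :- r) := b :* (y :- x)) R.refl (ofℕ B) x y (ofℕ (toℕ r))
          branch-≤ : ∀ r → branch r x ≤ branch r y
          branch-≤ r = ≤-by (0≤* (<⇒≤ 0<B) (0≤y-x x≤y)) (difference r)
          branch-close : ∀ r → branch r y - branch r x < β ^ K
          branch-close r = begin-strict
            branch r y - branch r x    ≈⟨ difference r ⟩
            ofℕ B * (y - x)            <⟨ *-mono-< 0<B y-x<β ⟩
            ofℕ B * (β * β ^ K)        ≈⟨ R.*-assoc _ _ _ ⟨
            ofℕ B * β * β ^ K          ≈⟨ R.*-congʳ Bβ ⟩
            1# * β ^ K                 ≈⟨ R.*-identityˡ _ ⟩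
            β ^ K                      ∎
            where open ≤-Reasoning
          -- The branches are sorted by the right end y. If that of y is negative, both sums are
          -- empty; if it is at least 1, both are complete, since the branch of x is then at least 1
          -- - B^(-K).
          outside : ∀ r → ¬ InUnit (branch r y) → δ r ≋ 0ᵛ
          outside r ¬p with trichotomy (branch r y)
          ... | inj₁ p        = -ᵛ-self {u = partialSum v K (branch r y)}
            (≋-trans (partialSum-<0 K p) (≋-sym (partialSum-<0 K (≤-<-trans (branch-≤ r) p))))
          ... | inj₂ (inj₁ p) = ⊥-elim (¬p p)
          ... | inj₂ (inj₂ p) = -ᵛ-self {u = partialSum v K (branch r y)}
            (≋-trans (partialSum-≥1 K p) (≋-sym (partialSum-top K (≤-by (0≤+ (0≤y-x p) (0≤y-x (<⇒≤ (branch-close r))))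
              (solve 3 (λ x y p → x :- (:1 :- p) := (y :- :1) :+ (p :- (y :- x))) R.refl (branch r x) (branch r y) (β ^ K))))))

  open PartialSums public

  -- Scalar recurrences and the solution of the dilation equation.

  module DilationEquation where

    ⁻¹-anti-< : ∀ {x y} → 0# < x → x < y → y ⁻¹ < x ⁻¹
    ⁻¹-anti-< {x} {y} 0<x x<y = <-by (0<* (0<y-x x<y) (0<* (0<⁻¹ 0<x) (0<⁻¹ 0<y))) (begin
      x ⁻¹ - y ⁻¹                                  ≈⟨ R.+-cong (R.trans (R.*-congˡ (⁻¹-inverseʳ 0<y)) (R.*-identityʳ _))
                                                        (R.-‿cong (R.trans (R.*-congʳ (⁻¹-inverseʳ 0<x)) (R.*-identityˡ _))) ⟨
      x ⁻¹ * (y * y ⁻¹) - x * x ⁻¹ * y ⁻¹          ≈⟨ solve 4 (λ x y i j → i :* (y :* j) :- x :* i :* j := (y :- x) :* (i :* j)) R.refl x y (x ⁻¹) (y ⁻¹) ⟩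
      (y - x) * (x ⁻¹ * y ⁻¹)                      ∎)
      where
      open import Relation.Binary.Reasoning.Setoid R.setoid
      0<y = ≤-<-trans (<⇒≤ 0<x) x<y

    -- e τ^K with e = c/(τ - a) solves the recurrence with equality, and the homogeneous solutions,
    -- multiples of a^K, grow no faster.
    recurrence-> : ∀ {a τ c} → 0# ≤ a → a < τ → 0# ≤ c → (u : ℕ → ℝ) → 0# ≤ u 0 →
      (∀ K → u (suc K) ≤ a * u K + c * τ ^ K) → ∃[ C ] 0# ≤ C × ∀ K → u K ≤ C * τ ^ K
    recurrence-> {a} {τ} {c} 0≤a a<τ 0≤c u 0≤u₀ step = u 0 + e , 0≤+ 0≤u₀ 0≤e , bound
      where
      open ≤-Reasoning
      e = c * (τ - a) ⁻¹
      0<τ-a = 0<y-x a<τ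
      0≤e = 0≤* 0≤c (0≤⁻¹ 0<τ-a)
      e[τ-a] : e * (τ - a) ≈ c
      e[τ-a] = R.trans (R.*-assoc _ _ _) (R.trans (R.*-congˡ (⁻¹-inverseˡ 0<τ-a)) (R.*-identityʳ c))
      0≤τ = RO.trans 0≤a (<⇒≤ a<τ)
      bound : ∀ K → u K ≤ (u 0 + e) * τ ^ K
      bound zero = ≤-by 0≤e (solve 2 (λ u e → (u :+ e) :* :1 :- u := e) R.refl (u 0) e)
      bound (suc K) = begin
        u (suc K)                                        ≤⟨ step K ⟩
        a * u K + c * τ ^ K                              ≤⟨ R.+-monoˡ-≤ _ (*-monoˡ-≤ 0≤a (bound K)) ⟩
        a * ((u 0 + e) * τ ^ K) + c * τ ^ K              ≈⟨ R.+-congˡ (R.*-congʳ e[τ-a]) ⟨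
        a * ((u 0 + e) * τ ^ K) + e * (τ - a) * τ ^ K    ≤⟨ ≤-by (0≤* (0≤* 0≤u₀ (<⇒≤ 0<τ-a)) (0≤^ 0≤τ K))
          (solve 5 (λ a t u e p → (u :+ e) :* (t :* p) :- (a :* ((u :+ e) :* p) :+ e :* (t :- a) :* p) := u :* (t :- a) :* p)
            R.refl a τ (u 0) e (τ ^ K)) ⟩
        (u 0 + e) * (τ * τ ^ K)                          ∎

    -- Here the particular solution is -e τ^K with e = c/(a - τ). The induction needs this negative
    -- term, which is dropped only at the end.
    recurrence-< : ∀ {a τ c} → 0# ≤ τ → τ < a → 0# ≤ c → (u : ℕ → ℝ) → 0# ≤ u 0 →
      (∀ K → u (suc K) ≤ a * u K + c * τ ^ K) → ∃[ C ] 0# ≤ C × ∀ K → u K ≤ C * a ^ K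
    recurrence-< {a} {τ} {c} 0≤τ τ<a 0≤c u 0≤u₀ step = u 0 + e , 0≤+ 0≤u₀ 0≤e ,
      λ K → RO.trans (bound K) (≤-by (0≤* 0≤e (0≤^ 0≤τ K)) (solve 2 (λ x y → x :- (x :- y) := y) R.refl _ _))
      where
      open ≤-Reasoning
      e = c * (a - τ) ⁻¹
      0<a-τ = 0<y-x τ<a
      0≤a = RO.trans 0≤τ (<⇒≤ τ<a)
      0≤e = 0≤* 0≤c (0≤⁻¹ 0<a-τ)
      e[a-τ] : e * (a - τ) ≈ c
      e[a-τ] = R.trans (R.*-assoc _ _ _) (R.trans (R.*-congˡ (⁻¹-inverseˡ 0<a-τ)) (R.*-identityʳ c))
      bound : ∀ K → u K ≤ (u 0 + e) * a ^ K - e * τ ^ K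
      bound zero = RO.reflexive (solve 2 (λ u e → u := (u :+ e) :* :1 :- e :* :1) R.refl (u 0) e)
      bound (suc K) = begin
        u (suc K)                                                    ≤⟨ step K ⟩
        a * u K + c * τ ^ K                                          ≤⟨ R.+-monoˡ-≤ _ (*-monoˡ-≤ 0≤a (bound K)) ⟩
        a * ((u 0 + e) * a ^ K - e * τ ^ K) + c * τ ^ K              ≈⟨ R.+-congˡ (R.*-congʳ e[a-τ]) ⟨
        a * ((u 0 + e) * a ^ K - e * τ ^ K) + e * (a - τ) * τ ^ K    ≈⟨ solve 6 (λ a t u e p q →
          a :* ((u :+ e) :* p :- e :* q) :+ e :* (a :- t) :* q := (u :+ e) :* (a :* p) :- e :* (t :* q))
          R.refl a τ (u 0) e (a ^ K) (τ ^ K) ⟩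
        (u 0 + e) * (a * a ^ K) - e * (τ * τ ^ K)                    ∎

    -- Resonance: forcing at the rate a itself costs one more power. Its base is K + 1 and not K, so
    -- that the bound already holds at K = 0.
    recurrence-≈ : ∀ {a c} → 0# < a → 0# ≤ c → ∀ j (u : ℕ → ℝ) → 0# ≤ u 0 →
      (∀ K → u (suc K) ≤ a * u K + c * (a ^ K * ofℕ (suc K) ^ j)) →
      ∃[ C ] 0# ≤ C × ∀ K → u K ≤ C * (a ^ K * ofℕ (suc K) ^ suc j)
    recurrence-≈ {a} {c} 0<a 0≤c j u 0≤u₀ step = u 0 + e , 0≤+ 0≤u₀ 0≤e , bound
      where
      open ≤-Reasoning
      e = c * a ⁻¹
      0≤e = 0≤* 0≤c (0≤⁻¹ 0<a)
      0≤a = <⇒≤ 0<a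
      ea : e * a ≈ c
      ea = R.trans (R.*-assoc _ _ _) (R.trans (R.*-congˡ (⁻¹-inverseˡ 0<a)) (R.*-identityʳ c))
      0≤C = 0≤+ 0≤u₀ 0≤e
      bound : ∀ K → u K ≤ (u 0 + e) * (a ^ K * ofℕ (suc K) ^ suc j)
      bound zero = begin
        u 0                                   ≤⟨ ≤-by 0≤e (solve 2 (λ u e → (u :+ e) :- u := e) R.refl (u 0) e) ⟩
        u 0 + e                               ≈⟨ R.*-identityʳ _ ⟨
        (u 0 + e) * 1#                        ≤⟨ *-monoˡ-≤ 0≤C (1≤^ (1≤ofℕ {1} ℕ.≤-refl) (suc j)) ⟩
        (u 0 + e) * ofℕ 1 ^ suc j             ≈⟨ R.*-congˡ (R.*-identityˡ _) ⟨
        (u 0 + e) * (1# * ofℕ 1 ^ suc j)      ∎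
      bound (suc K) = begin
        u (suc K)                                                              ≤⟨ step K ⟩
        a * u K + c * (a ^ K * p)                                              ≤⟨ R.+-monoˡ-≤ _ (*-monoˡ-≤ 0≤a (bound K)) ⟩
        a * ((u 0 + e) * (a ^ K * (n * p))) + c * (a ^ K * p)                  ≈⟨ R.+-congˡ (R.*-congʳ ea) ⟨
        a * ((u 0 + e) * (a ^ K * (n * p))) + e * a * (a ^ K * p)              ≤⟨ ≤-by (0≤* (0≤* 0≤u₀ (0≤^ 0≤a (suc K))) 0≤p)
          (solve 6 (λ a u e q n p → (u :+ e) :* (a :* q :* ((:1 :+ n) :* p)) :- (a :* ((u :+ e) :* (q :* (n :* p))) :+ e :* a :* (q :* p)) :=
            u :* (a :* q) :* p) R.refl a (u 0) e (a ^ K) n p) ⟩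
        (u 0 + e) * (a ^ suc K * ((1# + n) * p))                               ≤⟨ *-monoˡ-≤ 0≤C (*-monoˡ-≤ (0≤^ 0≤a (suc K))
          (*-monoˡ-≤ (0≤ofℕ (suc (suc K))) (^-mono-≤ (0≤ofℕ (suc K)) (ofℕ-mono (ℕ.n≤1+n (suc K))) j))) ⟩
        (u 0 + e) * (a ^ suc K * ofℕ (suc (suc K)) ^ suc j)                    ∎
        where
        n = ofℕ (suc K)
        p = n ^ j
        0≤p = 0≤^ (0≤ofℕ (suc K)) j

    private
      variable
        d ν : ℕ

    -- `IsJordanChain` and `IsDilationSolution` relate consecutive indices through `toℕ`; this is
    -- the matching induction.
    toℕ-induction : (P : Fin ν → Set) → (∀ j → toℕ j ≡ 0 → P j) →
      (∀ i j → toℕ j ≡ suc (toℕ i) → P i → P j) → ∀ j → P j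
    toℕ-induction {suc ν} P p₀ p₁ = <-weakInduction P (p₀ zero ≡.refl)
      (λ i p → p₁ (inject₁ i) (suc i) (≡.cong suc (≡.sym (Fin.toℕ-inject₁ i))) p)

    -- The entry in front of the first one is a parameter: it is 0ᵛ for a chain, whereas `untwist`
    -- hands the entry just found down its recursion.
    previous : ℂ^ d → (Fin ν → ℂ^ d) → Fin ν → ℂ^ d
    previous c X zero    = c
    previous c X (suc j) = X (inject₁ j)

    -- The right action on (X₀, …, X_{ν-1}) of the Jordan block of eigenvalue μ.
    twist : ℂ → (Fin ν → ℂ^ d) → Fin ν → ℂ^ d
    twist μ X j = μ • X j +ᵛ previous 0ᵛ X j

    previous-map : ∀ (f : ℂ^ d → ℂ^ d) → f 0ᵛ ≋ 0ᵛ → ∀ (X : Fin ν → ℂ^ d) j →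
      previous 0ᵛ (f ∘ X) j ≋ f (previous 0ᵛ X j)
    previous-map f f0 X zero    = ≋-sym f0
    previous-map f f0 X (suc j) = ≋-refl

    twist-⊙ : ∀ μ (M : Matrix d) (X : Fin ν → ℂ^ d) j → twist μ (λ i → M ⊙ X i) j ≋ M ⊙ twist μ X j
    twist-⊙ μ M X j = ≋-trans (+ᵛ-cong (≋-sym (⊙-• M μ (X j))) (previous-map (M ⊙_) (⊙-0 M) X j))
      (≋-sym (⊙-+ M (μ • X j) (previous 0ᵛ X j)))

    module _ {μ : ℂ} (0<μ : 0# < ∣ μ ∣) where

      •-solve : ∀ {u v w : ℂ^ d} → μ • u +ᵛ v ≋ w → u ≋ μ ⁻¹ᶜ • (w -ᵛ v)
      •-solve {u = u} {v} {w} p i = ℂR.trans (ℂR.sym (ℂR.*-identityˡ (u i))) (ℂR.trans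
        (ℂR.*-congʳ (ℂR.sym (⁻¹ᶜ-inverse 0<μ))) (ℂR.trans
        (ℂS.solve 4 (λ m n u v → m ℂS.:* n ℂS.:* u ℂS.:= n ℂS.:* ((m ℂS.:* u ℂS.:+ v) ℂS.:- v)) ℂR.refl μ (μ ⁻¹ᶜ) (u i) (v i))
        (ℂR.*-congˡ (ℂR.+-congʳ (p i)))))

      twist-injective : ∀ {X Y : Fin ν → ℂ^ d} → (∀ j → twist μ X j ≋ twist μ Y j) → ∀ j → X j ≋ Y j
      twist-injective {suc ν} {X = X} {Y} p = <-weakInduction (λ j → X j ≋ Y j)
        (extract zero ≋-refl) (λ j ih → extract (suc j) ih)
        where
        extract : ∀ j → previous 0ᵛ X j ≋ previous 0ᵛ Y j → X j ≋ Y j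
        extract j q = ≋-trans (•-solve (p j)) (≋-trans
          (•-congˡ (μ ⁻¹ᶜ) (-ᵛ-cong ≋-refl q)) (≋-sym (•-solve ≋-refl)))

      untwist : ℂ^ d → (Fin ν → ℂ^ d) → Fin ν → ℂ^ d
      untwist c X zero    = μ ⁻¹ᶜ • (X zero -ᵛ c)
      untwist c X (suc j) = untwist (untwist c X zero) (X ∘ suc) j

      untwist-correct : ∀ c (X : Fin ν → ℂ^ d) j → μ • untwist c X j +ᵛ previous c (untwist c X) j ≋ X j
      untwist-correct c X zero i = ℂR.trans (ℂR.+-congʳ (•-inverse (X zero -ᵛ c) 0<μ i))
        (ℂS.solve 2 (λ x c → (x ℂS.:- c) ℂS.:+ c ℂS.:= x) ℂR.refl (X zero i) (c i))
      untwist-correct c X (suc zero) = untwist-correct (untwist c X zero) (X ∘ suc) zero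
      untwist-correct c X (suc (suc j)) = untwist-correct (untwist c X zero) (X ∘ suc) (suc j)

    module _ (N : Norm d) where
      open Norm N
      open NormProperties N
      open ≤-Reasoning

      -- C is chosen before the sequence, since this is applied to all points x at once and the
      -- convergence has to be uniform.
      vector-limit : ∀ {θ c} → 0# ≤ θ → θ < 1# → 0# ≤ c → ∃[ C ] 0# ≤ C × (∀ (a : ℕ → ℂ^ d) →
        (∀ n → ‖ a (suc n) -ᵛ a n ‖ ≤ c * θ ^ n) → ∃[ l ] ∀ n → ‖ l -ᵛ a n ‖ ≤ C * θ ^ n)
      vector-limit {θ} {c} 0≤θ θ<1 0≤c =
        let (k , 0≤k , lower) = coordinates≤norm N
            (b , 0≤b , upper) = norm≤coordinates N
            e = k * c * (1# - θ) ⁻¹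
            0≤e = 0≤* (0≤* 0≤k 0≤c) (0≤⁻¹ (0<y-x θ<1))
        in b * (e + e) , 0≤* 0≤b (0≤+ 0≤e 0≤e) , λ a step →
        let limits = λ i → geometric-limitᶜ 0≤θ θ<1 (0≤* 0≤k 0≤c) (λ n → a n i) (λ n →
              RO.trans (lower (a (suc n) -ᵛ a n) i) (RO.trans (*-monoˡ-≤ 0≤k (step n)) (RO.reflexive (R.sym (R.*-assoc _ _ _)))))
        in (λ i → proj₁ (limits i)) , λ n → RO.trans (upper _ _ (λ i → proj₂ (limits i) n)) (RO.reflexive (R.sym (R.*-assoc _ _ _)))

      ≋-from-geometric : ∀ {θ} → 0# ≤ θ → θ < 1# → ∀ c {u v : ℂ^ d} → (∀ n → ‖ u -ᵛ v ‖ ≤ c * θ ^ n) → u ≋ v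
      ≋-from-geometric 0≤θ θ<1 c h = -ᵛ-zero⁻¹ (‖‖≤0⇒≋0 (≤-from-geometric 0≤θ θ<1 c h))

    module Solution {B d : ℕ} (2≤B : 2 ℕ.≤ B) (A : Fin B → Matrix d)
      {lam σ : ℝ} (0<lam : 0# < lam) (lam<σ : lam < σ) (contraction : Contraction A lam)
      {ν : ℕ} {μ : ℂ} (σ<μ : σ < ∣ μ ∣)
      (V : Fin ν → ℂ^ d) (chain : ∀ j → ∑ᴹ A ⊙ V j ≋ twist μ V j) where

      private
        Q = ∑ᴹ A
        -- U_K decays like τ^K and homogeneous families grow like lam^K, so that θ = lam/σ < 1 is
        -- the ratio of convergence.
        τ = σ ⁻¹
        θ = τ * lam
        0<σ : 0# < σ
        0<σ = ≤-<-trans (<⇒≤ 0<lam) lam<σ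

      0<μ : 0# < ∣ μ ∣
      0<μ = ≤-<-trans (<⇒≤ 0<σ) σ<μ

      private
        0<τ : 0# < τ
        0<τ = 0<⁻¹ 0<σ
        0≤θ : 0# ≤ θ
        0≤θ = 0≤* (<⇒≤ 0<τ) (<⇒≤ 0<lam)
        θ<1 : θ < 1#
        θ<1 = <-≤-trans (*-mono-< 0<τ lam<σ) (RO.reflexive (⁻¹-inverseˡ 0<σ))
      open Adapted A 0<lam contraction
      open Summation 2≤B A public
      open Growth 0<lam contraction
      open Norm N
      open NormProperties N

      private
        abstract
          norm-bound : ∃[ c ] 0# ≤ c × ∀ v → v ≼ c * ‖ v ‖
          norm-bound = norm-≼
        c₀ = proj₁ norm-bound
        0≤c₀ = proj₁ (proj₂ norm-bound)

      -- The tuples V, V J⁻¹, V J⁻², … for the Jordan block J of μ, so that each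
      -- entry is a backward orbit of Q.
      U : ℕ → Fin ν → ℂ^ d
      U zero    = V
      U (suc K) = untwist 0<μ 0ᵛ (U K)

      twist-U : ∀ K j → twist μ (U (suc K)) j ≋ U K j
      twist-U K = untwist-correct 0<μ 0ᵛ (U K)

      chain-U : ∀ K j → Q ⊙ U K j ≋ twist μ (U K) j
      -- Q acts on the left and the Jordan block J on the right, so that they commute: Q U_{K+1} J =
      -- Q U_K = U_K J, and J can be cancelled. The induction alternates with `chain-U`.
      Q-U : ∀ K j → Q ⊙ U (suc K) j ≋ U K j

      chain-U zero    = chain
      chain-U (suc K) j = ≋-trans (Q-U K j) (≋-sym (twist-U K j))

      Q-U K = twist-injective 0<μ {Y = U K} (λ j → ≋-trans (twist-⊙ μ Q (U (suc K)) j)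
        (≋-trans (⊙-cong Q (twist-U K j)) (chain-U K j)))

      Q^-U : ∀ K j → (Q ^ᴹ K) ⊙ U K j ≋ V j
      Q^-U zero j = ⊙-1ᴹ (V j)
      Q^-U (suc K) j = ≋-trans (^ᴹ-suc Q K (U (suc K) j)) (≋-trans (⊙-cong (Q ^ᴹ K) (Q-U K j)) (Q^-U K j))

      private
        -- Solving U_{K+1} J = U_K for the entry j gives U_{K+1,j} = μ^(-1) (U_{K,j} - U_{K+1,j-1}).
        -- The gap between ∣μ∣^(-1) and σ^(-1) absorbs the powers of K that the chain would produce.
        decay-step : ∀ j → (∃[ c ] 0# ≤ c × ∀ K → ‖ previous 0ᵛ (U (suc K)) j ‖ ≤ c * τ ^ K) →
          ∃[ c ] 0# ≤ c × ∀ K → ‖ U K j ‖ ≤ c * τ ^ K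
        decay-step j (c , 0≤c , h) = recurrence-> 0≤a a<τ (0≤* 0≤a 0≤c) (λ K → ‖ U K j ‖) (nonNegative (U 0 j)) λ K → begin
          ‖ U (suc K) j ‖                                            ≈⟨ cong (•-solve 0<μ (twist-U K j)) ⟩
          ‖ μ ⁻¹ᶜ • (U K j -ᵛ previous 0ᵛ (U (suc K)) j) ‖           ≈⟨ homogeneous (μ ⁻¹ᶜ) (U K j -ᵛ previous 0ᵛ (U (suc K)) j) ⟩
          a * ‖ U K j -ᵛ previous 0ᵛ (U (suc K)) j ‖                 ≤⟨ *-monoˡ-≤ 0≤a (RO.trans (‖-‖≤ (U K j) (previous 0ᵛ (U (suc K)) j)) (+-monoʳ-≤ _ (h K))) ⟩
          a * (‖ U K j ‖ + c * τ ^ K)                                ≈⟨ solve 4 (λ a u c t → a :* (u :+ c :* t) := a :* u :+ a :* c :* t) R.refl a ‖ U K j ‖ c (τ ^ K) ⟩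
          a * ‖ U K j ‖ + a * c * τ ^ K                              ∎
          where
          open ≤-Reasoning
          a = ∣ μ ⁻¹ᶜ ∣
          0≤a = 0≤∣ μ ⁻¹ᶜ ∣
          a<τ : a < τ
          a<τ = ≤-<-trans (RO.reflexive (∣⁻¹ᶜ∣ 0<μ)) (⁻¹-anti-< 0<σ σ<μ)

        decays : ∀ j → ∃[ c ] 0# ≤ c × ∀ K → ‖ U K j ‖ ≤ c * τ ^ K
        decays = toℕ-induction (λ j → ∃[ c ] 0# ≤ c × ∀ K → ‖ U K j ‖ ≤ c * τ ^ K) decay-step₀ decay-step₁
          where
          decay-step₀ : ∀ j → toℕ j ≡ 0 → _
          decay-step₀ zero _ = decay-step zero (0# , RO.refl , λ K → RO.reflexive (R.trans ‖0‖ (R.sym (R.zeroˡ _))))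
          decay-step₁ : ∀ i j → toℕ j ≡ suc (toℕ i) → _ → _
          decay-step₁ i (suc j) eq (c , 0≤c , h) with Fin.toℕ-injective {i = i} {j = inject₁ j} (≡.trans (≡.sym (ℕ.suc-injective eq)) (≡.sym (Fin.toℕ-inject₁ j)))
          ... | ≡.refl = decay-step (suc j) (c * τ , 0≤* 0≤c (<⇒≤ 0<τ) , λ K → RO.trans (h (suc K)) (RO.reflexive (R.sym (R.*-assoc _ _ _))))

        abstract
          uniform-decay : ∃[ c ] 0# ≤ c × ∀ K j → ‖ U K j ‖ ≤ c * τ ^ K
          uniform-decay = sum (λ j → proj₁ (decays j)) , 0≤sum (λ j → proj₁ (proj₂ (decays j))) , λ K j →
            RO.trans (proj₂ (proj₂ (decays j)) K) (*-monoʳ-≤ (0≤^ (<⇒≤ 0<τ) K)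
              (term≤sum (λ j → proj₁ (decays j)) (λ j → proj₁ (proj₂ (decays j))) j))

        C₁ = proj₁ uniform-decay
        0≤C₁ = proj₁ (proj₂ uniform-decay)
        decay = proj₂ (proj₂ uniform-decay)

        decay-≼ : ∀ K j → U K j ≼ c₀ * (C₁ * τ ^ K)
        decay-≼ K j = ≼-mono {v = U K j} (*-monoˡ-≤ 0≤c₀ (decay K j)) (proj₂ (proj₂ norm-bound) (U K j))

        θ^ : ∀ K → θ ^ K ≈ τ ^ K * lam ^ K
        θ^ zero    = R.sym (R.*-identityˡ 1#)
        θ^ (suc K) = R.trans (R.*-congˡ (θ^ K)) (solve 4 (λ t l p q → t :* l :* (p :* q) := t :* p :* (l :* q)) R.refl τ lam (τ ^ K) (lam ^ K))

        -- For v = U_{K+1} one has Q v = U_K, and this is the difference of two consecutive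
        -- approximations of 𝐅. With v held fixed while K varies the family is homogeneous, as both
        -- sums equal Q^(K+1) v for x ≥ 1. It grows like lam^K from an initial size governed by that
        -- of U_{K+1}.
        increment : ℂ^ d → ℕ → ℝ → ℂ^ d
        increment v K x = partialSum v (suc K) x -ᵛ partialSum (Q ⊙ v) K x

        increment-homogeneous : ∀ v → IsHomogeneous (increment v)
        increment-homogeneous v = record
          { recursion = λ K x → ≋-trans
              (≋-sym (∑-- (λ r → A r ⊙ partialSum v (suc K) (branch r x)) (λ r → A r ⊙ partialSum (Q ⊙ v) K (branch r x))))
              (∑-cong (λ r → ≋-sym (⊙-- (A r) (partialSum v (suc K) (branch r x)) (partialSum (Q ⊙ v) K (branch r x)))))
          ; support = support
          }
          where
          support : ∀ K x → ¬ InUnit x → increment v K x ≋ 0ᵛ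
          support K x ¬p with trichotomy x
          ... | inj₁ p        = -ᵛ-self (≋-trans (partialSum-<0 (suc K) p) (≋-sym (partialSum-<0 K p)))
          ... | inj₂ (inj₁ p) = ⊥-elim (¬p p)
          ... | inj₂ (inj₂ p) = -ᵛ-self (≋-trans (partialSum-≥1 (suc K) p)
            (≋-trans (^ᴹ-suc Q K v) (≋-sym (partialSum-≥1 K p))))

        when-≼ : ∀ {v M P} → 0# ≤ M → v ≼ M → v when P ≼ M
        when-≼ {P = P} 0≤M h with em {P}
        ... | yes _ = h
        ... | no  _ = ≼-0 ≋-refl 0≤M

        increment-0 : ∀ {v M} → 0# ≤ M → v ≼ M → ∀ x → increment v 0 x ≼ 2# * (ofℕ B * (lam * M))
        increment-0 {v} {M} 0≤M h x = ≼-cong (-ᵛ-as-+ (partialSum v 1 x) ((Q ⊙ v) when (0# ≤ x)))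
          (≼-mono {v = partialSum v 1 x +ᵛ (-ᶜ 1ᶜ) • ((Q ⊙ v) when (0# ≤ x))}
            (RO.reflexive (R.trans (R.+-congˡ (R.*-congʳ (R.trans (∣-ᶜ∣ 1ᶜ) ∣1∣)))
              (solve 1 (λ e → e :+ :1 :* e := (:1 :+ :1) :* e) R.refl (ofℕ B * (lam * M)))))
            (≼-+ {u = partialSum v 1 x} {v = (-ᶜ 1ᶜ) • ((Q ⊙ v) when (0# ≤ x))}
              (≼-∑ 0≤lamM (λ r → ≼-step {v = v when (0# ≤ branch r x)} r (when-≼ {v = v} {P = 0# ≤ branch r x} 0≤M h)))
              (≼-• {v = (Q ⊙ v) when (0# ≤ x)} (-ᶜ 1ᶜ) (when-≼ {v = Q ⊙ v} {P = 0# ≤ x} (0≤* (0≤ofℕ B) 0≤lamM)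
                (≼-cong {u = Q ⊙ v} (∑ᴹ-⊙ A v) (≼-∑ {f = λ r → A r ⊙ v} 0≤lamM (λ r → ≼-step {v = v} r h)))))))
          where
          0≤lamM = 0≤* (<⇒≤ 0<lam) 0≤M

        -- 2 B lam comes from the two sums in `increment` at K = 0, and the factor τ from the index
        -- K + 1 of U_{K+1}.
        C₂ = 2# * (ofℕ B * (lam * (c₀ * (C₁ * τ))))
        0≤C₂ : 0# ≤ C₂
        0≤C₂ = 0≤* (<⇒≤ 0<2) (0≤* (0≤ofℕ B) (0≤* (<⇒≤ 0<lam) (0≤* 0≤c₀ (0≤* 0≤C₁ (<⇒≤ 0<τ)))))

      approx : Fin ν → ℕ → ℝ → ℂ^ d
      approx j K x = partialSum (U K j) K x

      private
        approx-step : ∀ j x K → ‖ approx j (suc K) x -ᵛ approx j K x ‖ ≤ C₂ * θ ^ K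
        approx-step j x K = begin
          ‖ approx j (suc K) x -ᵛ approx j K x ‖         ≈⟨ cong (-ᵛ-cong ≋-refl (partialSum-cong K (≋-sym (Q-U K j)) R.refl)) ⟩
          ‖ increment (U (suc K) j) K x ‖                ≤⟨ ≼⇒≤ (homogeneous-bound (increment-homogeneous (U (suc K) j))
            0≤M (increment-0 0≤M′ (decay-≼ (suc K) j)) K x) ⟩
          2# * (ofℕ B * (lam * (c₀ * (C₁ * (τ * τ ^ K))))) * lam ^ K
            ≈⟨ solve 8 (λ a b l c e t p q → a :* (b :* (l :* (c :* (e :* (t :* p))))) :* q := a :* (b :* (l :* (c :* (e :* t)))) :* (p :* q))
              R.refl 2# (ofℕ B) lam c₀ C₁ τ (τ ^ K) (lam ^ K) ⟩
          C₂ * (τ ^ K * lam ^ K)                         ≈⟨ R.*-congˡ (θ^ K) ⟨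
          C₂ * θ ^ K                                     ∎
          where
          open ≤-Reasoning
          0≤M′ = 0≤* 0≤c₀ (0≤* 0≤C₁ (0≤^ (<⇒≤ 0<τ) (suc K)))
          0≤M = 0≤* (<⇒≤ 0<2) (0≤* (0≤ofℕ B) (0≤* (<⇒≤ 0<lam) 0≤M′))

        abstract
          limit : ∃[ C ] 0# ≤ C × ∀ j x → ∃[ l ] ∀ K → ‖ l -ᵛ approx j K x ‖ ≤ C * θ ^ K
          limit = let (C , 0≤C , h) = vector-limit N 0≤θ θ<1 0≤C₂ in
            C , 0≤C , λ j x → h (λ K → approx j K x) (approx-step j x)

        C₃ = proj₁ limit
        0≤C₃ = proj₁ (proj₂ limit)
        limits = proj₂ (proj₂ limit)

      F : Fin ν → ℝ → ℂ^ d
      F j x = proj₁ (limits j x)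

      private
        F-approx : ∀ j x K → ‖ F j x -ᵛ approx j K x ‖ ≤ C₃ * θ ^ K
        F-approx j x = proj₂ (limits j x)

        F-limit : ∀ j x v → (∀ K → approx j K x ≋ v) → F j x ≋ v
        F-limit j x v h = ≋-from-geometric N 0≤θ θ<1 C₃ λ K →
          RO.trans (RO.reflexive (cong (-ᵛ-cong ≋-refl (≋-sym (h K))))) (F-approx j x K)

      F-<0 : ∀ j {x} → x < 0# → F j x ≋ 0ᵛ
      F-<0 j {x} x<0 = F-limit j x 0ᵛ (λ K → partialSum-<0 K x<0)

      F-≥1 : ∀ j {x} → 1# ≤ x → F j x ≋ V j
      F-≥1 j {x} 1≤x = F-limit j x (V j) (λ K → ≋-trans (partialSum-≥1 K 1≤x) (Q^-U K j))

      private
        previous-close : ∀ {X Y : Fin ν → ℂ^ d} {b} → 0# ≤ b → (∀ j → ‖ X j -ᵛ Y j ‖ ≤ b) → ∀ j →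
          ‖ previous 0ᵛ X j -ᵛ previous 0ᵛ Y j ‖ ≤ b
        previous-close 0≤b h zero    = RO.trans (RO.reflexive (‖≋0‖ (-ᵛ-self {u = 0ᵛ} ≋-refl))) 0≤b
        previous-close 0≤b h (suc j) = h (inject₁ j)

        -- The right side is by definition ∑ A_r 𝐒_K(B x - r) for the vector U_K: the dilation
        -- equation holds exactly between the stages K + 1 and K, and `F-dilation` is its limit.
        twist-approx : ∀ j K x → twist μ (λ i → approx i (suc K) x) j ≋ partialSum (U K j) (suc K) x
        twist-approx j K x = begin
          μ • Σv (U (suc K) j) +ᵛ previous 0ᵛ (Σv ∘ U (suc K)) j
            ≈⟨ +ᵛ-cong (≋-sym (partialSum-• μ (U (suc K) j) (suc K) x)) (previous-map Σv (partialSum-0 (suc K) x) (U (suc K)) j) ⟩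
          Σv (μ • U (suc K) j) +ᵛ Σv (previous 0ᵛ (U (suc K)) j)
            ≈⟨ partialSum-+ (μ • U (suc K) j) (previous 0ᵛ (U (suc K)) j) (suc K) x ⟨
          Σv (twist μ (U (suc K)) j)
            ≈⟨ partialSum-cong (suc K) (twist-U K j) R.refl ⟩
          Σv (U K j) ∎
          where
          open ≋-Reasoning
          Σv = λ v → partialSum v (suc K) x

      F-dilation : ∀ j x → twist μ (λ i → F i x) j ≋ ∑ (λ r → A r ⊙ F j (branch r x))
      F-dilation j x = ≋-from-geometric N 0≤θ θ<1 ((∣ μ ∣ * C₃ + C₃) * θ + a * C₃) λ K →
        let X = λ i → approx i (suc K) x
            pm = partialSum (U K j) (suc K) x
            0≤b = 0≤* 0≤C₃ (0≤^ 0≤θ (suc K))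
        in begin
        ‖ twist μ (λ i → F i x) j -ᵛ ∑ (λ r → A r ⊙ F j (br r)) ‖
          ≤⟨ ‖-‖-triangle (twist μ (λ i → F i x) j) pm (∑ (λ r → A r ⊙ F j (br r))) ⟩
        ‖ twist μ (λ i → F i x) j -ᵛ pm ‖ + ‖ pm -ᵛ ∑ (λ r → A r ⊙ F j (br r)) ‖
          ≈⟨ R.+-cong (cong (-ᵛ-cong ≋-refl (≋-sym (twist-approx j K x)))) (R.trans (‖-‖-sym pm (∑ (λ r → A r ⊙ F j (br r))))
            (cong (≋-trans (≋-sym (∑-- (λ r → A r ⊙ F j (br r)) (λ r → A r ⊙ approx j K (br r))))
              (∑-cong (λ r → ≋-sym (⊙-- (A r) (F j (br r)) (approx j K (br r)))))))) ⟩
        ‖ twist μ (λ i → F i x) j -ᵛ twist μ X j ‖ + ‖ ∑ (λ r → A r ⊙ (F j (br r) -ᵛ approx j K (br r))) ‖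
          ≤⟨ +-mono-≤ (twist-close X 0≤b (λ i → F-approx i x (suc K)))
            (RO.trans (‖∑‖≤ (λ r → A r ⊙ (F j (br r) -ᵛ approx j K (br r)))) (RO.trans (sum-mono (λ r →
              RO.trans (proj₂ (proj₂ (bounds r)) (F j (br r) -ᵛ approx j K (br r))) (*-monoˡ-≤ (0≤bounds r) (F-approx j (br r) K))))
              (RO.reflexive (R.sym (∑ℝ.*-distribʳ-sum (C₃ * θ ^ K) (λ r → proj₁ (bounds r))))))) ⟩
        (∣ μ ∣ * (C₃ * (θ * θ ^ K)) + C₃ * (θ * θ ^ K)) + a * (C₃ * θ ^ K)
          ≈⟨ solve 5 (λ m c t p a → (m :* (c :* (t :* p)) :+ c :* (t :* p)) :+ a :* (c :* p) := ((m :* c :+ c) :* t :+ a :* c) :* p)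
            R.refl ∣ μ ∣ C₃ θ (θ ^ K) a ⟩
        ((∣ μ ∣ * C₃ + C₃) * θ + a * C₃) * θ ^ K                       ∎
        where
        open ≤-Reasoning
        br = λ r → branch r x
        bounds = λ r → matrix-bounded N (A r)
        0≤bounds = λ r → proj₁ (proj₂ (bounds r))
        a = sum (λ r → proj₁ (bounds r))
        twist-close : ∀ X {b} → 0# ≤ b → (∀ i → ‖ F i x -ᵛ X i ‖ ≤ b) →
          ‖ twist μ (λ i → F i x) j -ᵛ twist μ X j ‖ ≤ ∣ μ ∣ * b + b
        twist-close X {b} 0≤b h = begin
          ‖ twist μ Y j -ᵛ twist μ X j ‖      ≈⟨ cong (λ i → ℂS.solve 5 (λ m f g p q →
            (m ℂS.:* f ℂS.:+ p) ℂS.:- (m ℂS.:* g ℂS.:+ q) ℂS.:= m ℂS.:* (f ℂS.:- g) ℂS.:+ (p ℂS.:- q)) ℂR.refl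
            μ (Y j i) (X j i) (previous 0ᵛ Y j i) (previous 0ᵛ X j i)) ⟩
          ‖ μ • (Y j -ᵛ X j) +ᵛ (previous 0ᵛ Y j -ᵛ previous 0ᵛ X j) ‖ ≤⟨ triangle (μ • (Y j -ᵛ X j)) (previous 0ᵛ Y j -ᵛ previous 0ᵛ X j) ⟩
          ‖ μ • (Y j -ᵛ X j) ‖ + ‖ previous 0ᵛ Y j -ᵛ previous 0ᵛ X j ‖ ≈⟨ R.+-congʳ (homogeneous μ (Y j -ᵛ X j)) ⟩
          ∣ μ ∣ * ‖ Y j -ᵛ X j ‖ + ‖ previous 0ᵛ Y j -ᵛ previous 0ᵛ X j ‖ ≤⟨ +-mono-≤ (*-monoˡ-≤ 0≤∣ μ ∣ (h j)) (previous-close 0≤b h j) ⟩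
          ∣ μ ∣ * b + b  ∎
          where
          Y = λ i → F i x

      -- Stage 0 of the approximation, which yields the initial bound on the remainder.
      F-bounded : ∃[ c ] 0# ≤ c × ∀ j x → ‖ F j x -ᵛ (V j when (0# ≤ x)) ‖ ≤ c
      F-bounded = C₃ , 0≤C₃ , λ j x → RO.trans (F-approx j x 0) (RO.reflexive (R.*-identityʳ C₃))

      private
        C₄ = C₃ + (c₀ * C₁ + C₃)

      F-variation : ∀ j K {x y} → x ≤ y → y - x < β ^ K → ‖ F j y -ᵛ F j x ‖ ≤ C₄ * θ ^ K
      F-variation j K {x} {y} x≤y y-x<β = begin
        ‖ F j y -ᵛ F j x ‖
          ≤⟨ ‖-‖-triangle (F j y) (approx j K y) (F j x) ⟩
        ‖ F j y -ᵛ approx j K y ‖ + ‖ approx j K y -ᵛ F j x ‖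
          ≤⟨ +-mono-≤ (F-approx j y K) (‖-‖-triangle (approx j K y) (approx j K x) (F j x)) ⟩
        C₃ * θ ^ K + (‖ approx j K y -ᵛ approx j K x ‖ + ‖ approx j K x -ᵛ F j x ‖)
          ≤⟨ +-monoʳ-≤ _ (+-mono-≤ (≼⇒≤ (partialSum-variation (0≤* 0≤c₀ (0≤* 0≤C₁ (0≤^ (<⇒≤ 0<τ) K))) (decay-≼ K j) K x≤y y-x<β))
            (RO.trans (RO.reflexive (‖-‖-sym (approx j K x) (F j x))) (F-approx j x K))) ⟩
        C₃ * θ ^ K + (c₀ * (C₁ * τ ^ K) * lam ^ K + C₃ * θ ^ K)
          ≈⟨ R.+-congˡ (R.+-congʳ (R.trans (solve 4 (λ a b p q → a :* (b :* p) :* q := a :* b :* (p :* q)) R.refl c₀ C₁ (τ ^ K) (lam ^ K))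
            (R.*-congˡ (R.sym (θ^ K))))) ⟩
        C₃ * θ ^ K + (c₀ * C₁ * θ ^ K + C₃ * θ ^ K)
          ≈⟨ solve 3 (λ a b p → a :* p :+ (b :* p :+ a :* p) := (a :+ (b :+ a)) :* p) R.refl C₃ (c₀ * C₁) (θ ^ K) ⟩
        C₄ * θ ^ K ∎
        where open ≤-Reasoning

      F-continuous : ∀ j x ε → 0# < ε → ∃[ δ ] 0# < δ × (∀ y → ∣ y - x ∣ℝ < δ → ∀ i → ∣ (F j y -ᵛ F j x) i ∣ < ε)
      F-continuous j x ε 0<ε =
        let (k , 0≤k , lower) = coordinates≤norm N
            (K , small) = geometric-small 0≤θ θ<1 (k * C₄) ε 0<ε
        in β ^ K , 0<^ (0<β) K , λ y close i → begin-strict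
          ∣ (F j y -ᵛ F j x) i ∣     ≤⟨ lower (F j y -ᵛ F j x) i ⟩
          k * ‖ F j y -ᵛ F j x ‖     ≤⟨ *-monoˡ-≤ 0≤k (variation K y close) ⟩
          k * (C₄ * θ ^ K)           ≈⟨ R.*-assoc _ _ _ ⟨
          k * C₄ * θ ^ K             <⟨ small ⟩
          ε                          ∎
        where
        open ≤-Reasoning
        variation : ∀ K y → ∣ y - x ∣ℝ < β ^ K → ‖ F j y -ᵛ F j x ‖ ≤ C₄ * θ ^ K
        variation K y close with RO.total x y
        ... | inj₁ x≤y = F-variation j K x≤y (≤-<-trans (x≤∣x∣ (y - x)) close)
        ... | inj₂ y≤x = RO.trans (RO.reflexive (‖-‖-sym (F j y) (F j x)))
          (F-variation j K y≤x (≤-<-trans (RO.trans (x≤∣x∣ (x - y)) (RO.reflexive (∣x-y∣≈∣y-x∣ x y))) close))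

      -- The approximations need not vanish at 0, where the word of zeros counts. But 𝐅 vanishes to
      -- the left of 0, and `F-variation`, which holds on the whole real line, compares 0 with the
      -- points -B^(-K)/2.
      F-0 : ∀ j → F j 0# ≋ 0ᵛ
      F-0 j = ≋-from-geometric N 0≤θ θ<1 C₄ λ K →
        let p = ½ * β ^ K
            0<p = 0<* 0<½ (0<^ (0<β) K)
            0--p = solve 1 (λ p → :0 :- :- p := p) R.refl p
            -p<0 = <-by 0<p 0--p
        in RO.trans (RO.reflexive (cong (-ᵛ-cong ≋-refl (≋-sym (F-<0 j -p<0)))))
          (F-variation j K (<⇒≤ -p<0) (≤-<-trans (RO.reflexive 0--p) (<-≤-trans
            (≤-<-trans (RO.reflexive (R.*-comm _ _)) (*-mono-< (0<^ (0<β) K) ½<1)) (RO.reflexive (R.*-identityʳ _)))))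

  open DilationEquation public

  -- Binomial sums and the remainder of the expansion.

  module BinomialExpansion where

    module Multᶜ = SemiringMult ℂR.semiring

    private
      variable
        d ν : ℕ

    lastVector : (Fin ν → ℂ^ d) → ℂ^ d
    lastVector {zero}  X = 0ᵛ
    lastVector {suc ν} X = X (fromℕ ν)

    -- `binomialSum` with arbitrary coefficients: the induction for `convolution-twist` drops the
    -- first coefficient, after which the sequence is no longer a binomial one.
    convolution : (ℕ → ℂ) → (Fin ν → ℂ^ d) → ℂ^ d
    convolution c X = ∑ (λ l → c (toℕ l) • X (opposite l))

    convolution-cong : ∀ {c c′ : ℕ → ℂ} {X Y : Fin ν → ℂ^ d} → (∀ l → c l ≈ᶜ c′ l) → (∀ j → X j ≋ Y j) →
      convolution c X ≋ convolution c′ Y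
    convolution-cong p q = ∑-cong (λ l → •-cong (p (toℕ l)) (q (opposite l)))

    previous-inject₁ : ∀ (X : Fin (suc ν) → ℂ^ d) (j : Fin ν) → previous 0ᵛ X (inject₁ j) ≋ previous 0ᵛ (X ∘ inject₁) j
    previous-inject₁ X zero    = ≋-refl
    previous-inject₁ X (suc j) = ≋-refl

    previous-last : ∀ (X : Fin (suc ν) → ℂ^ d) → previous 0ᵛ X (fromℕ ν) ≋ lastVector (X ∘ inject₁)
    previous-last {zero}  X = ≋-refl
    previous-last {suc ν} X = ≋-refl

    -- In terms of generating functions, (μ + z) moves from the coefficients c to
    -- the vectors X.
    convolution-twist : ∀ μ a {c c′ : ℕ → ℂ} (X : Fin ν → ℂ^ d) → c′ 0 ≈ᶜ (μ *ᶜ c 0) +ᶜ a →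
      (∀ l → c′ (suc l) ≈ᶜ (μ *ᶜ c (suc l)) +ᶜ c l) →
      convolution c′ X ≋ convolution c (twist μ X) +ᵛ a • lastVector X
    convolution-twist {zero} μ a X p q i = ℂS.solve 1 (λ a → ℂS.:0 ℂS.:= ℂS.:0 ℂS.:+ a ℂS.:* ℂS.:0) ℂR.refl a
    convolution-twist {suc ν} μ a {c} {c′} X p q = begin
      c′ 0 • Xν +ᵛ convolution (c′ ∘ suc) (X ∘ inject₁)
        ≈⟨ +ᵛ-cong {u = c′ 0 • Xν} (•-cong {u = Xν} p ≋-refl)
          -- The dropped coefficient c 0 becomes the boundary term a of the shorter sum.
          (convolution-twist μ (c 0) {c ∘ suc} {c′ ∘ suc} (X ∘ inject₁) (q 0) (λ l → q (suc l))) ⟩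
      ((μ *ᶜ c 0) +ᶜ a) • Xν +ᵛ (convolution (c ∘ suc) (twist μ (X ∘ inject₁)) +ᵛ c 0 • lastVector (X ∘ inject₁))
        ≈⟨ (λ i → ℂS.solve 6 (λ m c a x s t → (m ℂS.:* c ℂS.:+ a) ℂS.:* x ℂS.:+ (s ℂS.:+ c ℂS.:* t) ℂS.:=
            (c ℂS.:* (m ℂS.:* x ℂS.:+ t) ℂS.:+ s) ℂS.:+ a ℂS.:* x) ℂR.refl μ (c 0) a (Xν i)
            (convolution (c ∘ suc) (twist μ (X ∘ inject₁)) i) (lastVector (X ∘ inject₁) i)) ⟩
      (c 0 • (μ • Xν +ᵛ lastVector (X ∘ inject₁)) +ᵛ convolution (c ∘ suc) (twist μ (X ∘ inject₁))) +ᵛ a • Xν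
        ≈⟨ +ᵛ-cong (+ᵛ-cong (•-congˡ (c 0) (+ᵛ-cong {u = μ • Xν} ≋-refl (≋-sym (previous-last X))))
            (convolution-cong {c = c ∘ suc} {c′ = c ∘ suc} (λ l → ℂR.refl) (λ j → +ᵛ-cong {u = μ • X (inject₁ j)} ≋-refl (≋-sym (previous-inject₁ X j)))))
            (≋-refl {v = a • Xν}) ⟩
      convolution c (twist μ X) +ᵛ a • lastVector X ∎
      where
      open ≋-Reasoning
      Xν = X (fromℕ ν)

    nC0≡1 : ∀ n → n choose 0 ≡ 1
    nC0≡1 n = ≡.trans (nCk≡nC[n∸k] {n = n} ℕ.z≤n) (nCn≡1 n)

    coefficient : ℂ → ℕ → ℕ → ℂ
    coefficient μ K l = (K choose l) ×ᶜ (μ ^ᶜ (K ∸ l))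

    coefficient-zero : ∀ μ K → coefficient μ (suc K) 0 ≈ᶜ (μ *ᶜ coefficient μ K 0)
    coefficient-zero μ K = begin
      (suc K choose 0) ×ᶜ (μ *ᶜ μ ^ᶜ K)      ≈⟨ Multᶜ.×-congˡ {μ *ᶜ μ ^ᶜ K} (≡.trans (nC0≡1 (suc K)) (≡.sym (nC0≡1 K))) ⟩
      (K choose 0) ×ᶜ (μ *ᶜ μ ^ᶜ K)          ≈⟨ Multᶜ.×-comm-* (K choose 0) μ (μ ^ᶜ K) ⟨
      μ *ᶜ ((K choose 0) ×ᶜ (μ ^ᶜ K))        ∎
      where open import Relation.Binary.Reasoning.Setoid ℂ-setoid

    -- Pascal's rule. Truncated subtraction lowers the exponent correctly only for l < K; otherwise
    -- K choose l + 1 is 0.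
    coefficient-suc : ∀ μ K l → coefficient μ (suc K) (suc l) ≈ᶜ (μ *ᶜ coefficient μ K (suc l)) +ᶜ coefficient μ K l
    coefficient-suc μ K l = begin
      (suc K choose suc l) ×ᶜ p                        ≈⟨ Multᶜ.×-congˡ {p} (nCk+nC[k+1]≡[n+1]C[k+1] K l) ⟨
      (K choose l ℕ.+ K choose suc l) ×ᶜ p                  ≈⟨ Multᶜ.×-homo-+ p (K choose l) (K choose suc l) ⟩
      ((K choose l) ×ᶜ p) +ᶜ ((K choose suc l) ×ᶜ p)        ≈⟨ ℂR.+-comm ((K choose l) ×ᶜ p) ((K choose suc l) ×ᶜ p) ⟩
      ((K choose suc l) ×ᶜ p) +ᶜ ((K choose l) ×ᶜ p)        ≈⟨ ℂR.+-congʳ {(K choose l) ×ᶜ p} shift-μ ⟩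
      (μ *ᶜ coefficient μ K (suc l)) +ᶜ coefficient μ K l ∎
      where
      open import Relation.Binary.Reasoning.Setoid ℂ-setoid
      p = μ ^ᶜ (K ∸ l)
      shift-μ : (K choose suc l) ×ᶜ p ≈ᶜ (μ *ᶜ coefficient μ K (suc l))
      shift-μ with ℕ.≤-<-connex (suc l) K
      ... | inj₁ l<K = ℂR.trans (Multᶜ.×-congʳ (K choose suc l) (ℂR.reflexive (≡.cong (μ ^ᶜ_) (ℕ.+-∸-assoc 1 l<K))))
        (ℂR.sym (Multᶜ.×-comm-* (K choose suc l) μ (μ ^ᶜ (K ∸ suc l))))
      ... | inj₂ K≤l = ℂR.trans (Multᶜ.×-congˡ {p} (k>n⇒nCk≡0 K≤l)) (ℂR.sym (ℂR.trans
        (ℂR.*-congˡ (Multᶜ.×-congˡ {μ ^ᶜ (K ∸ suc l)} (k>n⇒nCk≡0 K≤l))) (ℂR.zeroʳ μ)))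

    -- With J the Jordan block of μ, `binomialSum μ K X` is the last entry of X J^K.
    binomialSum-suc : ∀ μ K (X : Fin ν → ℂ^ d) → binomialSum μ (suc K) X ≋ binomialSum μ K (twist μ X)
    binomialSum-suc μ K X = ≋-trans
      (convolution-twist μ 0ᶜ {coefficient μ K} {coefficient μ (suc K)} X (ℂR.trans (coefficient-zero μ K) (ℂR.sym (ℂR.+-identityʳ (μ *ᶜ coefficient μ K 0)))) (coefficient-suc μ K))
      (≋-trans (+ᵛ-cong {u = binomialSum μ K (twist μ X)} ≋-refl (•-zeroˡ (lastVector X))) (0ᵛ-identityʳ (binomialSum μ K (twist μ X))))

    binomialSum-zero : ∀ μ (X : Fin ν → ℂ^ d) → binomialSum μ 0 X ≋ lastVector X
    binomialSum-zero {zero}  μ X = ≋-refl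
    binomialSum-zero {suc ν} μ X = ≋-trans
      (+ᵛ-cong {w = ∑ (λ (l : Fin ν) → coefficient μ 0 (suc (toℕ l)) • X (inject₁ (opposite l)))} {t = 0ᵛ}
        (≋-trans (•-cong {b = 1ᶜ} {u = X (fromℕ ν)} (ℂR.+-identityʳ 1ᶜ) ≋-refl) (•-identity (X (fromℕ ν))))
        (∑-zero (λ l → •-zeroˡ (X (inject₁ (opposite l))))))
      (0ᵛ-identityʳ (X (fromℕ ν)))

    binomialSum-cong : ∀ μ K {X Y : Fin ν → ℂ^ d} → (∀ j → X j ≋ Y j) → binomialSum μ K X ≋ binomialSum μ K Y
    binomialSum-cong μ K p = convolution-cong {c = coefficient μ K} {c′ = coefficient μ K} (λ l → ℂR.refl) p

    binomialSum-⊙ : ∀ μ K (M : Matrix d) (X : Fin ν → ℂ^ d) → binomialSum μ K (λ j → M ⊙ X j) ≋ M ⊙ binomialSum μ K X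
    binomialSum-⊙ μ K M X = ≋-trans (∑-cong (λ l → ≋-sym (⊙-• M (coefficient μ K (toℕ l)) (X (opposite l)))))
      (≋-sym (⊙-∑ M (λ l → coefficient μ K (toℕ l) • X (opposite l))))

    binomialSum-∑ : ∀ μ K {n} (G : Fin n → Fin ν → ℂ^ d) → binomialSum μ K (λ j → ∑ (λ r → G r j)) ≋ ∑ (λ r → binomialSum μ K (G r))
    binomialSum-∑ μ K G = ≋-trans
      (∑-cong (λ l → ≋-sym (∑-• (coefficient μ K (toℕ l)) (λ r → G r (opposite l)))))
      (∑-swap (λ l r → coefficient μ K (toℕ l) • G r (opposite l)))

    binomialSum-0 : ∀ μ K {X : Fin ν → ℂ^ d} → (∀ j → X j ≋ 0ᵛ) → binomialSum μ K X ≋ 0ᵛ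
    binomialSum-0 μ K {X} p = ∑-zero (λ l → ≋-trans (•-congˡ (coefficient μ K (toℕ l)) (p (opposite l))) (•-zeroʳ (coefficient μ K (toℕ l))))

    power-on-chain : ∀ {μ} (Q : Matrix d) (V : Fin ν → ℂ^ d) → (∀ j → Q ⊙ V j ≋ twist μ V j) →
      ∀ K → (Q ^ᴹ K) ⊙ lastVector V ≋ binomialSum μ K V
    power-on-chain {μ = μ} Q V chain zero = ≋-trans (⊙-1ᴹ (lastVector V)) (≋-sym (binomialSum-zero μ V))
    power-on-chain {μ = μ} Q V chain (suc K) = begin
      (Q ⊡ Q ^ᴹ K) ⊙ lastVector V         ≈⟨ ⊙-⊡ Q (Q ^ᴹ K) (lastVector V) ⟩
      Q ⊙ ((Q ^ᴹ K) ⊙ lastVector V)       ≈⟨ ⊙-cong Q (power-on-chain Q V chain K) ⟩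
      Q ⊙ binomialSum μ K V               ≈⟨ binomialSum-⊙ μ K Q V ⟨
      binomialSum μ K (λ j → Q ⊙ V j)     ≈⟨ binomialSum-cong μ K chain ⟩
      binomialSum μ K (twist μ V)         ≈⟨ binomialSum-suc μ K V ⟨
      binomialSum μ (suc K) V             ∎
      where open ≋-Reasoning

    -- For λ = 0 all products of T + 1 letters vanish.
    module Nilpotent {B d} (A : Fin B → Matrix d) {lam} (lam≈0 : lam ≈ 0#) (contraction : Contraction A lam)
      (branch : Fin B → ℝ → ℝ) where
      open Contraction contraction
      open Norm N
      open NormProperties N

      Killed : ℕ → ℂ^ d → Set
      Killed n v = ∀ (w : Word B n) → act A w v ≋ 0ᵛ

      all-killed : ∀ v → Killed (suc T) v
      all-killed v w = ‖‖≤0⇒≋0 (RO.trans (contracts w v) (RO.reflexive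
        (R.trans (R.*-congʳ (R.trans (R.*-congʳ lam≈0) (R.zeroˡ _))) (R.zeroˡ _))))

      killed-∑ : ∀ {n m} (f : Fin m → ℂ^ d) → (∀ r → Killed n (f r)) → Killed n (∑ f)
      killed-∑ {m = zero}  f h w = act-0 A w
      killed-∑ {m = suc m} f h w = ≋-trans (act-+ A w (f zero) (∑ (f ∘ suc)))
        (≋-trans (+ᵛ-cong (h zero w) (killed-∑ (f ∘ suc) (h ∘ suc) w)) (0ᵛ-identityˡ 0ᵛ))

      -- Unfolding E once lowers K by one and adds a letter to the word, so that m + K remains T +
      -- 1; at K = 0 the word is long enough to kill any vector.
      killed-step : ∀ (E : ℕ → ℝ → ℂ^ d) → (∀ K x → E (suc K) x ≋ ∑ (λ r → A r ⊙ E K (branch r x))) →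
        ∀ m K → m ℕ.+ K ≡ suc T → ∀ x → Killed m (E K x)
      killed-step E rec m zero eq x = ≡.subst (λ n → Killed n (E 0 x)) (≡.trans (≡.sym eq) (ℕ.+-identityʳ m)) (all-killed (E 0 x))
      killed-step E rec m (suc K) eq x w = ≋-trans (act-cong A w (rec K x))
        (killed-∑ (λ r → A r ⊙ E K (branch r x)) (λ r w → killed-step E rec (suc m) K (≡.trans (≡.sym (ℕ.+-suc m K)) eq) (branch r x) (r ∷ w)) w)

      vanishes : ∀ (E : ℕ → ℝ → ℂ^ d) → (∀ K x → E (suc K) x ≋ ∑ (λ r → A r ⊙ E K (branch r x))) → ∀ k x → E (suc T ℕ.+ k) x ≋ 0ᵛ
      vanishes E rec k x = killed-step (λ n → E (n ℕ.+ k)) (λ K → rec (K ℕ.+ k)) 0 (suc T) ≡.refl x []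

    module Expansion {B d : ℕ} (2≤B : 2 ℕ.≤ B) (A : Fin B → Matrix d)
      {lam σ : ℝ} (0<lam : 0# < lam) (lam<σ : lam < σ) (contraction : Contraction A lam)
      {ν : ℕ} {μ : ℂ} (σ<μ : σ < ∣ μ ∣)
      (V : Fin ν → ℂ^ d) (chain : ∀ j → ∑ᴹ A ⊙ V j ≋ twist μ V j) where

      open Solution 2≤B A 0<lam lam<σ contraction σ<μ V chain

      remainder : ℕ → ℝ → ℂ^ d
      remainder K x = partialSum (lastVector V) K x -ᵛ binomialSum μ K (λ j → F j x)

      -- In the last entry of 𝐅 J^(K+1) one factor J is spent on the dilation equation; the other K
      -- act on the right and commute with the A_r.
      binomialSum-recursion : ∀ K x → binomialSum μ (suc K) (λ j → F j x) ≋ ∑ (λ r → A r ⊙ binomialSum μ K (λ j → F j (branch r x)))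
      binomialSum-recursion K x = begin
        binomialSum μ (suc K) (λ j → F j x)                                 ≈⟨ binomialSum-suc μ K (λ j → F j x) ⟩
        binomialSum μ K (twist μ (λ j → F j x))                             ≈⟨ binomialSum-cong μ K (λ j → F-dilation j x) ⟩
        binomialSum μ K (λ j → ∑ (λ r → A r ⊙ F j (branch r x)))            ≈⟨ binomialSum-∑ μ K (λ r j → A r ⊙ F j (branch r x)) ⟩
        ∑ (λ r → binomialSum μ K (λ j → A r ⊙ F j (branch r x)))            ≈⟨ ∑-cong (λ r → binomialSum-⊙ μ K (A r) (λ j → F j (branch r x))) ⟩
        ∑ (λ r → A r ⊙ binomialSum μ K (λ j → F j (branch r x)))            ∎
        where open ≋-Reasoning

      remainder-homogeneous : IsHomogeneous remainder
      remainder-homogeneous = record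
        { recursion = λ K x → ≋-trans (-ᵛ-cong {u = partialSum (lastVector V) (suc K) x} ≋-refl (binomialSum-recursion K x))
            (≋-trans (≋-sym (∑-- (λ r → A r ⊙ partialSum (lastVector V) K (branch r x)) (λ r → A r ⊙ binomialSum μ K (λ j → F j (branch r x)))))
              (∑-cong (λ r → ≋-sym (⊙-- (A r) (partialSum (lastVector V) K (branch r x)) (binomialSum μ K (λ j → F j (branch r x)))))))
        ; support = support
        }
        where
        support : ∀ K x → ¬ InUnit x → remainder K x ≋ 0ᵛ
        support K x ¬p with trichotomy x
        ... | inj₁ p        = -ᵛ-self (≋-trans (partialSum-<0 K p) (≋-sym (binomialSum-0 μ K (λ j → F-<0 j p))))
        ... | inj₂ (inj₁ p) = ⊥-elim (¬p p)
        ... | inj₂ (inj₂ p) = -ᵛ-self (≋-trans (partialSum-≥1 K p) (≋-trans (power-on-chain (∑ᴹ A) V chain K)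
          (≋-sym (binomialSum-cong μ K (λ j → F-≥1 j p)))))

      remainder-bounded : let open Norm (Contraction.N contraction) in ∃[ c ] 0# ≤ c × ∀ x → ‖ remainder 0 x ‖ ≤ c
      remainder-bounded = let (c , 0≤c , h) = F-bounded in c , 0≤c , λ x →
        RO.trans (RO.reflexive (R.trans (cong (-ᵛ-cong {u = lastVector V when (0# ≤ x)} ≋-refl (binomialSum-zero μ (λ j → F j x))))
          (‖-‖-sym (lastVector V when (0# ≤ x)) (lastVector (λ j → F j x)))))
          (last-bound (λ j → F j x) V x 0≤c (λ j → h j x))
        where
        open Norm (Contraction.N contraction)
        open NormProperties (Contraction.N contraction)
        last-bound : ∀ {ν} (X Y : Fin ν → ℂ^ d) x {c} → 0# ≤ c → (∀ j → ‖ X j -ᵛ (Y j when (0# ≤ x)) ‖ ≤ c) →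
          ‖ lastVector X -ᵛ (lastVector Y when (0# ≤ x)) ‖ ≤ c
        last-bound {zero} X Y x 0≤c h = RO.trans (RO.reflexive (‖≋0‖ (-ᵛ-self {u = 0ᵛ} when-0))) 0≤c
          where
          when-0 : ∀ {P} → 0ᵛ ≋ 0ᵛ {d} when P
          when-0 {P} with em {P}
          ... | yes _ = ≋-refl
          ... | no  _ = ≋-refl
        last-bound {suc ν} X Y x 0≤c h = h (fromℕ ν)

  open BinomialExpansion public

  -- Uniqueness for the dilation equation.

  module Uniqueness where

    private
      variable
        d ν : ℕ

    floor-exists : ∀ n {y} → 0# ≤ y → y < ofℕ n → ∃[ k ] IsFloor (toℕ {n} k) y
    floor-exists zero 0≤y y<0 = ⊥-elim (<⇒≱ y<0 0≤y)
    floor-exists (suc n) {y} 0≤y y<n+1 with em {y < ofℕ n}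
    ... | yes y<n = let (k , fl) = floor-exists n 0≤y y<n in
      inject₁ k , ≡.subst (λ m → IsFloor m y) (≡.sym (Fin.toℕ-inject₁ k)) fl
    ... | no y≮n = fromℕ n , ≡.subst (λ m → IsFloor m y) (≡.sym (Fin.toℕ-fromℕ n)) (≮⇒≥ y≮n , y<n+1)

    ∑-split : ∀ {n} (f g : Fin n → ℂ^ d) (k : Fin n) →
      (∀ r → toℕ r ℕ.< toℕ k → f r ≋ g r) → (∀ r → toℕ k ℕ.< toℕ r → f r ≋ 0ᵛ) →
      ∑ f ≋ ∑ (λ (r : Fin (toℕ k)) → g (inject r)) +ᵛ f k
    ∑-split f g zero h₁ h₂ i = ℂR.trans (ℂR.+-congˡ (∑-zero (λ r → h₂ (suc r) (ℕ.s≤s ℕ.z≤n)) i))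
      (ℂR.+-comm (f zero i) 0ᶜ)
    ∑-split f g (suc k) h₁ h₂ i = ℂR.trans
      (ℂR.+-cong (h₁ zero (ℕ.s≤s ℕ.z≤n) i)
        (∑-split (f ∘ suc) (g ∘ suc) k (λ r p → h₁ (suc r) (ℕ.s≤s p)) (λ r p → h₂ (suc r) (ℕ.s≤s p)) i))
      (ℂR.sym (ℂR.+-assoc (g zero i) (∑ (λ (r : Fin (toℕ k)) → g (suc (inject r))) i) (f (suc k) i)))

    -- A point of `UnitInterval` carries proofs, and reals are compared by ≈, so that a function
    -- need not respect equality of points. A continuous one does.
    Continuous-cong : ∀ {F : UnitInterval → ℂ^ d} → Continuous F → ∀ {x y} → val x ≈ val y → F x ≋ F y
    Continuous-cong {F = F} cont {x} {y} x≈y i = ℂR.sym (ℂR.trans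
      (ℂS.solve 2 (λ a b → a ℂS.:= (a ℂS.:- b) ℂS.:+ b) ℂR.refl (F y i) (F x i))
      (ℂR.trans (ℂR.+-congʳ (∣∣≤0⇒≈0 (≤-from-ε close))) (ℂR.+-identityˡ (F x i))))
      where
      close : ∀ ε → 0# < ε → ∣ (F y -ᵛ F x) i ∣ ≤ ε
      close ε 0<ε = let (δ , 0<δ , h) = cont x ε 0<ε in
        <⇒≤ (h y (≤-<-trans (∣∣-≤ (RO.reflexive y-x≈0) (RO.reflexive (R.trans (R.-‿cong y-x≈0) (solve 0 (:- :0 := :0) R.refl)))) 0<δ) i)
        where
        y-x≈0 : val y - val x ≈ 0#
        y-x≈0 = R.trans (R.+-congʳ (R.sym x≈y)) (R.-‿inverseʳ (val x))

    module Dilation {B d : ℕ} (2≤B : 2 ℕ.≤ B) (A : Fin B → Matrix d) where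
      open Summation 2≤B A

      -- For r < x₁ the branch B x - r is at least 1, where F is v, and for r > x₁ it is negative,
      -- so that F remains unevaluated at the branch x₁ only.
      branch-split : ∀ (F : ℝ → ℂ^ d) v → (∀ {x} → x < 0# → F x ≋ 0ᵛ) → (∀ {x} → 1# ≤ x → F x ≋ v) →
        ∀ x (x₁ : Fin B) (fl : IsFloor (toℕ x₁) (ofℕ B * val x)) →
        ∑ (λ r → A r ⊙ F (branch r (val x))) ≋ dilationRHS A v (λ y → F (val y)) x x₁ fl
      branch-split F v F<0 F≥1 x x₁ (lower , upper) = ∑-split (λ r → A r ⊙ F (branch r (val x))) (λ r → A r ⊙ v) x₁
        (λ r r<x₁ → ⊙-cong (A r) (F≥1 (1≤x-m r<x₁ (0≤y-x lower))))
        (λ r x₁<r → ≋-trans (⊙-cong (A r) (F<0 (x-n<0 x₁<r frac<1))) (⊙-0 (A r)))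
        where
        frac<1 : ofℕ B * val x - ofℕ (toℕ x₁) < 1#
        frac<1 = <-by (0<y-x upper) (solve 2 (λ y n → :1 :- (y :- n) := (:1 :+ n) :- y) R.refl (ofℕ B * val x) (ofℕ (toℕ x₁)))

      expand : ∀ x → val x < 1# → ∃[ x₁ ] IsFloor (toℕ {B} x₁) (ofℕ B * val x)
      expand x x<1 = floor-exists B (0≤* (<⇒≤ 0<B) (UnitInterval.0≤val x))
        (<-≤-trans (*-mono-< 0<B x<1) (RO.reflexive (R.*-identityʳ _)))

      -- The points of agreement have a finite expansion in base B: there a
      -- solution is determined by its value at 0.
      record Point (F G : UnitInterval → ℂ^ d) (K : ℕ) (x : ℝ) : Set where
        field
          point : UnitInterval
          below : val point ≤ x
          close : x ≤ val point + β ^ K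
          <1    : val point < 1#
          agree : F point ≋ G point

      module _ {F G : UnitInterval → ℂ^ d} (contF : Continuous F) (contG : Continuous G)
        (at-0 : F 0ᴵ ≋ G 0ᴵ) (at-1 : F 1ᴵ ≋ G 1ᴵ)
        (step : ∀ x → val x < 1# → ∀ x₁ fl → F (dilate A x x₁ fl) ≋ G (dilate A x x₁ fl) → F x ≋ G x) where

        -- If q approximates the dilated point B x - x₁, then (x₁ + q)/B approximates x with B times
        -- less error. It has x₁ as first digit again and dilates to q, so that `step` carries the
        -- agreement over from q.
        points : ∀ K x → val x < 1# → Point F G K (val x)
        points zero x x<1 = record
          { point = 0ᴵ ; below = UnitInterval.0≤val x
          ; close = RO.trans (<⇒≤ x<1) (RO.reflexive (R.sym (R.+-identityˡ 1#)))
          ; <1 = 0<1 ; agree = at-0 }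
        points (suc K) x x<1 = record
          { point = p
          ; below = *-cancel-≤ 0<B (begin
              ofℕ B * (β * (r + val q))    ≈⟨ B*p ⟩
              r + val q                    ≤⟨ +-monoʳ-≤ r below ⟩
              r + (ofℕ B * val x - r)      ≈⟨ solve 2 (λ r y → r :+ (y :- r) := y) R.refl r (ofℕ B * val x) ⟩
              ofℕ B * val x                ∎)
          ; close = *-cancel-≤ 0<B (begin
              ofℕ B * val x                                          ≈⟨ solve 2 (λ r y → y := r :+ (y :- r)) R.refl r (ofℕ B * val x) ⟩
              r + (ofℕ B * val x - r)                                ≤⟨ +-monoʳ-≤ r close ⟩
              r + (val q + β ^ K)                                    ≈⟨ R.+-assoc _ _ _ ⟨
              r + val q + β ^ K                                      ≈⟨ R.+-cong B*p (R.trans (R.*-congʳ Bβ) (R.*-identityˡ _)) ⟨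
              ofℕ B * (β * (r + val q)) + ofℕ B * β * β ^ K          ≈⟨ solve 4 (λ b i y p → b :* (i :* y) :+ b :* i :* p :=
                b :* (i :* y :+ i :* p)) R.refl (ofℕ B) β (r + val q) (β ^ K) ⟩
              ofℕ B * (β * (r + val q) + β * β ^ K)                  ∎)
          ; <1 = p<1
          ; agree = step p p<1 x₁ p-floor (≋-trans (Continuous-cong contF dilate≈)
              (≋-trans agree (Continuous-cong contG (R.sym dilate≈))))
          }
          where
          open ≤-Reasoning
          x₁ = proj₁ (expand x x<1)
          r = ofℕ (toℕ x₁)
          fl = proj₂ (expand x x<1)
          x′<1 : ofℕ B * val x - r < 1#
          x′<1 = <-by (0<y-x (proj₂ fl)) (solve 2 (λ y n → :1 :- (y :- n) := (:1 :+ n) :- y) R.refl (ofℕ B * val x) r)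
          open Point (points K (dilate A x x₁ fl) x′<1) renaming (point to q)
          B*p : ofℕ B * (β * (r + val q)) ≈ r + val q
          B*p = R.trans (R.sym (R.*-assoc _ _ _)) (R.trans (R.*-congʳ Bβ) (R.*-identityˡ _))
          r+q<B : r + val q < ofℕ B
          r+q<B = <-≤-trans (≤-<-trans (RO.reflexive (R.+-comm r (val q))) (+-mono-<-≤ <1 RO.refl)) (ofℕ-mono (Fin.toℕ<n x₁))
          p<1 : β * (r + val q) < 1#
          p<1 = <-≤-trans (*-mono-< 0<β r+q<B) (RO.reflexive (⁻¹-inverseˡ 0<B))
          p : UnitInterval
          p = interval (β * (r + val q)) (0≤* (<⇒≤ 0<β) (0≤+ (0≤ofℕ (toℕ x₁)) (UnitInterval.0≤val q))) (<⇒≤ p<1)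
          p-floor : IsFloor (toℕ x₁) (ofℕ B * val p)
          p-floor = RO.trans (≤-by (UnitInterval.0≤val q) (solve 2 (λ r q → (r :+ q) :- r := q) R.refl r (val q))) (RO.reflexive (R.sym B*p)) ,
            ≤-<-trans (RO.reflexive B*p) (≤-<-trans (RO.reflexive (R.+-comm r (val q))) (+-mono-<-≤ <1 RO.refl))
          dilate≈ : val (dilate A p x₁ p-floor) ≈ val q
          dilate≈ = R.trans (R.+-congʳ B*p) (solve 2 (λ r q → (r :+ q) :- r := q) R.refl r (val q))

        agreement : ∀ x → F x ≋ G x
        agreement x with em {val x < 1#}
        -- The equation is stated for x < 1 only; at 1 the value is prescribed.
        ... | no x≮1 = ≋-trans (Continuous-cong contF x≈1) (≋-trans at-1 (Continuous-cong contG (R.sym x≈1)))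
          where
          x≈1 : val x ≈ 1#
          x≈1 = RO.antisym (UnitInterval.val≤1 x) (≮⇒≥ x≮1)
        ... | yes x<1 = λ i → ℂR.trans
          (ℂS.solve 2 (λ a b → a ℂS.:= (a ℂS.:- b) ℂS.:+ b) ℂR.refl (F x i) (G x i))
          (ℂR.trans (ℂR.+-congʳ (∣∣≤0⇒≈0 (≤-from-ε (bound i)))) (ℂR.+-identityˡ (G x i)))
          where
          bound : ∀ i ε → 0# < ε → ∣ (F x -ᵛ G x) i ∣ ≤ ε
          bound i ε 0<ε = begin
            ∣ (F x -ᵛ G x) i ∣                                ≈⟨ ∣∣ᶜ-cong (ℂR.trans
              (ℂS.solve 3 (λ f g a → f ℂS.:- g ℂS.:= (ℂS.:- (a ℂS.:- f)) ℂS.:+ (a ℂS.:- g)) ℂR.refl (F x i) (G x i) (F point i))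
              (ℂR.+-congˡ (ℂR.+-congʳ (agree i)))) ⟩
            ∣ (-ᶜ (F point -ᵛ F x) i) +ᶜ (G point -ᵛ G x) i ∣  ≤⟨ ∣∣-+ (-ᶜ (F point -ᵛ F x) i) ((G point -ᵛ G x) i) ⟩
            ∣ -ᶜ (F point -ᵛ F x) i ∣ + ∣ (G point -ᵛ G x) i ∣ ≈⟨ R.+-congʳ (∣-ᶜ∣ ((F point -ᵛ F x) i)) ⟩
            ∣ (F point -ᵛ F x) i ∣ + ∣ (G point -ᵛ G x) i ∣    ≤⟨ +-mono-≤ (<⇒≤ (proj₂ (proj₂ moduli) point near i))
                                                                   (<⇒≤ (proj₂ (proj₂ moduli′) point near′ i)) ⟩
            ½ * ε + ½ * ε                                      ≈⟨ R.distribʳ _ _ _ ⟨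
            (½ + ½) * ε                                        ≈⟨ R.*-congʳ ½+½ ⟩
            1# * ε                                             ≈⟨ R.*-identityˡ ε ⟩
            ε                                                  ∎
            where
            open ≤-Reasoning
            moduli = contF x (½ * ε) (0<* 0<½ 0<ε)
            moduli′ = contG x (½ * ε) (0<* 0<½ 0<ε)
            small = powers-small (<⇒≤ 0<β) β<1 (proj₁ moduli) (proj₁ (proj₂ moduli))
            small′ = powers-small (<⇒≤ 0<β) β<1 (proj₁ moduli′) (proj₁ (proj₂ moduli′))
            K = proj₁ small ℕ.+ proj₁ small′
            open Point (points K x x<1)
            dist≤ : ∣ val point - val x ∣ℝ ≤ β ^ K
            dist≤ = ∣∣-≤ (RO.trans (≤-by (0≤y-x below) (solve 2 (λ p x → :0 :- (p :- x) := x :- p) R.refl (val point) (val x))) (0≤^ (<⇒≤ 0<β) K))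
              (≤-by (0≤y-x close) (solve 3 (λ p x b → b :- (:- (p :- x)) := (p :+ b) :- x) R.refl (val point) (val x) (β ^ K)))
            β^-anti : ∀ m n → β ^ (n ℕ.+ m) ≤ β ^ m
            β^-anti m zero    = RO.refl
            β^-anti m (suc n) = RO.trans (*-monoʳ-≤ (0≤^ (<⇒≤ 0<β) (n ℕ.+ m)) (<⇒≤ β<1))
              (RO.trans (RO.reflexive (R.*-identityˡ _)) (β^-anti m n))
            near : ∣ val point - val x ∣ℝ < proj₁ moduli
            near = ≤-<-trans dist≤ (≤-<-trans (RO.trans (RO.reflexive (R.reflexive (≡.cong (β ^_) (ℕ.+-comm (proj₁ small) (proj₁ small′)))))
              (β^-anti (proj₁ small) (proj₁ small′))) (proj₂ small))
            near′ : ∣ val point - val x ∣ℝ < proj₁ moduli′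
            near′ = ≤-<-trans dist≤ (≤-<-trans (β^-anti (proj₁ small′) (proj₁ small)) (proj₂ small′))

      -- Along the chain, the equation for the index j involves no other unknown than the function
      -- before it, on which the solutions already agree, and μ is cancelled.
      dilation-unique : ∀ {μ} → 0# < ∣ μ ∣ → ∀ {V : Fin ν → ℂ^ d} {F G} → IsDilationSolution A μ V F → IsDilationSolution A μ V G →
        ∀ j x → F j x ≋ G j x
      dilation-unique {μ = μ} 0<μ {V} {F} {G} solF solG = toℕ-induction (λ j → ∀ x → F j x ≋ G j x)
        (λ j j≡0 → agreement (SF.continuous j) (SG.continuous j) (at-0 j) (at-1 j) λ x x<1 x₁ fl eq →
          cancel {v = 0ᵛ} {w = 0ᵛ} ≋-refl (≋-trans (0ᵛ-identityʳ (μ • F j x)) (≋-trans (SF.base j j≡0 x x<1 x₁ fl)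
            (≋-trans (rhs j x x₁ fl eq) (≋-trans (≋-sym (SG.base j j≡0 x x<1 x₁ fl)) (≋-sym (0ᵛ-identityʳ (μ • G j x))))))))
        (λ i j j≡1+i ih → agreement (SF.continuous j) (SG.continuous j) (at-0 j) (at-1 j) λ x x<1 x₁ fl eq →
          cancel (ih x) (≋-trans (λ k → ℂR.+-comm ((μ • F j x) k) (F i x k)) (≋-trans (SF.step i j j≡1+i x x<1 x₁ fl)
            (≋-trans (rhs j x x₁ fl eq) (≋-trans (≋-sym (SG.step i j j≡1+i x x<1 x₁ fl)) (λ k → ℂR.+-comm (G i x k) ((μ • G j x) k)))))))
        where
        module SF = IsDilationSolution solF
        module SG = IsDilationSolution solG
        at-0 = λ j → ≋-trans (SF.at-0 j) (≋-sym (SG.at-0 j))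
        at-1 = λ j → ≋-trans (SF.at-1 j) (≋-sym (SG.at-1 j))
        rhs : ∀ j x x₁ fl → F j (dilate A x x₁ fl) ≋ G j (dilate A x x₁ fl) →
          dilationRHS A (V j) (F j) x x₁ fl ≋ dilationRHS A (V j) (G j) x x₁ fl
        rhs j x x₁ fl eq = +ᵛ-cong {u = ∑ (λ (r : Fin (toℕ x₁)) → A (inject r) ⊙ V j)} ≋-refl (⊙-cong (A x₁) eq)
        cancel : ∀ {u u′ v w : ℂ^ d} → v ≋ w → μ • u +ᵛ v ≋ μ • u′ +ᵛ w → u ≋ u′
        cancel {u} {u′} {v} {w} p q = ≋-trans (•-solve 0<μ q) (≋-trans
          (•-congˡ (μ ⁻¹ᶜ) (-ᵛ-cong {u = μ • u′ +ᵛ w} ≋-refl p)) (≋-sym (•-solve 0<μ (≋-refl {v = μ • u′ +ᵛ w}))))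

  open Uniqueness public

  -- Uniform estimates for single Jordan chains.

  module Growth where

    private
      variable
        d ν : ℕ
        E E′ : ℕ → UnitInterval → ℂ^ d
        g g′ : ℕ → ℝ

    UniformlyO-cong : (∀ K x → E K x ≋ E′ K x) → UniformlyO E g → UniformlyO E′ g
    UniformlyO-cong p (c , K₀ , h) = c , K₀ , λ K K₀≤K x i →
      RO.trans (RO.reflexive (∣∣ᶜ-cong (ℂR.sym (p K x i)))) (h K K₀≤K x i)

    -- The gauge g is arbitrary; for λ⋆ = 0 it may itself vanish.
    UniformlyO-vanishing : ∀ K₀ → (∀ K → K₀ ℕ.≤ K → ∀ x → E K x ≋ 0ᵛ) → UniformlyO E g
    UniformlyO-vanishing {g = g} K₀ h = 0# , K₀ , λ K K₀≤K x i →
      RO.reflexive (R.trans (∣∣ᶜ-cong (h K K₀≤K x i)) (R.trans ∣0∣ (R.sym (R.zeroˡ (g K)))))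

    UniformlyO-+ : UniformlyO E g → UniformlyO E′ g → UniformlyO (λ K x → E K x +ᵛ E′ K x) g
    UniformlyO-+ {E = E} {g = g} {E′ = E′} (c , K₀ , h) (c′ , K₀′ , h′) = c + c′ , K₀ ℕ.+ K₀′ , λ K K₀≤K x i → begin
      ∣ E K x i +ᶜ E′ K x i ∣          ≤⟨ ∣∣-+ (E K x i) (E′ K x i) ⟩
      ∣ E K x i ∣ + ∣ E′ K x i ∣       ≤⟨ +-mono-≤ (h K (ℕ.≤-trans (ℕ.m≤m+n K₀ K₀′) K₀≤K) x i) (h′ K (ℕ.≤-trans (ℕ.m≤n+m K₀′ K₀) K₀≤K) x i) ⟩
      c * g K + c′ * g K               ≈⟨ R.distribʳ _ _ _ ⟨
      (c + c′) * g K                   ∎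
      where open ≤-Reasoning

    UniformlyO-• : ∀ z → UniformlyO E g → UniformlyO (λ K x → z • E K x) g
    UniformlyO-• {E = E} {g = g} z (c , K₀ , h) = ∣ z ∣ * c , K₀ , λ K K₀≤K x i → begin
      ∣ z *ᶜ E K x i ∣        ≈⟨ ∣∣-* z (E K x i) ⟩
      ∣ z ∣ * ∣ E K x i ∣     ≤⟨ *-monoˡ-≤ 0≤∣ z ∣ (h K K₀≤K x i) ⟩
      ∣ z ∣ * (c * g K)       ≈⟨ R.*-assoc _ _ _ ⟨
      ∣ z ∣ * c * g K         ∎
      where open ≤-Reasoning

    UniformlyO-∑ : ∀ {n} (E : Fin n → ℕ → UnitInterval → ℂ^ d) → (∀ j → UniformlyO (E j) g) →
      UniformlyO (λ K x → ∑ (λ j → E j K x)) g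
    UniformlyO-∑ {n = zero}  E h = UniformlyO-vanishing 0 (λ _ _ _ → ≋-refl)
    UniformlyO-∑ {n = suc n} E h = UniformlyO-+ {E = E zero} {E′ = λ K x → ∑ (λ j → E (suc j) K x)} (h zero) (UniformlyO-∑ (E ∘ suc) (h ∘ suc))

    UniformlyO-mono : ∀ c′ K₁ → (∀ K → K₁ ℕ.≤ K → 0# ≤ g K × g K ≤ c′ * g′ K) → UniformlyO E g → UniformlyO E g′
    UniformlyO-mono {g = g} {g′ = g′} {E = E} c′ K₁ p (c , K₀ , h) = ∣ c ∣ℝ * c′ , K₀ ℕ.+ K₁ , λ K K₀≤K x i →
      let (0≤g , g≤g′) = p K (ℕ.≤-trans (ℕ.m≤n+m K₁ K₀) K₀≤K) in begin
      ∣ E K x i ∣              ≤⟨ h K (ℕ.≤-trans (ℕ.m≤m+n K₀ K₁) K₀≤K) x i ⟩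
      c * g K                  ≤⟨ *-monoʳ-≤ 0≤g (x≤∣x∣ c) ⟩
      ∣ c ∣ℝ * g K             ≤⟨ *-monoˡ-≤ (0≤∣∣ c) g≤g′ ⟩
      ∣ c ∣ℝ * (c′ * g′ K)     ≈⟨ R.*-assoc _ _ _ ⟨
      ∣ c ∣ℝ * c′ * g′ K       ∎
      where open ≤-Reasoning

    UniformlyO-norm : ∀ (N : Norm d) → let open Norm N in ∀ (E : ℕ → ℝ → ℂ^ d) c →
      (∀ K x → ‖ E K x ‖ ≤ c * g K) → UniformlyO (λ K x → E K (val x)) g
    UniformlyO-norm {g = g} N E c h = let (k , 0≤k , lower) = coordinates≤norm N in
      k * c , 0 , λ K _ x i → RO.trans (lower (E K (val x)) i)
        (RO.trans (*-monoˡ-≤ 0≤k (h K (val x))) (RO.reflexive (R.sym (R.*-assoc k c (g K)))))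

    inject₁-unique : ∀ {n} (i : Fin (suc n)) (j : Fin n) → suc (toℕ j) ≡ suc (toℕ i) → i ≡ inject₁ j
    inject₁-unique i j eq = Fin.toℕ-injective (≡.trans (≡.sym (ℕ.suc-injective eq)) (≡.sym (Fin.toℕ-inject₁ j)))

    jordan⇒twist : ∀ {Q : Matrix d} {μ} {V : Fin ν → ℂ^ d} → IsJordanChain Q μ V → ∀ j → Q ⊙ V j ≋ twist μ V j
    jordan⇒twist {μ = μ} {V} chain zero = ≋-trans (IsJordanChain.base chain zero ≡.refl) (≋-sym (0ᵛ-identityʳ (μ • V zero)))
    jordan⇒twist chain (suc j) = IsJordanChain.step chain (inject₁ j) (suc j) (≡.cong suc (≡.sym (Fin.toℕ-inject₁ j)))

    module _ {μ : ℂ} {Q : Matrix d} {V : Fin ν → ℂ^ d} (chain : ∀ j → Q ⊙ V j ≋ twist μ V j) (N : Norm d) where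
      open Norm N
      open NormProperties N

      orbit : Fin ν → ℕ → ℝ
      orbit j K = ‖ (Q ^ᴹ K) ⊙ V j ‖

      orbit-step : ∀ j K {b} → ‖ (Q ^ᴹ K) ⊙ previous 0ᵛ V j ‖ ≤ b → orbit j (suc K) ≤ ∣ μ ∣ * orbit j K + b
      orbit-step j K {b} h = begin
        ‖ (Q ^ᴹ suc K) ⊙ V j ‖                                             ≈⟨ cong (≋-trans (^ᴹ-suc Q K (V j)) (⊙-cong (Q ^ᴹ K) (chain j))) ⟩
        ‖ (Q ^ᴹ K) ⊙ (μ • V j +ᵛ previous 0ᵛ V j) ‖                        ≈⟨ cong (≋-trans (⊙-+ (Q ^ᴹ K) (μ • V j) (previous 0ᵛ V j))
                                                                                (+ᵛ-cong {w = (Q ^ᴹ K) ⊙ previous 0ᵛ V j} (⊙-• (Q ^ᴹ K) μ (V j)) ≋-refl)) ⟩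
        ‖ μ • ((Q ^ᴹ K) ⊙ V j) +ᵛ (Q ^ᴹ K) ⊙ previous 0ᵛ V j ‖             ≤⟨ triangle (μ • ((Q ^ᴹ K) ⊙ V j)) ((Q ^ᴹ K) ⊙ previous 0ᵛ V j) ⟩
        ‖ μ • ((Q ^ᴹ K) ⊙ V j) ‖ + ‖ (Q ^ᴹ K) ⊙ previous 0ᵛ V j ‖          ≤⟨ +-mono-≤ (RO.reflexive (homogeneous μ ((Q ^ᴹ K) ⊙ V j))) h ⟩
        ∣ μ ∣ * orbit j K + b                                              ∎
        where open ≤-Reasoning

      orbit-base : ∀ j → toℕ j ≡ 0 → ∀ K → ‖ (Q ^ᴹ K) ⊙ previous 0ᵛ V j ‖ ≤ 0#
      orbit-base zero _ K = RO.reflexive (‖≋0‖ (⊙-0 (Q ^ᴹ K)))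

      orbit-previous : ∀ i j → toℕ j ≡ suc (toℕ i) → ∀ {b} K → orbit i K ≤ b → ‖ (Q ^ᴹ K) ⊙ previous 0ᵛ V j ‖ ≤ b
      orbit-previous i (suc j) eq K h with inject₁-unique i j eq
      ... | ≡.refl = h

      -- The strict gap between ∣μ∣ and σ absorbs the powers of K, and μ = 0 is allowed.
      orbit-subexponential : ∀ {σ} → ∣ μ ∣ < σ → ∀ j → ∃[ c ] 0# ≤ c × ∀ K → orbit j K ≤ c * σ ^ K
      orbit-subexponential {σ} μ<σ = toℕ-induction (λ j → ∃[ c ] 0# ≤ c × ∀ K → orbit j K ≤ c * σ ^ K)
        (λ j j≡0 → recurrence-> 0≤∣ μ ∣ μ<σ RO.refl (orbit j) (nonNegative _)
          (λ K → RO.trans (orbit-step j K (orbit-base j j≡0 K)) (+-monoʳ-≤ _ (RO.reflexive (R.sym (R.zeroˡ _))))))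
        (λ i j eq (c , 0≤c , h) → recurrence-> 0≤∣ μ ∣ μ<σ 0≤c (orbit j) (nonNegative _)
          (λ K → orbit-step j K (orbit-previous i j eq K (h K))))

      -- Each step up the chain is one resonance. The first vector is treated directly, as
      -- `recurrence-≈` would cost one power too many there.
      orbit-exact : 0# < ∣ μ ∣ → ∀ j → ∃[ c ] 0# ≤ c × ∀ K → orbit j K ≤ c * (∣ μ ∣ ^ K * ofℕ (suc K) ^ toℕ j)
      orbit-exact 0<μ = toℕ-induction (λ j → ∃[ c ] 0# ≤ c × ∀ K → orbit j K ≤ c * (∣ μ ∣ ^ K * ofℕ (suc K) ^ toℕ j))
        (λ j j≡0 → orbit j 0 , nonNegative _ , λ K → RO.trans (base-bound j j≡0 K) (RO.reflexive
          (R.*-congˡ (R.trans (R.sym (R.*-identityʳ _)) (R.*-congˡ (R.reflexive (≡.cong (ofℕ (suc K) ^_) (≡.sym j≡0))))))))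
        (λ i j eq (c , 0≤c , h) → ≡.subst (λ p → ∃[ c ] 0# ≤ c × ∀ K → orbit j K ≤ c * (∣ μ ∣ ^ K * ofℕ (suc K) ^ p)) (≡.sym eq)
          (recurrence-≈ 0<μ 0≤c (toℕ i) (orbit j) (nonNegative _) (λ K → orbit-step j K (orbit-previous i j eq K (h K)))))
        where
        open ≤-Reasoning
        base-bound : ∀ j → toℕ j ≡ 0 → ∀ K → orbit j K ≤ orbit j 0 * ∣ μ ∣ ^ K
        base-bound j j≡0 zero = RO.reflexive (R.sym (R.*-identityʳ _))
        base-bound j j≡0 (suc K) = begin
          orbit j (suc K)                          ≤⟨ orbit-step j K (orbit-base j j≡0 K) ⟩
          ∣ μ ∣ * orbit j K + 0#                   ≈⟨ R.+-identityʳ _ ⟩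
          ∣ μ ∣ * orbit j K                        ≤⟨ *-monoˡ-≤ 0≤∣ μ ∣ (base-bound j j≡0 K) ⟩
          ∣ μ ∣ * (orbit j 0 * ∣ μ ∣ ^ K)          ≈⟨ solve 3 (λ m o p → m :* (o :* p) := o :* (m :* p)) R.refl ∣ μ ∣ (orbit j 0) (∣ μ ∣ ^ K) ⟩
          orbit j 0 * ∣ μ ∣ ^ suc K                ∎

    -- K + 1 ≤ 2 K. The recurrences yield powers of K + 1, the theorem asks for powers of K.
    ofℕ-suc-≤ : ∀ {K} → 1 ℕ.≤ K → ∀ p → ofℕ (suc K) ^ p ≤ 2# ^ p * ofℕ K ^ p
    ofℕ-suc-≤ 1≤K zero = RO.reflexive (R.sym (R.*-identityˡ 1#))
    ofℕ-suc-≤ {K} 1≤K (suc p) = begin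
      ofℕ (suc K) * ofℕ (suc K) ^ p           ≤⟨ *-mono-≤ (0≤ofℕ (suc K)) (0≤* (0≤^ (<⇒≤ 0<2) p) (0≤^ (0≤ofℕ K) p))
        (≤-by (0≤y-x (1≤ofℕ 1≤K)) (solve 1 (λ k → (:1 :+ :1) :* k :- (:1 :+ k) := k :- :1) R.refl (ofℕ K))) (ofℕ-suc-≤ 1≤K p) ⟩
      2# * ofℕ K * (2# ^ p * ofℕ K ^ p)       ≈⟨ solve 4 (λ t k p q → t :* k :* (p :* q) := t :* p :* (k :* q)) R.refl 2# (ofℕ K) (2# ^ p) (ofℕ K ^ p) ⟩
      2# ^ suc p * ofℕ K ^ suc p              ∎
      where open ≤-Reasoning

    module Asymptotics {B d : ℕ} (2≤B : 2 ℕ.≤ B) (A : Fin B → Matrix d) {λ⋆ : ℝ} (jsr : IsJointSpectralRadius A λ⋆) where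
      open Summation 2≤B A
      open Dilation 2≤B A

      private
        Q = ∑ᴹ A

      S≋ : ∀ v K x → S A v K x ≋ partialSum v K (val x)
      S≋ v K x = S≋partialSum v K (val x)

      partialSum-killed : ∀ {lam} → lam ≈ 0# → Contraction A lam → ∃[ K₀ ] ∀ v K → K₀ ℕ.≤ K → ∀ x → S A v K x ≋ 0ᵛ
      partialSum-killed lam≈0 contraction = suc (Contraction.T contraction) , λ v K K₀≤K x → ≋-trans (S≋ v K x)
        (≡.subst (λ n → partialSum v n (val x) ≋ 0ᵛ) (ℕ.m+[n∸m]≡n K₀≤K)
          (vanishes (partialSum v) (λ _ _ → ≋-refl) (K ℕ.∸ suc (Contraction.T contraction)) (val x)))
        where open Nilpotent A lam≈0 contraction branch

      -- `expansion` holds for every contraction, not just for the one from which F was built.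
      -- `exact` replaces it at the rate 0, where there is no adapted norm.
      record Solved {ν} (μ : ℂ) (V : Fin ν → ℂ^ d) : Set where
        field
          F         : Fin ν → UnitInterval → ℂ^ d
          solution  : IsDilationSolution A μ V F
          expansion : ∀ {lam} → 0# < lam → Contraction A lam →
                      UniformlyO (λ K x → S A (lastVector V) K x -ᵛ 𝐀 μ F K x) (λ K → lam ^ K)
          exact     : ∀ {lam} → lam ≈ 0# → Contraction A lam →
                      ∃[ K₀ ] ∀ K → K₀ ℕ.≤ K → ∀ x → S A (lastVector V) K x -ᵛ 𝐀 μ F K x ≋ 0ᵛ

      module _ {lam σ : ℝ} (0<lam : 0# < lam) (lam<σ : lam < σ) (contraction : Contraction A lam)
        {ν : ℕ} {μ : ℂ} (σ<μ : σ < ∣ μ ∣)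
        (V : Fin ν → ℂ^ d) (chain : ∀ j → Q ⊙ V j ≋ twist μ V j) where

        open Solution 2≤B A 0<lam lam<σ contraction σ<μ V chain using (F; F-continuous; F-0; F-<0; F-≥1; F-dilation)
        open Expansion 2≤B A 0<lam lam<σ contraction σ<μ V chain using (remainder; remainder-homogeneous; remainder-bounded)

        F-solution : IsDilationSolution A μ V (λ j x → F j (val x))
        F-solution = record
          { continuous = λ j x ε 0<ε → let (δ , 0<δ , h) = F-continuous j (val x) ε 0<ε in δ , 0<δ , λ y → h (val y)
          ; at-0 = F-0
          ; at-1 = λ j → F-≥1 j RO.refl
          ; base = base
          ; step = step
          }
          where
          dilation : ∀ j x x₁ fl → twist μ (λ i → F i (val x)) j ≋ dilationRHS A (V j) (λ y → F j (val y)) x x₁ fl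
          dilation j x x₁ fl = ≋-trans (F-dilation j (val x)) (branch-split (F j) (V j) (F-<0 j) (F-≥1 j) x x₁ fl)
          base : ∀ j → toℕ j ≡ 0 → ∀ x → val x < 1# → ∀ x₁ fl →
            μ • F j (val x) ≋ dilationRHS A (V j) (λ y → F j (val y)) x x₁ fl
          base zero _ x _ x₁ fl = ≋-trans (≋-sym (0ᵛ-identityʳ (μ • F zero (val x)))) (dilation zero x x₁ fl)
          step : ∀ i j → toℕ j ≡ suc (toℕ i) → ∀ x → val x < 1# → ∀ x₁ fl →
            F i (val x) +ᵛ μ • F j (val x) ≋ dilationRHS A (V j) (λ y → F j (val y)) x x₁ fl
          step i (suc j) eq x _ x₁ fl with inject₁-unique i j eq
          ... | ≡.refl = ≋-trans (λ k → ℂR.+-comm (F (inject₁ j) (val x) k) ((μ • F (suc j) (val x)) k)) (dilation (suc j) x x₁ fl)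

        -- `remainder-bounded` speaks of the norm used to build 𝐅, whereas the contraction that
        -- governs the error has a norm of its own.
        bounded-in : ∀ N → let open Norm N in ∃[ c ] 0# ≤ c × ∀ x → ‖ remainder 0 x ‖ ≤ c
        bounded-in N =
          let (b , 0≤b , upper) = norm≤coordinates N
              (k , 0≤k , lower) = coordinates≤norm (Contraction.N contraction)
              (c , 0≤c , h) = remainder-bounded
          in b * (k * c) , 0≤* 0≤b (0≤* 0≤k 0≤c) , λ x → upper (remainder 0 x) (k * c)
            (λ i → RO.trans (lower (remainder 0 x) i) (*-monoˡ-≤ 0≤k (h x)))

        remainder≋ : ∀ K x → remainder K (val x) ≋ S A (lastVector V) K x -ᵛ 𝐀 μ (λ j x → F j (val x)) K x
        remainder≋ K x = -ᵛ-cong {w = binomialSum μ K (λ j → F j (val x))} (≋-sym (S≋ (lastVector V) K x)) ≋-refl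

        remainder-O : ∀ {lam′} → 0# < lam′ → Contraction A lam′ →
          UniformlyO (λ K x → remainder K (val x)) (λ K → lam′ ^ K)
        remainder-O {lam′} 0<lam′ contraction′ =
          UniformlyO-norm {g = λ K → lam′ ^ K} N remainder (c₀ * c) (λ K x → ≼⇒≤ {v = remainder K x}
            (homogeneous-bound remainder-homogeneous (0≤* 0≤c₀ 0≤c) start K x))
          where
          open Growth 0<lam′ contraction′
          open Adapted A 0<lam′ contraction′
          c₀ = proj₁ norm-≼
          0≤c₀ = proj₁ (proj₂ norm-≼)
          c = proj₁ (bounded-in N)
          0≤c = proj₁ (proj₂ (bounded-in N))
          start : ∀ x → remainder 0 x ≼ c₀ * c
          start x = ≼-mono {v = remainder 0 x} (*-monoˡ-≤ 0≤c₀ (proj₂ (proj₂ (bounded-in N)) x)) (proj₂ (proj₂ norm-≼) (remainder 0 x))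

        remainder-killed : ∀ {lam′} → lam′ ≈ 0# → Contraction A lam′ →
          ∃[ K₀ ] ∀ K → K₀ ℕ.≤ K → ∀ x → remainder K x ≋ 0ᵛ
        remainder-killed lam≈0 contraction′ = suc (Contraction.T contraction′) , λ K K₀≤K x →
          ≡.subst (λ n → remainder n x ≋ 0ᵛ) (ℕ.m+[n∸m]≡n K₀≤K)
            (vanishes remainder (IsHomogeneous.recursion remainder-homogeneous) (K ℕ.∸ suc (Contraction.T contraction′)) x)
          where open Nilpotent A lam≈0 contraction′ branch

        solved : Solved μ V
        solved = record
          { F = λ j x → F j (val x)
          ; solution = F-solution
          ; expansion = λ 0<lam′ contraction′ → UniformlyO-cong remainder≋ (remainder-O 0<lam′ contraction′)
          ; exact = λ lam≈0 contraction′ → let (K₀ , h) = remainder-killed lam≈0 contraction′ in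
              K₀ , λ K K₀≤K x → ≋-trans (≋-sym (remainder≋ K x)) (h K K₀≤K (val x))
          }

      abstract
        solve-chain : ∀ {μ} → λ⋆ < ∣ μ ∣ → (V : Fin ν → ℂ^ d) → (∀ j → Q ⊙ V j ≋ twist μ V j) → Solved μ V
        solve-chain λ⋆<μ V chain =
          let (lam , λ⋆<lam , lam<μ) = between λ⋆<μ
              (σ , lam<σ , σ<μ) = between lam<μ
          in solved (≤-<-trans (0≤λ⋆ A jsr) λ⋆<lam) lam<σ (jsr⇒contraction A jsr λ⋆<lam) σ<μ V chain

      module _ {μ : ℂ} {V : Fin ν → ℂ^ d} (chain : ∀ j → Q ⊙ V j ≋ twist μ V j) where

        module Bound {lam} (0<lam : 0# < lam) (contraction : Contraction A lam) (j : Fin ν) where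
          open Adapted A 0<lam contraction
          open Growth 0<lam contraction
          open Norm N

          private
            c₀ = proj₁ norm-≼
            0≤c₀ = proj₁ (proj₂ norm-≼)
            0≤lam = <⇒≤ 0<lam

          -- The inequality required by `partialSum-growth`, solved with equality, so that the
          -- scalar recurrences apply.
          sumBound : (ℕ → ℝ) → ℕ → ℝ
          sumBound q zero    = q 0
          sumBound q (suc K) = lam * sumBound q K + ofℕ B * (lam * q K)

          0≤sumBound : ∀ {q} → (∀ K → 0# ≤ q K) → ∀ K → 0# ≤ sumBound q K
          0≤sumBound 0≤q zero    = 0≤q 0
          0≤sumBound 0≤q (suc K) = 0≤+ (0≤* 0≤lam (0≤sumBound 0≤q K)) (0≤* (0≤ofℕ B) (0≤* 0≤lam (0≤q K)))

          partialSum-bound : ∀ (q : ℕ → ℝ) → (∀ K → 0# ≤ q K) → (∀ K → orbit chain N j K ≤ q K) →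
            ∀ {h : ℕ → ℝ} → (∃[ C ] 0# ≤ C × ∀ K → sumBound (λ K → c₀ * q K) K ≤ C * h K) →
            UniformlyO (λ K x → S A (V j) K x) h
          partialSum-bound q 0≤q orbit≤q {h} (C , 0≤C , bound) = UniformlyO-cong (λ K x → ≋-sym (S≋ (V j) K x))
            (UniformlyO-norm {g = h} N (partialSum (V j)) C (λ K x → RO.trans (≼⇒≤ {v = partialSum (V j) K x}
              (partialSum-growth (λ K → c₀ * q K) (sumBound (λ K → c₀ * q K)) 0≤c₀q (0≤sumBound 0≤c₀q)
                (λ K → ≼-mono {v = (Q ^ᴹ K) ⊙ V j} (*-monoˡ-≤ 0≤c₀ (orbit≤q K)) (proj₂ (proj₂ norm-≼) ((Q ^ᴹ K) ⊙ V j)))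
                RO.refl (λ K → RO.refl) K x)) (bound K)))
            where
            0≤c₀q : ∀ K → 0# ≤ c₀ * q K
            0≤c₀q K = 0≤* 0≤c₀ (0≤q K)

          private
            module _ {c : ℝ} (0≤c : 0# ≤ c) (h : ℕ → ℝ) (0≤h : ∀ K → 0# ≤ h K) where
              coefficient≥0 : 0# ≤ ofℕ B * (lam * (c₀ * c))
              coefficient≥0 = 0≤* (0≤ofℕ B) (0≤* 0≤lam (0≤* 0≤c₀ 0≤c))
              recurrence : ∀ K → sumBound (λ K → c₀ * (c * h K)) (suc K) ≤
                lam * sumBound (λ K → c₀ * (c * h K)) K + ofℕ B * (lam * (c₀ * c)) * h K
              recurrence K = RO.reflexive (R.+-congˡ (solve 5 (λ b l c e h → b :* (l :* (c :* (e :* h))) := b :* (l :* (c :* e)) :* h)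
                R.refl (ofℕ B) lam c₀ c (h K)))
              start≥0 : 0# ≤ c₀ * (c * h 0)
              start≥0 = 0≤* 0≤c₀ (0≤* 0≤c (0≤h 0))

          bound-> : ∀ {σ} → ∣ μ ∣ < σ → lam < σ → UniformlyO (λ K x → S A (V j) K x) (λ K → σ ^ K)
          bound-> {σ} μ<σ lam<σ = go (orbit-subexponential chain N μ<σ j)
            where
            0≤σ^ = 0≤^ (RO.trans 0≤lam (<⇒≤ lam<σ))
            go : ∃[ c ] 0# ≤ c × (∀ K → orbit chain N j K ≤ c * σ ^ K) → UniformlyO (λ K x → S A (V j) K x) (λ K → σ ^ K)
            go (c , 0≤c , h) = partialSum-bound (λ K → c * σ ^ K) (λ K → 0≤* 0≤c (0≤σ^ K)) h
              (recurrence-> 0≤lam lam<σ (coefficient≥0 0≤c (σ ^_) 0≤σ^) (sumBound (λ K → c₀ * (c * σ ^ K)))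
                (start≥0 0≤c (σ ^_) 0≤σ^) (recurrence 0≤c (σ ^_) 0≤σ^))

          -- A rate between ∣μ∣ and lam bounds the orbit of Q. The products then dominate, and lam^K
          -- is reached without a power of K.
          bound-< : ∣ μ ∣ < lam → UniformlyO (λ K x → S A (V j) K x) (λ K → lam ^ K)
          bound-< μ<lam = go (between μ<lam)
            where
            go : ∃[ σ ] ∣ μ ∣ < σ × σ < lam → UniformlyO (λ K x → S A (V j) K x) (λ K → lam ^ K)
            go (σ , μ<σ , σ<lam) = go′ (orbit-subexponential chain N μ<σ j)
              where
              0≤σ = RO.trans 0≤∣ μ ∣ (<⇒≤ μ<σ)
              0≤σ^ = 0≤^ 0≤σ
              go′ : ∃[ c ] 0# ≤ c × (∀ K → orbit chain N j K ≤ c * σ ^ K) → UniformlyO (λ K x → S A (V j) K x) (λ K → lam ^ K)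
              go′ (c , 0≤c , h) = partialSum-bound (λ K → c * σ ^ K) (λ K → 0≤* 0≤c (0≤σ^ K)) h
                (recurrence-< 0≤σ σ<lam (coefficient≥0 0≤c (σ ^_) 0≤σ^) (sumBound (λ K → c₀ * (c * σ ^ K)))
                  (start≥0 0≤c (σ ^_) 0≤σ^) (recurrence 0≤c (σ ^_) 0≤σ^))

          -- The orbit of Q contributes the power j, from the position in the chain; one more comes
          -- from the resonance of the orbit with the products A_w. Their sum j + 1 is the height.
          bound-≈ : ∣ μ ∣ ≈ lam → UniformlyO (λ K x → S A (V j) K x) (λ K → lam ^ K * ofℕ (suc K) ^ suc (toℕ j))
          bound-≈ μ≈lam = go (orbit-exact chain N (<-≤-trans 0<lam (RO.reflexive (R.sym μ≈lam))) j)
            where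
            f : ℕ → ℝ
            f K = lam ^ K * ofℕ (suc K) ^ toℕ j
            0≤f : ∀ K → 0# ≤ f K
            0≤f K = 0≤* (0≤^ 0≤lam K) (0≤^ (0≤ofℕ (suc K)) (toℕ j))
            go : ∃[ c ] 0# ≤ c × (∀ K → orbit chain N j K ≤ c * (∣ μ ∣ ^ K * ofℕ (suc K) ^ toℕ j)) →
              UniformlyO (λ K x → S A (V j) K x) (λ K → lam ^ K * ofℕ (suc K) ^ suc (toℕ j))
            go (c , 0≤c , h) = partialSum-bound (λ K → c * f K) (λ K → 0≤* 0≤c (0≤f K))
              (λ K → RO.trans (h K) (*-monoˡ-≤ 0≤c (*-monoʳ-≤ (0≤^ (0≤ofℕ (suc K)) (toℕ j)) (^-mono-≤ 0≤∣ μ ∣ (RO.reflexive μ≈lam) K))))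
              (recurrence-≈ 0<lam (coefficient≥0 0≤c f 0≤f) (toℕ j) (sumBound (λ K → c₀ * (c * f K)))
                (start≥0 0≤c f 0≤f) (recurrence 0≤c f 0≤f))

        -- A contraction rate strictly between λ⋆ and λ₁ exists even if λ⋆ is not attained, and λ₁
        -- exceeds both it and ∣μ∣. The case ∣μ∣ = λ⋆ thus needs no separate treatment.
        subordinate : ¬ λ⋆ < ∣ μ ∣ → ∀ {λ₁} → λ⋆ < λ₁ → ∀ j → UniformlyO (λ K x → S A (V j) K x) (λ K → λ₁ ^ K)
        subordinate μ≤λ⋆ {λ₁} λ⋆<λ₁ j =
          let (lam , λ⋆<lam , lam<λ₁) = between λ⋆<λ₁ in
          Bound.bound-> (≤-<-trans (0≤λ⋆ A jsr) λ⋆<lam) (jsr⇒contraction A jsr λ⋆<lam) j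
            (≤-<-trans (≮⇒≥ μ≤λ⋆) λ⋆<λ₁) lam<λ₁

        critical : 0# < λ⋆ → Contraction A λ⋆ → ∣ μ ∣ ≈ λ⋆ → ∀ {m} j → suc (toℕ j) ℕ.≤ m →
          UniformlyO (λ K x → S A (V j) K x) (λ K → λ⋆ ^ K * ofℕ K ^ m)
        critical 0<λ⋆ contraction μ≈λ⋆ {m} j j<m = UniformlyO-mono (2# ^ p) 1
          (λ K 1≤K → 0≤* (0≤^ (<⇒≤ 0<λ⋆) K) (0≤^ (0≤ofℕ (suc K)) p) , (begin
            λ⋆ ^ K * ofℕ (suc K) ^ p          ≤⟨ *-monoˡ-≤ (0≤^ (<⇒≤ 0<λ⋆) K) (ofℕ-suc-≤ 1≤K p) ⟩
            λ⋆ ^ K * (2# ^ p * ofℕ K ^ p)     ≤⟨ *-monoˡ-≤ (0≤^ (<⇒≤ 0<λ⋆) K) (*-monoˡ-≤ (0≤^ (<⇒≤ 0<2) p) (^-monoʳ-≤ (1≤ofℕ 1≤K) j<m)) ⟩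
            λ⋆ ^ K * (2# ^ p * ofℕ K ^ m)     ≈⟨ solve 3 (λ a b c → a :* (b :* c) := b :* (a :* c)) R.refl (λ⋆ ^ K) (2# ^ p) (ofℕ K ^ m) ⟩
            2# ^ p * (λ⋆ ^ K * ofℕ K ^ m)     ∎))
          (Bound.bound-≈ 0<λ⋆ contraction j μ≈λ⋆)
          where
          open ≤-Reasoning
          p = suc (toℕ j)

      UniformlyO-polynomial : 0# ≤ λ⋆ → ∀ m {E : ℕ → UnitInterval → ℂ^ d} → UniformlyO E (λ K → λ⋆ ^ K) →
        UniformlyO E (λ K → λ⋆ ^ K * ofℕ K ^ m)
      UniformlyO-polynomial 0≤λ⋆ m = UniformlyO-mono 1# 1 λ K 1≤K → 0≤^ 0≤λ⋆ K , (begin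
        λ⋆ ^ K                       ≈⟨ R.*-identityʳ _ ⟨
        λ⋆ ^ K * 1#                  ≤⟨ *-monoˡ-≤ (0≤^ 0≤λ⋆ K) (1≤^ (1≤ofℕ 1≤K) m) ⟩
        λ⋆ ^ K * ofℕ K ^ m           ≈⟨ R.*-identityˡ _ ⟨
        1# * (λ⋆ ^ K * ofℕ K ^ m)    ∎)
        where open ≤-Reasoning

  open Growth public

  -- Heights in a Jordan basis, and the terms of the expansion.

  module JordanBases where

    private
      variable
        d n m : ℕ

    module Span (b : Fin n → ℂ^ d) where

      InSpan-cong : ∀ {u v} → u ≋ v → InSpan b v → InSpan b u
      InSpan-cong p (a , q) = a , ≋-trans p q

      InSpan-basis : ∀ i → InSpan b (b i)
      InSpan-basis i = 1ᴹ i , λ x → ℂR.sym (⊙-1ᴹ (λ j → b j x) i)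

      InSpan-• : ∀ z {v} → InSpan b v → InSpan b (z • v)
      InSpan-• z (a , q) = (λ j → z *ᶜ a j) , ≋-trans (•-congˡ z q)
        (≋-trans (≋-sym (∑-• z (λ j → a j • b j))) (∑-cong (λ j → •-assoc z (a j) (b j))))

      InSpan-+ : ∀ {u v} → InSpan b u → InSpan b v → InSpan b (u +ᵛ v)
      InSpan-+ (a , p) (a′ , q) = (λ j → a j +ᶜ a′ j) , ≋-trans (+ᵛ-cong p q)
        (≋-trans (≋-sym (∑-+ (λ j → a j • b j) (λ j → a′ j • b j))) (∑-cong (λ j i → ℂR.sym (ℂR.distribʳ (b j i) (a j) (a′ j)))))

      InSpan-0 : InSpan b 0ᵛ
      InSpan-0 = (λ _ → 0ᶜ) , ≋-sym (∑-zero (λ j → •-zeroˡ (b j)))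

      InSpan-∑ : ∀ (f : Fin m → ℂ^ d) → (∀ j → InSpan b (f j)) → InSpan b (∑ f)
      InSpan-∑ {m = zero}  f h = InSpan-0
      InSpan-∑ {m = suc m} f h = InSpan-+ {u = f zero} {v = ∑ (f ∘ suc)} (h zero) (InSpan-∑ (f ∘ suc) (h ∘ suc))

    module _ {Q : Matrix d} where

      orbitFamily : ℂ^ d → Fin n → ℂ^ d
      orbitFamily v k = (Q ^ᴹ toℕ k) ⊙ v

      Cyclic-self : ∀ v → Cyclic Q v v
      Cyclic-self v = 1 , InSpan-cong {v = 1ᴹ ⊙ v} (≋-sym (⊙-1ᴹ v)) (InSpan-basis zero)
        where open Span {n = 1} (orbitFamily v)

      -- On a chain, Q - μ maps each vector to its predecessor; the whole chain is reached in this
      -- way from its last vector.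
      Cyclic-shift : ∀ μ v u → Cyclic Q v u → Cyclic Q v (Q ⊙ u -ᵛ μ • u)
      Cyclic-shift μ v u (n , a , p) = suc n , InSpan-cong {v = Q ⊙ u +ᵛ (-ᶜ 1ᶜ) • μ • u} (-ᵛ-as-+ (Q ⊙ u) (μ • u))
        (InSpan-+ {u = Q ⊙ u} {v = (-ᶜ 1ᶜ) • μ • u} image (InSpan-• (-ᶜ 1ᶜ) {v = μ • u} (InSpan-• μ {v = u} self)))
        where
        open Span {n = suc n} (orbitFamily v)
        lift : ∀ k → InSpan {n = suc n} (orbitFamily v) (orbitFamily {n} v k)
        lift k = ≡.subst (λ l → InSpan {n = suc n} (orbitFamily v) ((Q ^ᴹ l) ⊙ v)) (Fin.toℕ-inject₁ k) (InSpan-basis (inject₁ k))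
        self : InSpan {n = suc n} (orbitFamily v) u
        self = InSpan-cong {v = ∑ (λ k → a k • orbitFamily v k)} p
          (InSpan-∑ (λ k → a k • orbitFamily v k) λ k → InSpan-• (a k) {v = orbitFamily v k} (lift k))
        image : InSpan {n = suc n} (orbitFamily v) (Q ⊙ u)
        image = InSpan-cong {v = ∑ (λ k → Q ⊙ (a k • orbitFamily v k))} (≋-trans (⊙-cong Q p) (⊙-∑ Q (λ k → a k • orbitFamily v k)))
          (InSpan-∑ (λ k → Q ⊙ (a k • orbitFamily v k)) λ k →
            InSpan-cong {v = a k • ((Q ^ᴹ suc (toℕ k)) ⊙ v)}
              (≋-trans (⊙-• Q (a k) (orbitFamily v k)) (•-congˡ (a k) (≋-sym (⊙-⊡ Q (Q ^ᴹ toℕ k) v))))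
              (InSpan-• (a k) {v = (Q ^ᴹ suc (toℕ k)) ⊙ v} (InSpan-basis (suc k))))

      module _ {μ : ℂ} (X : Fin (suc n) → ℂ^ d) (chain : ∀ j → Q ⊙ X j ≋ twist μ X j) where
        open Span X

        InSpan-invariant : ∀ u K → InSpan X u → InSpan X ((Q ^ᴹ K) ⊙ u)
        InSpan-invariant u zero h = InSpan-cong {v = u} (⊙-1ᴹ u) h
        InSpan-invariant u (suc K) h = InSpan-cong {v = Q ⊙ ((Q ^ᴹ K) ⊙ u)} (⊙-⊡ Q (Q ^ᴹ K) u) (stable ((Q ^ᴹ K) ⊙ u) (InSpan-invariant u K h))
          where
          previous-in : ∀ j → InSpan X (previous 0ᵛ X j)
          previous-in zero    = InSpan-0
          previous-in (suc j) = InSpan-basis (inject₁ j)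
          stable : ∀ u → InSpan X u → InSpan X (Q ⊙ u)
          stable u (a , p) = InSpan-cong {v = ∑ (λ j → Q ⊙ (a j • X j))} (≋-trans (⊙-cong Q p) (⊙-∑ Q (λ j → a j • X j)))
            (InSpan-∑ (λ j → Q ⊙ (a j • X j)) λ j →
              InSpan-cong {v = a j • twist μ X j} (≋-trans (⊙-• Q (a j) (X j)) (•-congˡ (a j) (chain j))) (InSpan-• (a j) {v = twist μ X j}
                (InSpan-+ {u = μ • X j} {v = previous 0ᵛ X j} (InSpan-• μ {v = X j} (InSpan-basis j)) (previous-in j))))

        -- The chain itself is a basis of the cyclic subspace of its last vector: its span is
        -- invariant under Q, and Q - μ descends to all its members. Heights, as in the definition
        -- of m, thereby become positions in chains.
        chain-height : LinearlyIndependent X → HasHeight Q (X (fromℕ n)) (suc n)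
        chain-height independent = X , in-cyclic , independent , λ u (k , a , p) →
          InSpan-cong {v = ∑ (λ l → a l • orbitFamily top l)} p (InSpan-∑ (λ l → a l • orbitFamily top l) λ l →
            InSpan-• (a l) {v = orbitFamily top l} (InSpan-invariant top (toℕ l) (InSpan-basis (fromℕ n))))
          where
          top = X (fromℕ n)
          lower : ∀ i → X (inject₁ i) ≋ Q ⊙ X (suc i) -ᵛ μ • X (suc i)
          lower i x = ℂR.sym (ℂR.trans (ℂR.+-congʳ (chain (suc i) x))
            (ℂS.solve 2 (λ a b → (a ℂS.:+ b) ℂS.:- a ℂS.:= b) ℂR.refl ((μ • X (suc i)) x) (X (inject₁ i) x)))
          in-cyclic : ∀ j → Cyclic Q top (X j)
          in-cyclic = >-weakInduction (λ j → Cyclic Q top (X j)) (Cyclic-self top) λ i h →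
            descend i (Cyclic-shift μ top (X (suc i)) h)
            where
            descend : ∀ i → Cyclic Q top (Q ⊙ X (suc i) -ᵛ μ • X (suc i)) → Cyclic Q top (X (inject₁ i))
            descend i (k , a , p) = k , a , ≋-trans (lower i) p

    ∑-truncate : ∀ (n≤m : n ℕ.≤ m) (f : Fin m → ℂ^ d) → (∀ i → n ℕ.≤ toℕ i → f i ≋ 0ᵛ) →
      ∑ f ≋ ∑ (λ (i : Fin n) → f (inject≤ i n≤m))
    ∑-truncate ℕ.z≤n f h = ∑-zero (λ i → h i ℕ.z≤n)
    ∑-truncate (ℕ.s≤s n≤m) f h = +ᵛ-cong {u = f zero} ≋-refl (∑-truncate n≤m (f ∘ suc) (λ i p → h (suc i) (ℕ.s≤s p)))

    module _ {Q : Matrix d} (𝒱 : JordanBasis Q) where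
      open JordanBasis 𝒱

      module _ (k : Fin chains) (j : Fin (ν k)) where
        private
          h : ℕ
          h = suc (toℕ j)

        associated-chain : IsJordanChain Q (μ k) (associated k j)
        associated-chain = record
          { base = λ i i≡0 → IsJordanChain.base (isChain k) _ (≡.trans (Fin.toℕ-inject≤ i (Fin.toℕ<n j)) i≡0)
          ; step = λ i i′ eq → IsJordanChain.step (isChain k) _ _ (≡.trans (Fin.toℕ-inject≤ i′ (Fin.toℕ<n j))
              (≡.trans eq (≡.cong suc (≡.sym (Fin.toℕ-inject≤ i (Fin.toℕ<n j))))))
          }

        associated-last : associated k j (fromℕ (toℕ j)) ≡ V k j
        associated-last = ≡.cong (V k) (Fin.toℕ-injective (≡.trans (Fin.toℕ-inject≤ (fromℕ (toℕ j)) (Fin.toℕ<n j)) (Fin.toℕ-fromℕ (toℕ j))))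

        private
          -- Extension by 0 to coefficients on the whole basis, for which `JordanBasis` provides
          -- independence.
          extend : (Fin h → ℂ) → (k′ : Fin chains) → Fin (ν k′) → ℂ
          extend a k′ i with k′ Fin.≟ k | toℕ i ℕ.<? h
          ... | yes _ | yes p = a (fromℕ< p)
          ... | yes _ | no  _ = 0ᶜ
          ... | no  _ | _     = 0ᶜ

          extend-≢ : ∀ a k′ i → ¬ k′ ≡ k → extend a k′ i ≈ᶜ 0ᶜ
          extend-≢ a k′ i k′≢k with k′ Fin.≟ k | toℕ i ℕ.<? h
          ... | yes eq | _ = ⊥-elim (k′≢k eq)
          ... | no  _  | _ = ℂR.refl

          extend-≥ : ∀ a k′ i → h ℕ.≤ toℕ i → extend a k′ i ≈ᶜ 0ᶜ
          extend-≥ a k′ i h≤i with k′ Fin.≟ k | toℕ i ℕ.<? h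
          ... | yes _ | yes p = ⊥-elim (ℕ.<⇒≱ p h≤i)
          ... | yes _ | no  _ = ℂR.refl
          ... | no  _ | _     = ℂR.refl

          extend-inject : ∀ a i → extend a k (inject≤ i (Fin.toℕ<n j)) ≈ᶜ a i
          extend-inject a i with k Fin.≟ k | toℕ (inject≤ i (Fin.toℕ<n j)) ℕ.<? h
          ... | no  k≢k | _     = ⊥-elim (k≢k ≡.refl)
          ... | yes _   | no ≮h = ⊥-elim (≮h (≡.subst (ℕ._< h) (≡.sym (Fin.toℕ-inject≤ i (Fin.toℕ<n j))) (Fin.toℕ<n i)))
          ... | yes _   | yes p = ℂR.reflexive (≡.cong a (Fin.toℕ-injective
            (≡.trans (Fin.toℕ-fromℕ< p) (Fin.toℕ-inject≤ i (Fin.toℕ<n j)))))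

        associated-independent : LinearlyIndependent (associated k j)
        associated-independent a p i = ℂR.trans (ℂR.sym (extend-inject a i))
          (independent (extend a) total k (inject≤ i (Fin.toℕ<n j)))
          where
          row : (k′ : Fin chains) → ℂ^ d
          row k′ = ∑ (λ i → extend a k′ i • V k′ i)
          row-≢ : ∀ k′ → ¬ k′ ≡ k → row k′ ≋ 0ᵛ
          row-≢ k′ k′≢k = ∑-zero (λ i → ≋-trans (•-cong {u = V k′ i} (extend-≢ a k′ i k′≢k) ≋-refl) (•-zeroˡ (V k′ i)))
          total : ∑∑ ν (λ k j → extend a k j • V k j) ≋ 0ᵛ
          total = begin
            ∑ row                                                           ≈⟨ ∑-split row (λ _ → 0ᵛ) k
              (λ r r<k → row-≢ r (λ eq → ℕ.<-irrefl (≡.cong toℕ eq) r<k))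
              (λ r k<r → row-≢ r (λ eq → ℕ.<-irrefl (≡.cong toℕ (≡.sym eq)) k<r)) ⟩
            ∑ (λ (_ : Fin (toℕ k)) → 0ᵛ) +ᵛ row k                           ≈⟨ +ᵛ-cong (∑-zero {n = toℕ k} (λ _ → ≋-refl)) (≋-refl {v = row k}) ⟩
            0ᵛ +ᵛ row k                                                     ≈⟨ 0ᵛ-identityˡ (row k) ⟩
            row k                                                           ≈⟨ ∑-truncate (Fin.toℕ<n j) (λ i → extend a k i • V k i)
              (λ i h≤i → ≋-trans (•-cong {u = V k i} (extend-≥ a k i h≤i) ≋-refl) (•-zeroˡ (V k i))) ⟩
            ∑ (λ i → extend a k (inject≤ i (Fin.toℕ<n j)) • associated k j i) ≈⟨ ∑-cong (λ i → •-cong {u = associated k j i} (extend-inject a i) ≋-refl) ⟩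
            ∑ (λ i → a i • associated k j i)                                ≈⟨ p ⟩
            0ᵛ                                                              ∎
            where open ≋-Reasoning

        basis-height : HasHeight Q (V k j) h
        basis-height = ≡.subst (λ v → HasHeight Q v h) associated-last
          (chain-height (associated k j) (jordan⇒twist associated-chain) associated-independent)

    module Expᶜ = SemiringExp ℂR.semiring
    module CExpᶜ = CommutativeSemiringExp ℂR.commutativeSemiring

    ofℝ-* : ∀ x y → ofℝ (x * y) ≈ᶜ (ofℝ x *ᶜ ofℝ y)
    ofℝ-* x y = solve 2 (λ x y → x :* y := x :* y :- :0 :* :0) R.refl x y , solve 2 (λ x y → :0 := x :* :0 :+ :0 :* y) R.refl x y

    ofℝ-^ : ∀ x n → ofℝ (x ^ n) ≈ᶜ (ofℝ x ^ᶜ n)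
    ofℝ-^ x zero    = ℂR.refl
    ofℝ-^ x (suc n) = ℂR.trans (ofℝ-* x (x ^ n)) (ℂR.*-congˡ (ofℝ-^ x n))

    ×ᶜ-ofℝ : ∀ n z → (n ×ᶜ z) ≈ᶜ (ofℝ (ofℕ n) *ᶜ z)
    ×ᶜ-ofℝ zero z = ℂR.sym (ℂR.zeroˡ z)
    ×ᶜ-ofℝ (suc n) z = ℂR.trans (ℂR.+-cong (ℂR.sym (ℂR.*-identityˡ z)) (×ᶜ-ofℝ n z))
      (ℂR.trans (ℂR.sym (ℂR.distribʳ z 1ᶜ (ofℝ (ofℕ n)))) (ℂR.*-congʳ (R.refl , R.+-identityˡ 0#)))

    1ᶜ^ : ∀ n → (1ᶜ ^ᶜ n) ≈ᶜ 1ᶜ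
    1ᶜ^ zero    = ℂR.refl
    1ᶜ^ (suc n) = ℂR.trans (ℂR.*-identityˡ (1ᶜ ^ᶜ n)) (1ᶜ^ n)

    Continuous-• : ∀ z {F : UnitInterval → ℂ^ d} → Continuous F → Continuous (λ x → z • F x)
    Continuous-• z {F} cont x ε 0<ε = δ , 0<δ , λ y close i → begin-strict
      ∣ (z *ᶜ F y i) +ᶜ -ᶜ (z *ᶜ F x i) ∣      ≈⟨ ∣∣ᶜ-cong (ℂS.solve 3 (λ z a b → z ℂS.:* a ℂS.:- z ℂS.:* b ℂS.:= z ℂS.:* (a ℂS.:- b)) ℂR.refl z (F y i) (F x i)) ⟩
      ∣ z *ᶜ (F y -ᵛ F x) i ∣                  ≈⟨ ∣∣-* z ((F y -ᵛ F x) i) ⟩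
      ∣ z ∣ * ∣ (F y -ᵛ F x) i ∣               ≤⟨ *-monoʳ-≤ 0≤∣ (F y -ᵛ F x) i ∣ (≤-by 0≤1 (solve 1 (λ z → (:1 :+ z) :- z := :1) R.refl ∣ z ∣)) ⟩
      e * ∣ (F y -ᵛ F x) i ∣                   <⟨ *-mono-< 0<e (h y close i) ⟩
      e * (e ⁻¹ * ε)                           ≈⟨ R.*-assoc _ _ _ ⟨
      e * e ⁻¹ * ε                             ≈⟨ R.*-congʳ (⁻¹-inverseʳ 0<e) ⟩
      1# * ε                                   ≈⟨ R.*-identityˡ ε ⟩
      ε                                        ∎
      where
      open ≤-Reasoning
      e = 1# + ∣ z ∣
      0<e = 0<+ 0<1 0≤∣ z ∣
      modulus = cont x (e ⁻¹ * ε) (0<* (0<⁻¹ 0<e) 0<ε)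
      δ = proj₁ modulus
      0<δ = proj₁ (proj₂ modulus)
      h = proj₂ (proj₂ modulus)

    •-exchange : ∀ a b a′ b′ (v : ℂ^ d) → (a *ᶜ b) ≈ᶜ (a′ *ᶜ b′) → a • b • v ≋ a′ • b′ • v
    •-exchange a b a′ b′ v p = ≋-trans (•-assoc a b v) (≋-trans (•-cong {u = v} p ≋-refl) (≋-sym (•-assoc a′ b′ v)))

    module _ {μ : ℂ} (0<μ : 0# < ∣ μ ∣) (γ : ℂ) (F : Fin n → UnitInterval → ℂ^ d) (continuous : ∀ j → Continuous (F j)) where

      private
        ω = ofℝ (∣ μ ∣ ⁻¹) *ᶜ μ

      -- For ℓ ≤ K one has μ^(K-ℓ) = ρ^K ω^K μ^(-ℓ) with ρ = ∣μ∣ and ω = μ/ρ. The factors γ and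
      -- μ^(-ℓ) do not depend on K and go into G.
      expansionTerm : Fin n → ExpansionTerm d
      expansionTerm l = record
        { ρ = ∣ μ ∣
        ; ω = ω
        ; l = toℕ l
        ; G = λ x → (γ *ᶜ μ ⁻¹ᶜ ^ᶜ toℕ l) • F (opposite l) x
        ; ρ-positive = 0<μ
        ; ω-unit = R.trans (∣∣-* (ofℝ (∣ μ ∣ ⁻¹)) μ) (R.trans (R.*-congʳ (∣ofℝ∣ (0≤⁻¹ 0<μ))) (⁻¹-inverseˡ 0<μ))
        ; G-continuous = Continuous-• (γ *ᶜ μ ⁻¹ᶜ ^ᶜ toℕ l) (continuous (opposite l))
        }

      private
        ρ^Kω^K : ∀ K → (ofℝ (∣ μ ∣ ^ K) *ᶜ ω ^ᶜ K) ≈ᶜ (μ ^ᶜ K)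
        ρ^Kω^K K = begin
          ofℝ (∣ μ ∣ ^ K) *ᶜ ω ^ᶜ K           ≈⟨ ℂR.*-congʳ {ω ^ᶜ K} (ofℝ-^ ∣ μ ∣ K) ⟩
          ofℝ ∣ μ ∣ ^ᶜ K *ᶜ ω ^ᶜ K            ≈⟨ CExpᶜ.^-distrib-* (ofℝ ∣ μ ∣) ω K ⟨
          (ofℝ ∣ μ ∣ *ᶜ ω) ^ᶜ K               ≈⟨ Expᶜ.^-congˡ K ρω ⟩
          μ ^ᶜ K                              ∎
          where
          open import Relation.Binary.Reasoning.Setoid ℂ-setoid
          ρω : (ofℝ ∣ μ ∣ *ᶜ ω) ≈ᶜ μ
          ρω = ℂR.trans (ℂR.sym (ℂR.*-assoc (ofℝ ∣ μ ∣) (ofℝ (∣ μ ∣ ⁻¹)) μ)) (ℂR.trans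
            (ℂR.*-congʳ (ℂR.trans (ℂR.sym (ofℝ-* ∣ μ ∣ (∣ μ ∣ ⁻¹))) (⁻¹-inverseʳ 0<μ , R.refl))) (ℂR.*-identityˡ μ))

        μ^∸ : ∀ {K l} → l ℕ.≤ K → ((μ ^ᶜ K) *ᶜ μ ⁻¹ᶜ ^ᶜ l) ≈ᶜ (μ ^ᶜ (K ∸ l))
        μ^∸ {K} {l} l≤K = begin
          (μ ^ᶜ K) *ᶜ (ι ^ᶜ l)                             ≈⟨ ℂR.*-congʳ {ι ^ᶜ l} (ℂR.reflexive (≡.cong (μ ^ᶜ_) (≡.sym (ℕ.m∸n+n≡m l≤K)))) ⟩
          (μ ^ᶜ (K ∸ l ℕ.+ l)) *ᶜ (ι ^ᶜ l)                 ≈⟨ ℂR.*-congʳ {ι ^ᶜ l} (Expᶜ.^-homo-* μ (K ∸ l) l) ⟩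
          ((μ ^ᶜ (K ∸ l)) *ᶜ (μ ^ᶜ l)) *ᶜ (ι ^ᶜ l)         ≈⟨ ℂR.*-assoc (μ ^ᶜ (K ∸ l)) (μ ^ᶜ l) (ι ^ᶜ l) ⟩
          (μ ^ᶜ (K ∸ l)) *ᶜ ((μ ^ᶜ l) *ᶜ (ι ^ᶜ l))         ≈⟨ ℂR.*-congˡ {μ ^ᶜ (K ∸ l)} (CExpᶜ.^-distrib-* μ ι l) ⟨
          (μ ^ᶜ (K ∸ l)) *ᶜ ((μ *ᶜ ι) ^ᶜ l)                ≈⟨ ℂR.*-congˡ {μ ^ᶜ (K ∸ l)} (ℂR.trans (Expᶜ.^-congˡ l (⁻¹ᶜ-inverse 0<μ)) (1ᶜ^ l)) ⟩
          (μ ^ᶜ (K ∸ l)) *ᶜ 1ᶜ                             ≈⟨ ℂR.*-identityʳ (μ ^ᶜ (K ∸ l)) ⟩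
          μ ^ᶜ (K ∸ l)                                     ∎
          where
          open import Relation.Binary.Reasoning.Setoid ℂ-setoid
          ι = μ ⁻¹ᶜ

        scalar : ∀ K l → ((ofℝ (∣ μ ∣ ^ K * ofℕ (K choose l)) *ᶜ ω ^ᶜ K) *ᶜ (γ *ᶜ μ ⁻¹ᶜ ^ᶜ l)) ≈ᶜ (γ *ᶜ coefficient μ K l)
        scalar K l = begin
          (ofℝ (∣ μ ∣ ^ K * ofℕ (K choose l)) *ᶜ w) *ᶜ (γ *ᶜ ι)           ≈⟨ ℂR.*-congʳ {γ *ᶜ ι} (ℂR.*-congʳ {w} (ofℝ-* (∣ μ ∣ ^ K) (ofℕ (K choose l)))) ⟩
          ((p *ᶜ c) *ᶜ w) *ᶜ (γ *ᶜ ι)                                ≈⟨ ℂS.solve 5 (λ p c w g i → p ℂS.:* c ℂS.:* w ℂS.:* (g ℂS.:* i) ℂS.:=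
                                                                          g ℂS.:* (c ℂS.:* (p ℂS.:* w ℂS.:* i))) ℂR.refl p c w γ ι ⟩
          γ *ᶜ (c *ᶜ ((p *ᶜ w) *ᶜ ι))                                ≈⟨ ℂR.*-congˡ {γ} (ℂR.*-congˡ {c} (ℂR.*-congʳ {ι} (ρ^Kω^K K))) ⟩
          γ *ᶜ (c *ᶜ ((μ ^ᶜ K) *ᶜ ι))                                ≈⟨ ℂR.*-congˡ {γ} (ℂR.sym (×ᶜ-ofℝ (K choose l) ((μ ^ᶜ K) *ᶜ ι))) ⟩
          γ *ᶜ ((K choose l) ×ᶜ ((μ ^ᶜ K) *ᶜ ι))                          ≈⟨ ℂR.*-congˡ {γ} tail ⟩
          γ *ᶜ coefficient μ K l                                     ∎
          where
          open import Relation.Binary.Reasoning.Setoid ℂ-setoid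
          p = ofℝ (∣ μ ∣ ^ K)
          c = ofℝ (ofℕ (K choose l))
          w = ω ^ᶜ K
          ι = μ ⁻¹ᶜ ^ᶜ l
          tail : ((K choose l) ×ᶜ ((μ ^ᶜ K) *ᶜ ι)) ≈ᶜ coefficient μ K l
          tail with ℕ.≤-<-connex l K
          ... | inj₁ l≤K = Multᶜ.×-congʳ (K choose l) (μ^∸ l≤K)
          -- The exponents do not match here, but both sides have the factor K choose l = 0.
          ... | inj₂ K<l = ℂR.trans (Multᶜ.×-congˡ {(μ ^ᶜ K) *ᶜ ι} (k>n⇒nCk≡0 K<l))
            (ℂR.sym (Multᶜ.×-congˡ {μ ^ᶜ (K ∸ l)} (k>n⇒nCk≡0 K<l)))

        term≋ : ∀ K x l → ExpansionTerm.value (expansionTerm l) K x ≋ γ • (coefficient μ K (toℕ l) • F (opposite l) x)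
        term≋ K x l = •-exchange (ofℝ (∣ μ ∣ ^ K * ofℕ (K choose toℕ l)) *ᶜ ω ^ᶜ K) (γ *ᶜ μ ⁻¹ᶜ ^ᶜ toℕ l) γ (coefficient μ K (toℕ l))
          (F (opposite l) x) (scalar K (toℕ l))

      expansionTerm-sum : ∀ K x → ∑ (λ l → ExpansionTerm.value (expansionTerm l) K x) ≋ γ • 𝐀 μ F K x
      expansionTerm-sum K x = ≋-trans (∑-cong (term≋ K x)) (∑-• γ (λ l → coefficient μ K (toℕ l) • F (opposite l) x))

    ∑ᴸ-tabulate : ∀ {X : Set} (f : X → ℂ^ d) (h : Fin n → X) → ∑ᴸ f (List.tabulate h) ≋ ∑ (f ∘ h)
    ∑ᴸ-tabulate {n = zero}  f h = ≋-refl
    ∑ᴸ-tabulate {n = suc n} f h = +ᵛ-cong {u = f (h zero)} ≋-refl (∑ᴸ-tabulate f (h ∘ suc))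

    ∑ᴸ-concat : ∀ {X : Set} (f : X → ℂ^ d) (h : Fin n → List X) →
      ∑ᴸ f (List.concat (List.tabulate h)) ≋ ∑ (λ j → ∑ᴸ f (h j))
    ∑ᴸ-concat {n = zero}  f h = ≋-refl
    ∑ᴸ-concat {n = suc n} f h = ≋-trans (∑ᴸ-++ f (h zero) (List.concat (List.tabulate (h ∘ suc))))
      (+ᵛ-cong {u = ∑ᴸ f (h zero)} ≋-refl (∑ᴸ-concat f (h ∘ suc)))

  open JordanBases public

  -- Assembly: single chains for (a), sums over a Jordan basis for (b) and (c).

  height-positive : ∀ {d} (Q : Matrix d) v → ¬ v ≋ 0ᵛ → ¬ HasHeight Q v 0
  height-positive Q v v≉0 (b , _ , _ , spans) = v≉0 (proj₂ (spans v (Cyclic-self {Q = Q} v)))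

  module _ {B d : ℕ} (2≤B : 2 ℕ.≤ B) (A : Fin B → Matrix d) {λ⋆ : ℝ} (jsr : IsJointSpectralRadius A λ⋆) where
    open Summation 2≤B A using (partialSum; partialSum-cong; partialSum-•; partialSum-∑)
    open Dilation 2≤B A using (dilation-unique)
    open Asymptotics 2≤B A jsr

    private
      Q = ∑ᴹ A

    S-cong : ∀ {u v} → u ≋ v → ∀ K x → S A u K x ≋ S A v K x
    S-cong {u} {v} p K x = ≋-trans (S≋ u K x) (≋-trans (partialSum-cong K p R.refl) (≋-sym (S≋ v K x)))

    S-∑ : ∀ {n} (f : Fin n → ℂ^ d) K x → S A (∑ f) K x ≋ ∑ (λ j → S A (f j) K x)
    S-∑ f K x = ≋-trans (S≋ (∑ f) K x) (≋-trans (partialSum-∑ f K (val x)) (∑-cong (λ j → ≋-sym (S≋ (f j) K x))))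

    S-• : ∀ z v K x → S A (z • v) K x ≋ z • S A v K x
    S-• z v K x = ≋-trans (S≋ (z • v) K x) (≋-trans (partialSum-• z v K (val x)) (•-congˡ z (≋-sym (S≋ v K x))))

    positive : ∀ {x} → λ⋆ < x → 0# < x
    positive = ≤-<-trans (0≤λ⋆ A jsr)

    solution-of-chain : ∀ {ν μ} → λ⋆ < ∣ μ ∣ → (V : ℂ^ d) (Vs : Fin ν → ℂ^ d) → (∀ j → Q ⊙ Vs j ≋ twist μ Vs j) → lastVector Vs ≋ V →
      (∀ K → (Q ^ᴹ K) ⊙ V ≋ binomialSum μ K Vs) ×
      (Σ[ F ∈ (Fin ν → UnitInterval → ℂ^ d) ]
        IsDilationSolution A μ Vs F ×
        (∀ G → IsDilationSolution A μ Vs G → ∀ j x → G j x ≋ F j x) ×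
        (∀ λ₁ → λ⋆ < λ₁ → UniformlyO (λ K x → S A V K x -ᵛ 𝐀 μ F K x) (λ K → λ₁ ^ K)))
    solution-of-chain {ν} {μ} λ⋆<μ V Vs chain last≋V = power , go (solve-chain λ⋆<μ Vs chain)
      where
      power : ∀ K → (Q ^ᴹ K) ⊙ V ≋ binomialSum μ K Vs
      power K = ≋-trans (⊙-cong (Q ^ᴹ K) (≋-sym last≋V)) (power-on-chain Q Vs chain K)
      go : Solved μ Vs → _
      go solved = F , solution , (λ G solG → dilation-unique (positive λ⋆<μ) solG solution) , λ λ₁ λ⋆<λ₁ →
        UniformlyO-cong (λ K x → -ᵛ-cong {w = 𝐀 μ F K x} (S-cong last≋V K x) ≋-refl)
          (expansion (positive λ⋆<λ₁) (jsr⇒contraction A jsr λ⋆<λ₁))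
        where open Solved solved

    module _ (𝒱 : JordanBasis Q) where
      open JordanBasis 𝒱

      module _ (γ : (k : Fin chains) → Fin (ν k) → ℂ) where

        contribution : ((k : Fin chains) → Fin (ν k) → ℕ → UnitInterval → ℂ^ d) → (k : Fin chains) → Fin (ν k) → ℕ → UnitInterval → ℂ^ d
        contribution W k j K x = γ k j • S A (V k j) K x -ᵛ W k j K x

        -- The part W that is subtracted is left open: it is `dominantPart` for the error terms of
        -- (b) and (c), and a sum of expansion terms for the asymptotic scale.
        error-sum : ∀ {v} → v ≋ ∑∑ ν (λ k j → γ k j • V k j) → ∀ W {g} →
          (∀ k j → UniformlyO (contribution W k j) g) →
          UniformlyO (λ K x → S A v K x -ᵛ ∑∑ ν (λ k j → W k j K x)) g
        error-sum {v} v≋ W {g} h = UniformlyO-cong decomposition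
          (UniformlyO-∑ (λ k K x → ∑ (λ j → contribution W k j K x)) (λ k → UniformlyO-∑ (contribution W k) (h k)))
          where
          decomposition : ∀ K x → ∑ (λ k → ∑ (λ j → contribution W k j K x)) ≋ S A v K x -ᵛ ∑∑ ν (λ k j → W k j K x)
          decomposition K x = begin
            ∑ (λ k → ∑ (λ j → contribution W k j K x))
              ≈⟨ ∑-cong (λ k → ∑-- (λ j → γ k j • S A (V k j) K x) (λ j → W k j K x)) ⟩
            ∑ (λ k → ∑ (λ j → γ k j • S A (V k j) K x) -ᵛ ∑ (λ j → W k j K x))
              ≈⟨ ∑-- (λ k → ∑ (λ j → γ k j • S A (V k j) K x)) (λ k → ∑ (λ j → W k j K x)) ⟩
            ∑∑ ν (λ k j → γ k j • S A (V k j) K x) -ᵛ ∑∑ ν (λ k j → W k j K x)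
              ≈⟨ -ᵛ-cong {w = ∑∑ ν (λ k j → W k j K x)} (∑-cong (λ k → ∑-cong (λ j → ≋-sym (S-• (γ k j) (V k j) K x)))) ≋-refl ⟩
            ∑∑ ν (λ k j → S A (γ k j • V k j) K x) -ᵛ ∑∑ ν (λ k j → W k j K x)
              ≈⟨ -ᵛ-cong {w = ∑∑ ν (λ k j → W k j K x)} (∑-cong (λ k → ≋-sym (S-∑ (λ j → γ k j • V k j) K x))) ≋-refl ⟩
            ∑ (λ k → S A (∑ (λ j → γ k j • V k j)) K x) -ᵛ ∑∑ ν (λ k j → W k j K x)
              ≈⟨ -ᵛ-cong {w = ∑∑ ν (λ k j → W k j K x)} (≋-sym (S-∑ (λ k → ∑ (λ j → γ k j • V k j)) K x)) ≋-refl ⟩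
            S A (∑∑ ν (λ k j → γ k j • V k j)) K x -ᵛ ∑∑ ν (λ k j → W k j K x)
              ≈⟨ -ᵛ-cong {w = ∑∑ ν (λ k j → W k j K x)} (S-cong (≋-sym v≋) K x) ≋-refl ⟩
            S A v K x -ᵛ ∑∑ ν (λ k j → W k j K x) ∎
            where open ≋-Reasoning

        dominant-solved : ∀ k j → λ⋆ < ∣ μ k ∣ → Solved (μ k) (associated k j)
        dominant-solved k j λ⋆<μ = solve-chain λ⋆<μ (associated k j) (jordan⇒twist (associated-chain 𝒱 k j))

        dominant≋ : ∀ W k j (F : Fin (suc (toℕ j)) → UnitInterval → ℂ^ d) →
          (∀ K x → W k j K x ≋ γ k j • 𝐀 (μ k) F K x) → ∀ K x →
          γ k j • (S A (lastVector (associated k j)) K x -ᵛ 𝐀 (μ k) F K x) ≋ contribution W k j K x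
        dominant≋ W k j F W≋ K x = begin
          γ k j • (S A (lastVector (associated k j)) K x -ᵛ 𝐀 (μ k) F K x)
            ≈⟨ •-congˡ (γ k j) (-ᵛ-cong {w = 𝐀 (μ k) F K x} (λ i → ℂR.reflexive (≡.cong (λ v → S A v K x i) (associated-last 𝒱 k j))) ≋-refl) ⟩
          γ k j • (S A (V k j) K x -ᵛ 𝐀 (μ k) F K x)
            ≈⟨ (λ i → ℂS.solve 3 (λ g s a → g ℂS.:* (s ℂS.:- a) ℂS.:= g ℂS.:* s ℂS.:- g ℂS.:* a) ℂR.refl (γ k j) (S A (V k j) K x i) (𝐀 (μ k) F K x i)) ⟩
          γ k j • S A (V k j) K x -ᵛ γ k j • 𝐀 (μ k) F K x
            ≈⟨ -ᵛ-cong {u = γ k j • S A (V k j) K x} ≋-refl (≋-sym (W≋ K x)) ⟩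
          contribution W k j K x ∎
          where open ≋-Reasoning

        negligible≋ : ∀ W k j → (∀ K x → W k j K x ≋ 0ᵛ) → ∀ K x → γ k j • S A (V k j) K x ≋ contribution W k j K x
        negligible≋ W k j W≋0 K x i = ℂR.sym (ℂR.trans (ℂR.+-congˡ (ℂR.-‿cong (W≋0 K x i)))
          (ℂS.solve 1 (λ a → a ℂS.:- ℂS.:0 ℂS.:= a) ℂR.refl ((γ k j • S A (V k j) K x) i)))

        dominant-O : ∀ W k j (F : Fin (suc (toℕ j)) → UnitInterval → ℂ^ d) {g} →
          (∀ K x → W k j K x ≋ γ k j • 𝐀 (μ k) F K x) →
          UniformlyO (λ K x → S A (lastVector (associated k j)) K x -ᵛ 𝐀 (μ k) F K x) g → UniformlyO (contribution W k j) g
        dominant-O W k j F W≋ h = UniformlyO-cong {E = λ K x → γ k j • (S A (lastVector (associated k j)) K x -ᵛ 𝐀 (μ k) F K x)}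
          (dominant≋ W k j F W≋)
          (UniformlyO-• {E = λ K x → S A (lastVector (associated k j)) K x -ᵛ 𝐀 (μ k) F K x} (γ k j) h)

        negligible-O : ∀ W k j {g} → (∀ K x → W k j K x ≋ 0ᵛ) →
          UniformlyO (λ K x → S A (V k j) K x) g → UniformlyO (contribution W k j) g
        negligible-O W k j W≋0 h = UniformlyO-cong {E = λ K x → γ k j • S A (V k j) K x} (negligible≋ W k j W≋0)
          (UniformlyO-• {E = λ K x → S A (V k j) K x} (γ k j) h)

        module _ (W : (k : Fin chains) → Fin (ν k) → ℕ → UnitInterval → ℂ^ d)
          (dominant : ∀ k j (λ⋆<μ : λ⋆ < ∣ μ k ∣) K x → W k j K x ≋ γ k j • 𝐀 (μ k) (Solved.F (dominant-solved k j λ⋆<μ)) K x)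
          (negligible : ∀ k j → ¬ λ⋆ < ∣ μ k ∣ → ∀ K x → W k j K x ≋ 0ᵛ) where

          contribution-O : ∀ {λ₁} → λ⋆ < λ₁ → ∀ k j → UniformlyO (contribution W k j) (λ K → λ₁ ^ K)
          contribution-O {λ₁} λ⋆<λ₁ k j = by-case em
            where
            by-case : Dec (λ⋆ < ∣ μ k ∣) → UniformlyO (contribution W k j) (λ K → λ₁ ^ K)
            by-case (yes p) = dominant-O W k j (Solved.F (dominant-solved k j p)) (dominant k j p)
              (Solved.expansion (dominant-solved k j p) (positive λ⋆<λ₁) (jsr⇒contraction A jsr λ⋆<λ₁))
            by-case (no ¬p) = negligible-O W k j (negligible k j ¬p) (subordinate (jordan⇒twist (isChain k)) ¬p λ⋆<λ₁ j)

          module _ (attained : IsAttained A λ⋆) where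
            private
              contraction = attained⇒contraction A jsr attained

            -- For λ⋆ = 0 the gauge λ⋆^K K^m is 0 for K ≥ 1, so that the contributions themselves
            -- have to vanish from some K on.
            contribution-killed : λ⋆ ≈ 0# → ∀ {g} k j → UniformlyO (contribution W k j) g
            contribution-killed λ⋆≈0 {g} k j = by-case em
              where
              by-case : Dec (λ⋆ < ∣ μ k ∣) → UniformlyO (contribution W k j) g
              by-case (yes p) = dominant-O W k j (Solved.F (dominant-solved k j p)) (dominant k j p)
                (UniformlyO-vanishing (proj₁ vanish) (proj₂ vanish))
                where vanish = Solved.exact (dominant-solved k j p) λ⋆≈0 contraction
              by-case (no ¬p) = negligible-O W k j (negligible k j ¬p) (UniformlyO-vanishing (proj₁ vanish) (proj₂ vanish (V k j)))
                where vanish = partialSum-killed λ⋆≈0 contraction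

            -- Only ∣μ∣ = λ⋆ with γ ≠ 0 requires a power of K: there V has height j + 1, which is at
            -- most m. Larger and smaller eigenvalues leave O(λ⋆^K), and γ = 0 leaves nothing.
            contribution-critical : 0# < λ⋆ → ∀ {m} → IsMaximalHeight 𝒱 λ⋆ γ m → ∀ k j →
              UniformlyO (contribution W k j) (λ K → λ⋆ ^ K * ofℕ K ^ m)
            contribution-critical 0<λ⋆ {m} maximal k j = by-case em em em
              where
              by-case : Dec (λ⋆ < ∣ μ k ∣) → Dec (∣ μ k ∣ ≈ λ⋆) → Dec (γ k j ≈ᶜ 0ᶜ) →
                UniformlyO (contribution W k j) (λ K → λ⋆ ^ K * ofℕ K ^ m)
              by-case (yes p) _ _ = dominant-O W k j (Solved.F (dominant-solved k j p)) (dominant k j p)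
                (UniformlyO-polynomial (<⇒≤ 0<λ⋆) m (Solved.expansion (dominant-solved k j p) 0<λ⋆ contraction))
              by-case (no ¬p) (no μ≉λ⋆) _ = negligible-O W k j (negligible k j ¬p)
                (UniformlyO-polynomial (<⇒≤ 0<λ⋆) m (Bound.bound-< (jordan⇒twist (isChain k)) 0<λ⋆ contraction j (≮⇒≥ ¬p , μ≉λ⋆)))
              by-case (no ¬p) (yes μ≈λ⋆) (yes γ≈0) = UniformlyO-vanishing 0 λ K _ x →
                ≋-trans (≋-sym (negligible≋ W k j (negligible k j ¬p) K x))
                  (≋-trans (•-cong {u = S A (V k j) K x} γ≈0 ≋-refl) (•-zeroˡ (S A (V k j) K x)))
              by-case (no ¬p) (yes μ≈λ⋆) (no γ≉0) = negligible-O W k j (negligible k j ¬p)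
                (critical (jordan⇒twist (isChain k)) 0<λ⋆ contraction μ≈λ⋆ j
                  (proj₁ maximal k j (suc (toℕ j)) (μ≈λ⋆ , γ≉0) (basis-height 𝒱 k j)))

            contribution-attained : ∀ {m} → IsMaximalHeight 𝒱 λ⋆ γ m → ∀ k j →
              UniformlyO (contribution W k j) (λ K → λ⋆ ^ K * ofℕ K ^ m)
            contribution-attained {m} maximal k j = by-case em
              where
              by-case : Dec (λ⋆ ≈ 0#) → UniformlyO (contribution W k j) (λ K → λ⋆ ^ K * ofℕ K ^ m)
              by-case (yes λ⋆≈0) = contribution-killed λ⋆≈0 k j
              by-case (no λ⋆≉0) = contribution-critical (0≤λ⋆ A jsr , λ eq → λ⋆≉0 (R.sym eq)) maximal k j

        module _ (F : (k : Fin chains) (j : Fin (ν k)) → Fin (suc (toℕ j)) → UnitInterval → ℂ^ d)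
          (solutions : ∀ k j → λ⋆ < ∣ μ k ∣ → IsDilationSolution A (μ k) (associated k j) (F k j)) where

          dominantPart : (k : Fin chains) → Fin (ν k) → ℕ → UnitInterval → ℂ^ d
          dominantPart k j K x = (γ k j • 𝐀 (μ k) (F k j) K x) when (λ⋆ < ∣ μ k ∣)

          -- The theorem admits any family F of solutions; uniqueness identifies it with the one
          -- constructed.
          dominantPart-solved : ∀ k j (λ⋆<μ : λ⋆ < ∣ μ k ∣) K x →
            dominantPart k j K x ≋ γ k j • 𝐀 (μ k) (Solved.F (dominant-solved k j λ⋆<μ)) K x
          dominantPart-solved k j λ⋆<μ K x = ≋-trans (when-yes λ⋆<μ) (•-congˡ (γ k j) (binomialSum-cong (μ k) K
            (λ i → dilation-unique (positive λ⋆<μ) (solutions k j λ⋆<μ) (Solved.solution (dominant-solved k j λ⋆<μ)) i x)))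

          dominantPart-negligible : ∀ k j → ¬ λ⋆ < ∣ μ k ∣ → ∀ K x → dominantPart k j K x ≋ 0ᵛ
          dominantPart-negligible k j ¬p K x = when-no ¬p

          error-bounds : ∀ {v} → v ≋ ∑∑ ν (λ k j → γ k j • V k j) →
            let error = λ K x → S A v K x -ᵛ ∑∑ ν (λ k j → dominantPart k j K x) in
            (∀ λ₁ → λ⋆ < λ₁ → UniformlyO error (λ K → λ₁ ^ K)) ×
            (IsAttained A λ⋆ → ∀ m → IsMaximalHeight 𝒱 λ⋆ γ m → UniformlyO error (λ K → λ⋆ ^ K * ofℕ K ^ m))
          error-bounds v≋ =
            (λ λ₁ λ⋆<λ₁ → error-sum v≋ dominantPart
              (contribution-O dominantPart dominantPart-solved dominantPart-negligible λ⋆<λ₁)) ,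
            (λ attained m maximal → error-sum v≋ dominantPart
              (contribution-attained dominantPart dominantPart-solved dominantPart-negligible attained maximal))

        record Terms (k : Fin chains) (j : Fin (ν k)) : Set where
          field
            list  : List (ExpansionTerm d)
          total : ℕ → UnitInterval → ℂ^ d
          total K x = ∑ᴸ (λ t → ExpansionTerm.value t K x) list
          field
            bound : ∀ {λ₁} → λ⋆ < λ₁ → UniformlyO (contribution (λ _ _ → total) k j) (λ K → λ₁ ^ K)

        terms : ∀ k j → Terms k j
        terms k j = by-case em
          where
          by-case : Dec (λ⋆ < ∣ μ k ∣) → Terms k j
          by-case (yes p) = record
            { list  = List.tabulate t
            ; bound = λ λ⋆<λ₁ → dominant-O (λ _ _ → W) k j F W≋ (expansion (positive λ⋆<λ₁) (jsr⇒contraction A jsr λ⋆<λ₁))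
            }
            where
            open Solved (dominant-solved k j p)
            t = expansionTerm (positive p) (γ k j) F (IsDilationSolution.continuous solution)
            W : ℕ → UnitInterval → ℂ^ d
            W K x = ∑ᴸ (λ t → ExpansionTerm.value t K x) (List.tabulate t)
            W≋ : ∀ K x → W K x ≋ γ k j • 𝐀 (μ k) F K x
            W≋ K x = ≋-trans (∑ᴸ-tabulate (λ t → ExpansionTerm.value t K x) t)
              (expansionTerm-sum (positive p) (γ k j) F (IsDilationSolution.continuous solution) K x)
          by-case (no ¬p) = record
            { list  = []
            ; bound = λ λ⋆<λ₁ → negligible-O (λ _ _ _ _ → 0ᵛ) k j (λ _ _ → ≋-refl)
                (subordinate (jordan⇒twist (isChain k)) ¬p λ⋆<λ₁ j)
            }

        termSum : (k : Fin chains) → Fin (ν k) → ℕ → UnitInterval → ℂ^ d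
        termSum k j = Terms.total (terms k j)

        expansion-terms : ∀ {v} → v ≋ ∑∑ ν (λ k j → γ k j • V k j) → Σ[ ts ∈ List (ExpansionTerm d) ]
          ∀ λ₁ → λ⋆ < λ₁ →
            UniformlyO (λ K x → S A v K x -ᵛ ∑ᴸ (λ t → ExpansionTerm.value t K x) ts) (λ K → λ₁ ^ K)
        expansion-terms {v} v≋ = allTerms , λ λ₁ λ⋆<λ₁ →
          UniformlyO-cong {E = λ K x → S A v K x -ᵛ ∑∑ ν (λ k j → termSum k j K x)}
            (λ K x → -ᵛ-cong {u = S A v K x} ≋-refl (allTerms-sum K x))
            (error-sum v≋ termSum (λ k j → Terms.bound (terms k j) λ⋆<λ₁))
          where
          allTerms : List (ExpansionTerm d)
          allTerms = List.concat (List.tabulate (λ k → List.concat (List.tabulate (λ j → Terms.list (terms k j)))))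
          allTerms-sum : ∀ K x → ∑∑ ν (λ k j → termSum k j K x) ≋ ∑ᴸ (λ t → ExpansionTerm.value t K x) allTerms
          allTerms-sum K x = ≋-sym (≋-trans
            (∑ᴸ-concat (λ t → ExpansionTerm.value t K x) (λ k → List.concat (List.tabulate (λ j → Terms.list (terms k j)))))
            (∑-cong (λ k → ∑ᴸ-concat (λ t → ExpansionTerm.value t K x) (λ j → Terms.list (terms k j)))))

  -- ν = 0 is excluded because V ≠ 0 lies in its own cyclic subspace; `lastVector` would then be its
  -- default 0ᵛ.
  last-of-height : ∀ {d ν} {Q : Matrix d} (Vs : Fin ν → ℂ^ d) {V} → ¬ V ≋ 0ᵛ → HasHeight Q V ν →
    (∀ j → suc (toℕ j) ≡ ν → Vs j ≋ V) → lastVector Vs ≋ V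
  last-of-height {ν = zero}  {Q} Vs {V} V≉0 height last = ⊥-elim (height-positive Q V V≉0 height)
  last-of-height {ν = suc n} Vs V≉0 height last = last (fromℕ n) (≡.cong suc (Fin.toℕ-fromℕ n))

theorem2 :
  (em : ExcludedMiddle 0ℓ) (R : CompleteOrderedField) →
  let open Analysis em R in
  (B d : ℕ) → 2 ℕ.≤ B → 1 ℕ.≤ d →
  (rep : LinearRepresentation B d) →
  let open LinearRepresentation rep in
  (λ⋆ : ℝ) → IsJointSpectralRadius A λ⋆ →
  -- (a)
  ( (ρ : ℝ) (ω : ℂ) → λ⋆ < ρ → ∣ ω ∣ ≈ 1# →
    (V : ℂ^ d) (ν : ℕ) (Vs : Fin ν → ℂ^ d) →
    let μ = ofℝ ρ *ᶜ ω in
    IsGeneralizedEigenvector Q μ V → HasHeight Q V ν →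
    LinearlyIndependent Vs → IsJordanChain Q μ Vs →
    (∀ j → suc (toℕ j) ≡ ν → Vs j ≋ V) →
    (∀ K → (Q ^ᴹ K) ⊙ V ≋ binomialSum μ K Vs) ×
    (Σ[ F ∈ (Fin ν → UnitInterval → ℂ^ d) ]
      IsDilationSolution A μ Vs F ×
      (∀ G → IsDilationSolution A μ Vs G → ∀ j x → G j x ≋ F j x) ×
      (∀ λ₁ → λ⋆ < λ₁ →
        UniformlyO (λ K x → S A V K x -ᵛ 𝐀 μ F K x) (λ K → λ₁ ^ K)))) ×
  -- (b) and (c)
  ( (𝒱 : JordanBasis Q) →
    let open JordanBasis 𝒱 in
    (γ : (k : Fin chains) → Fin (ν k) → ℂ) →
    C ≋ ∑∑ ν (λ k j → γ k j • V k j) →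
    ( (F : (k : Fin chains) (j : Fin (ν k)) → Fin (suc (toℕ j)) → UnitInterval → ℂ^ d) →
      (∀ k j → λ⋆ < ∣ μ k ∣ → IsDilationSolution A (μ k) (associated k j) (F k j)) →
      let error = λ K x → S A C K x -ᵛ
            ∑∑ ν (λ k j → (γ k j • 𝐀 (μ k) (F k j) K x) when (λ⋆ < ∣ μ k ∣)) in
      (∀ λ₁ → λ⋆ < λ₁ → UniformlyO error (λ K → λ₁ ^ K)) ×
      (IsAttained A λ⋆ → ∀ m → IsMaximalHeight 𝒱 λ⋆ γ m →
        UniformlyO error (λ K → λ⋆ ^ K * ofℕ K ^ m))) ×
    (Σ[ terms ∈ List (ExpansionTerm d) ]
      ∀ λ₁ → λ⋆ < λ₁ →
        UniformlyO (λ K x → S A C K x -ᵛ ∑ᴸ (λ t → ExpansionTerm.value t K x) terms)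
                   (λ K → λ₁ ^ K)))
theorem2 em R B d 2≤B _ rep λ⋆ jsr =
  (λ ρ ω λ⋆<ρ ∣ω∣≈1 V ν Vs (V≉0 , _) height _ chain last →
    solution-of-chain 2≤B A jsr (<-≤-trans λ⋆<ρ (RO.reflexive (R.sym (∣μ∣≈ρ ρ ω λ⋆<ρ ∣ω∣≈1)))) V Vs
      (jordan⇒twist chain) (last-of-height {Q = Q} Vs V≉0 height last)) ,
  λ 𝒱 γ C≋ → (λ F solutions → error-bounds 2≤B A jsr 𝒱 γ F solutions C≋) , expansion-terms 2≤B A jsr 𝒱 γ C≋
  where
  open Analysis em R
  open Development em R
  open LinearRepresentation rep

  ∣μ∣≈ρ : ∀ ρ ω → λ⋆ < ρ → ∣ ω ∣ ≈ 1# → ∣ ofℝ ρ *ᶜ ω ∣ ≈ ρ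
  ∣μ∣≈ρ ρ ω λ⋆<ρ ∣ω∣≈1 = R.trans (∣∣-* (ofℝ ρ) ω) (R.trans
    (R.*-cong (∣ofℝ∣ (<⇒≤ (≤-<-trans (0≤λ⋆ A jsr) λ⋆<ρ))) ∣ω∣≈1) (R.*-identityʳ ρ))
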